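{- The problem $1|er|\sum w_jU_j$ (given jobs $J$ with processing times $p_j$, due dates $d_j$ and weights $w_j$, a subset $J^r\subseteq J$ and a budget $K^r$, find a sequence of $J$ minimizing the weighted number of tardy jobs $\sum_{j\in J}w_jU_j$ among all sequences with renting period of length $er\le K^r$) can be solved in $\mathrm{O}(nP^4)$ time, where $n=|J|$ and $P=\sum_{j\in J}p_j$.
   Context: An instance has a finite set $J$ of $n$ jobs; job $j$ has a non-negative integer processing time $p_j$, a due date $d_j$ and a non-negative integer weight $w_j$. A non-empty subset $J^r\subseteq J$ (the r-jobs) requires an external resource. A sequence is a permutation of $J$; the jobs are processed one at a time on a single machine in this order, non-preemptively, from time $0$ without idle time. $C_j$ is the completion time of job $j$; $U_j=1$ if $C_j>d_j$ (job $j$ is tardy) and $U_j=0$ otherwise. The resource is rented once, without interruption, from the start of the first r-job to the completion of the last r-job, so $er=\max_{j\in J^r} C_j-\min_{j\in J^r}(C_j-p_j)$. -}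

module Defs where

open import Algebra.Properties.CommutativeMonoid.Sum using (sum)
open import Data.Bool.Base using (if_then_else_)
open import Data.Fin.Base using (Fin; toℕ; fromℕ<)
import Data.Fin.Properties as Fin
open import Data.Fin.Permutation using (Permutation′; _⟨$⟩ʳ_; _⟨$⟩ˡ_)
open import Data.Fin.Subset using (Subset; Nonempty)
open import Data.Fin.Subset.Properties using (_∈?_)
open import Data.Integer.Base as ℤ using (ℤ; +_; -[1+_]; 0ℤ; 1ℤ)
import Data.Integer.Properties as ℤ
open import Data.List.Base using (List; filter; allFin; map)
open import Data.List.Extrema.Nat using (max; min)
open import Data.Maybe.Base using (Maybe; just; nothing)
open import Data.Nat.Base using (ℕ; suc; _+_; _*_; _∸_; _≤_)
open import Data.Nat.Properties using (_≟_; _<?_; +-0-commutativeMonoid)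
open import Data.Product.Base using (∃-syntax; _×_)
open import Relation.Binary.Definitions using (DecidableEquality)
open import Relation.Binary.PropositionalEquality.Core using (_≡_)
open import Relation.Nullary.Decidable using (yes; no; does)
open import Relation.Nullary.Negation using (¬_)

------------------------------------------------------------------------
-- The scheduling problem 1|er|Σ wⱼUⱼ

record Instance : Set where
  field
    n           : ℕ
    p           : Fin n → ℕ
    d           : Fin n → ℤ
    w           : Fin n → ℕ
    Jʳ          : Subset n
    Jʳ-nonempty : Nonempty Jʳ
    Kʳ          : ℤ

total : ∀ {n} → (Fin n → ℕ) → ℕ
total f = sum +-0-commutativeMonoid f

module _ (I : Instance) where
  open Instance I

  P : ℕ
  P = total p

  -- π ⟨$⟩ʳ k is the job in position k, and π ⟨$⟩ˡ j the position of job j.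
  Sequence : Set
  Sequence = Permutation′ n

  C : Sequence → Fin n → ℕ
  C π j = total λ i → if does (π ⟨$⟩ˡ i Fin.≤? π ⟨$⟩ˡ j) then p i else 0

  U : Sequence → Fin n → ℕ
  U π j = if does (d j ℤ.<? + C π j) then 1 else 0

  weightedTardy : Sequence → ℕ
  weightedTardy π = total λ j → w j * U π j

  rJobs : List (Fin n)
  rJobs = filter (_∈? Jʳ) (allFin n)

  -- The default values 0 of max and P of min have no effect, since Jʳ is
  -- non-empty and all times lie between 0 and P.  No ∸ truncates: p j is a
  -- summand of C π j, and the maximum is at least the minimum.
  er : Sequence → ℕ
  er π = max 0 (map (C π) rJobs) ∸ min P (map (λ j → C π j ∸ p j) rJobs)

  Feasible : Sequence → Set
  Feasible π = + er π ℤ.≤ Kʳ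

  Optimal : Sequence → Set
  Optimal π = Feasible π ×
              (∀ π′ → Feasible π′ → weightedTardy π ≤ weightedTardy π′)

  -- The budget may be too small for any sequence; a correct answer then
  -- reports this.
  CorrectAnswer : Maybe Sequence → Set
  CorrectAnswer (just π) = Optimal π
  CorrectAnswer nothing  = ∀ π → ¬ Feasible π

------------------------------------------------------------------------
-- The model of computation: structured programs for a random access
-- machine with integer cells and uniform cost.  Addition and subtraction
-- are the only arithmetic.  Multiplication is left out because at unit cost
-- it would allow numbers of exponential length to be built in linear time.
--
-- A program mentions finitely many variables and one-dimensional arrays,
-- each named by a natural number.  Arrays are indexed by arbitrary integers.

data Expr : Set where
  lit     : ℤ → Expr
  var     : ℕ → Expr
  _[_]    : ℕ → Expr → Expr
  _⊕_ _⊖_ : Expr → Expr → Expr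

data Test : Set where
  _≼_ : Expr → Expr → Test

data Program : Set where
  skip          : Program
  _≔_           : ℕ → Expr → Program
  _[_]≔_        : ℕ → Expr → Expr → Program
  _⨾_           : Program → Program → Program
  IF_THEN_ELSE_ : Test → Program → Program → Program
  WHILE_DO_     : Test → Program → Program

infixl 6 _⊕_ _⊖_
infix  4 _≼_
infix  3 _≔_ _[_]≔_
infixr 2 IF_THEN_ELSE_ WHILE_DO_
infixr 1 _⨾_

record Store : Set where
  constructor ⟪_,_⟫
  field
    vars : ℕ → ℤ
    arrs : ℕ → ℤ → ℤ

open Store public

update : ∀ {A B : Set} → DecidableEquality A → (A → B) → A → B → A → B
update _≈?_ f x v y = if does (x ≈? y) then v else f y

setVar : ℕ → ℤ → Store → Store
setVar x v σ = ⟪ update _≟_ (vars σ) x v , arrs σ ⟫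

setArr : ℕ → ℤ → ℤ → Store → Store
setArr a i v σ = ⟪ vars σ , update _≟_ (arrs σ) a (update ℤ._≟_ (arrs σ a) i v) ⟫

eval : Expr → Store → ℤ
eval (lit z)   σ = z
eval (var x)   σ = vars σ x
eval (a [ e ]) σ = arrs σ a (eval e σ)
eval (e ⊕ f)   σ = eval e σ ℤ.+ eval f σ
eval (e ⊖ f)   σ = eval e σ ℤ.- eval f σ

Holds : Test → Store → Set
Holds (e ≼ f) σ = eval e σ ℤ.≤ eval f σ

-- One unit for every literal, read and arithmetic operation.
cost : Expr → ℕ
cost (lit z)   = 1
cost (var x)   = 1
cost (a [ e ]) = suc (cost e)
cost (e ⊕ f)   = suc (cost e + cost f)
cost (e ⊖ f)   = suc (cost e + cost f)

costᵗ : Test → ℕ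
costᵗ (e ≼ f) = suc (cost e + cost f)

-- ⟨ c , σ ⟩⇓ τ [ t ]: program c, started in store σ, halts in store τ after
-- t units of time.
data ⟨_,_⟩⇓_[_] : Program → Store → Store → ℕ → Set where

  ⇓-skip : ∀ {σ} → ⟨ skip , σ ⟩⇓ σ [ 1 ]

  ⇓-var : ∀ {x e σ} →
    ⟨ x ≔ e , σ ⟩⇓ setVar x (eval e σ) σ [ suc (cost e) ]

  ⇓-arr : ∀ {a i e σ} →
    ⟨ a [ i ]≔ e , σ ⟩⇓ setArr a (eval i σ) (eval e σ) σ
      [ suc (cost i + cost e) ]

  ⇓-seq : ∀ {c₁ c₂ σ τ υ t₁ t₂} →
    ⟨ c₁ , σ ⟩⇓ τ [ t₁ ] → ⟨ c₂ , τ ⟩⇓ υ [ t₂ ] →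
    ⟨ c₁ ⨾ c₂ , σ ⟩⇓ υ [ t₁ + t₂ ]

  ⇓-then : ∀ {b c₁ c₂ σ τ t} →
    Holds b σ → ⟨ c₁ , σ ⟩⇓ τ [ t ] →
    ⟨ IF b THEN c₁ ELSE c₂ , σ ⟩⇓ τ [ costᵗ b + t ]

  ⇓-else : ∀ {b c₁ c₂ σ τ t} →
    ¬ Holds b σ → ⟨ c₂ , σ ⟩⇓ τ [ t ] →
    ⟨ IF b THEN c₁ ELSE c₂ , σ ⟩⇓ τ [ costᵗ b + t ]

  ⇓-exit : ∀ {b c σ} →
    ¬ Holds b σ →
    ⟨ WHILE b DO c , σ ⟩⇓ σ [ costᵗ b ]

  ⇓-loop : ∀ {b c σ τ υ t₁ t₂} →
    Holds b σ → ⟨ c , σ ⟩⇓ τ [ t₁ ] → ⟨ WHILE b DO c , τ ⟩⇓ υ [ t₂ ] →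
    ⟨ WHILE b DO c , σ ⟩⇓ υ [ costᵗ b + (t₁ + t₂) ]

------------------------------------------------------------------------
-- Input and output conventions

-- The entries 0, …, n - 1 of the array hold f; all other entries are 0.
fromVector : ∀ {n} → (Fin n → ℤ) → ℤ → ℤ
fromVector     f -[1+ _ ] = 0ℤ
fromVector {n} f (+ i) with i <? n
... | yes i<n = f (fromℕ< i<n)
... | no  _   = 0ℤ

-- Variables 0 and 1 hold n and Kʳ.  Arrays 0, 1, 2 and 3 hold p, d, w and the
-- characteristic function of Jʳ.
input : Instance → Store
input I = ⟪ inputVars , inputArrs ⟫
  where
  open Instance I

  inputVars : ℕ → ℤ
  inputVars 0 = + n
  inputVars 1 = Kʳ
  inputVars _ = 0ℤ

  inputArrs : ℕ → ℤ → ℤ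
  inputArrs 0 = fromVector λ j → + p j
  inputArrs 1 = fromVector d
  inputArrs 2 = fromVector λ j → + w j
  inputArrs 3 = fromVector λ j → if does (j ∈? Jʳ) then 1ℤ else 0ℤ
  inputArrs _ = λ _ → 0ℤ

-- Variable 2 tells whether a sequence was found.  If so, array 4 lists the jobs
-- in their order in the sequence.
Outputs : (I : Instance) → Store → Maybe (Sequence I) → Set
Outputs I σ nothing  = vars σ 2 ≡ 0ℤ
Outputs I σ (just π) = vars σ 2 ≡ 1ℤ ×
                       (∀ k → arrs σ 4 (+ toℕ k) ≡ + toℕ (π ⟨$⟩ʳ k))

SolvesWithin : Program → Instance → ℕ → Set
SolvesWithin c I b =
  ∃[ τ ] ∃[ t ] ∃[ answer ]
    ⟨ c , input I ⟩⇓ τ [ t ] × t ≤ b × Outputs I τ answer × CorrectAnswer I answer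

-- One program and one constant factor serve all instances.
SolvableInTimeO : (Instance → ℕ) → Set
SolvableInTimeO bound =
  ∃[ c ] ∃[ k ] ∀ I → SolvesWithin c I (k * bound I)

{-# OPTIONS --safe #-}

-- Call the jobs processed during the renting period the block.  A sequence can be
-- rearranged, without changing which jobs are early, into five consecutive
-- classes, each in order of due dates: early jobs before the block, early and
-- late jobs of the block, early and late jobs after it.  Late jobs that are not
-- r-jobs can be moved to the very end.  So a sequence amounts to a choice of the
-- start S and the end F of the block and of a class for every job.
--
-- Go through the jobs in order of due dates.  While the due dates are at most S,
-- a job can only be early before the block; once they exceed S, every job before
-- the block is early as long as there is room for it, and likewise for the block
-- once they exceed F.  Hence at any time only one of the three groups of early
-- jobs needs a clock, and the state consists of F, this clock, and the
-- capacities left before and in the block: O(P⁴) states per job.  One table of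
-- least weights, filled backwards over the jobs, serves all choices of S and F.

module Submission where

open import Defs
import Algebra.Properties.CommutativeMonoid.Sum as Sum
open import Data.Bool.Base using (Bool; true; false; T; not; _∧_; _∨_; if_then_else_)
open import Data.Bool.ListAction using (all)
open import Data.Bool.Properties using (T-∧; T-∨; T?; ∧-conicalˡ; ∧-conicalʳ; ∨-conicalˡ; ∨-conicalʳ)
open import Data.Empty using (⊥; ⊥-elim)
open import Data.Fin.Base as Fin using (Fin; toℕ; fromℕ<; punchOut) renaming (zero to fzero; suc to fsuc)
import Data.Fin.Properties as Fin
open import Data.Fin.Permutation using (Permutation′; permutation; _⟨$⟩ˡ_; _⟨$⟩ʳ_; inverseʳ; inverseˡ; _∘ₚ_)
import Data.Fin.Subset as Subset
open import Data.Fin.Subset.Properties using (_∈?_)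
open import Data.Integer.Base as ℤ using (ℤ; +_; -[1+_]; 0ℤ; 1ℤ)
import Data.Integer.Properties as ℤ
open import Data.List.Base using (List; []; _∷_; foldl; filter; allFin; map)
open import Data.List.Extrema.Nat
open import Data.List.Membership.Propositional using (_∈_)
open import Data.List.Membership.Propositional.Properties using (∈-filter⁺; ∈-allFin; ∈-map⁺)
open import Data.List.Relation.Unary.All as All using (All; []; _∷_)
import Data.List.Relation.Unary.All.Properties as All
open import Data.List.Relation.Unary.Any using (here; there)
open import Data.Maybe.Base using (just; nothing)
open import Data.Nat.Base
open import Data.Nat.Properties
open import Data.Nat.Solver using (module +-*-Solver)
open import Data.Product.Base using (∃; ∃-syntax; _×_; _,_; proj₁; proj₂)
open import Data.Sum.Base using (_⊎_; inj₁; inj₂)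
open import Data.Unit.Base using (⊤; tt)
open import Function.Base using (_∘_; _$_; id)
open import Function.Bundles using (Equivalence)
open import Relation.Binary.Definitions using (tri<; tri≈; tri>)
open import Relation.Binary.PropositionalEquality hiding ([_])
open import Relation.Nullary.Decidable using (Dec; yes; no; does; _×-dec_; dec-true; dec-false)
open import Relation.Nullary.Negation using (¬_; contradiction)

-- Sequences and assignments of classes are compared by inequalities only. A sequence yields an
-- assignment of the same weight that respects all capacities. An assignment yields a sequence that
-- is no heavier, since a job classed as late may happen to be early, and whose block may start
-- before `S` and end before `F`. With the minimality of the table this suffices for optimality.
--
-- All r-jobs lie in the block, early or late, so their total time `reserve` is deducted at the
-- outset and a late job then changes no capacity. The budget restricts only the pairs of `S` and
-- `F`, not the recursion; some pair is admissible exactly if `reserve` is at most `Kʳ`. The state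
-- does not contain `S` either: in phase 0 it is the sum of the clock and the room left.
--
-- Due dates are cut to the range from 0 to `P + 1`, which bounds the clocks and lets bucket sort
-- produce their order. Addresses of states are numbers to radix `P + 1`, and the machine cannot
-- multiply; the table of products used instead is smaller than the table of states by a factor of
-- `P + 1`, so it stays within the time bound.

open Sum +-0-commutativeMonoid using (sum-cong-≗; ∑-distrib-+; sum-permute)

-- Running times

record Run (c : Program) (σ : Store) (T : ℕ) (Q : Store → Set) : Set where
  constructor run
  field
    {final} : Store
    {time}  : ℕ
    halts   : ⟨ c , σ ⟩⇓ final [ time ]
    within  : time ≤ T
    post    : Q final

run-mono : ∀ {c σ T T′} {Q Q′ : Store → Set} → T ≤ T′ → (∀ {τ} → Q τ → Q′ τ) →
           Run c σ T Q → Run c σ T′ Q′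
run-mono T≤T′ Q⇒Q′ (run e t≤T q) = run e (≤-trans t≤T T≤T′) (Q⇒Q′ q)

-- The run of `d` is the postcondition of the run of `c`, so all that is known about the
-- intermediate store is at hand when the second run is built.
run-seq : ∀ {c d σ T U Q} → Run c σ T (λ τ → Run d τ U Q) → Run (c ⨾ d) σ (T + U) Q
run-seq (run e t≤T (run f u≤U q)) = run (⇓-seq e f) (+-mono-≤ t≤T u≤U) q

run-then : ∀ {c d σ T U Q R} → Run c σ T Q → (∀ τ → Q τ → Run d τ U R) → Run (c ⨾ d) σ (T + U) R
run-then r k = run-seq (run-mono ≤-refl (λ {τ} → k τ) r)

run-then* : ∀ k l W {c d σ Q R} → Run c σ (k * W) Q → (∀ τ → Q τ → Run d τ (l * W) R) → Run (c ⨾ d) σ ((k + l) * W) R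
run-then* k l W r f = run-mono (≤-reflexive (sym (*-distribʳ-+ W k l))) id (run-then r f)

run-yes : ∀ {b c d σ T Q} → Holds b σ → Run c σ T Q → Run (IF b THEN c ELSE d) σ (costᵗ b + T) Q
run-yes {b} h (run e t≤T q) = run (⇓-then h e) (+-monoʳ-≤ (costᵗ b) t≤T) q

run-no : ∀ {b c d σ T Q} → ¬ Holds b σ → Run d σ T Q → Run (IF b THEN c ELSE d) σ (costᵗ b + T) Q
run-no {b} ¬h (run e t≤T q) = run (⇓-else ¬h e) (+-monoʳ-≤ (costᵗ b) t≤T) q

-- A syntactic over-approximation of the cells that a program may change. It computes, so `refl`
-- proves that a concrete program spares a cell.
writesVar writesArr : Program → ℕ → Bool
writesVar skip                      x = false
writesVar (y ≔ e)                   x = does (y ≟ x)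
writesVar (a [ i ]≔ e)              x = false
writesVar (c ⨾ d)                   x = writesVar c x ∨ writesVar d x
writesVar (IF b THEN c ELSE d)      x = writesVar c x ∨ writesVar d x
writesVar (WHILE b DO c)            x = writesVar c x
writesArr skip                      x = false
writesArr (y ≔ e)                   x = false
writesArr (a [ i ]≔ e)              x = does (a ≟ x)
writesArr (c ⨾ d)                   x = writesArr c x ∨ writesArr d x
writesArr (IF b THEN c ELSE d)      x = writesArr c x ∨ writesArr d x
writesArr (WHILE b DO c)            x = writesArr c x

varFrame : ∀ {c σ τ t} x → ⟨ c , σ ⟩⇓ τ [ t ] → writesVar c x ≡ false → vars τ x ≡ vars σ x
varFrame x ⇓-skip              w = refl
varFrame x (⇓-var {y})         w rewrite w = refl
varFrame x ⇓-arr               w = refl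
varFrame x (⇓-seq e f)         w =
  trans (varFrame x f (∨-conicalʳ _ _ w)) (varFrame x e (∨-conicalˡ _ _ w))
varFrame x (⇓-then _ e)        w = varFrame x e (∨-conicalˡ _ _ w)
varFrame x (⇓-else _ e)        w = varFrame x e (∨-conicalʳ _ _ w)
varFrame x (⇓-exit _)          w = refl
varFrame x (⇓-loop _ e f)      w = trans (varFrame x f w) (varFrame x e w)

arrFrame : ∀ {c σ τ t} a → ⟨ c , σ ⟩⇓ τ [ t ] → writesArr c a ≡ false → arrs τ a ≡ arrs σ a
arrFrame x ⇓-skip              w = refl
arrFrame x ⇓-var               w = refl
arrFrame x ⇓-arr               w rewrite w = refl
arrFrame x (⇓-seq e f)         w =
  trans (arrFrame x f (∨-conicalʳ _ _ w)) (arrFrame x e (∨-conicalˡ _ _ w))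
arrFrame x (⇓-then _ e)        w = arrFrame x e (∨-conicalˡ _ _ w)
arrFrame x (⇓-else _ e)        w = arrFrame x e (∨-conicalʳ _ _ w)
arrFrame x (⇓-exit _)          w = refl
arrFrame x (⇓-loop _ e f)      w = trans (arrFrame x f w) (arrFrame x e w)

record Frame (c : Program) (σ τ : Store) : Set where
  field
    sameVar : ∀ x → writesVar c x ≡ false → vars τ x ≡ vars σ x
    sameArr : ∀ a → writesArr c a ≡ false → arrs τ a ≡ arrs σ a

open Frame public

run-frame : ∀ {c σ T Q} → Run c σ T Q → Run c σ T (λ τ → Q τ × Frame c σ τ)
run-frame (run e t≤T q) =
  run e t≤T (q , record { sameVar = λ x → varFrame x e ; sameArr = λ a → arrFrame a e })

-- Loop-free programs

loopFree : Program → Bool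
loopFree (c ⨾ d)              = loopFree c ∧ loopFree d
loopFree (IF b THEN c ELSE d) = loopFree c ∧ loopFree d
loopFree (WHILE b DO c)       = false
loopFree _                    = true

holds? : ∀ b σ → Dec (Holds b σ)
holds? (e ≼ f) σ = eval e σ ℤ.≤? eval f σ

exec : Program → Store → Store
exec skip                 σ = σ
exec (x ≔ e)              σ = setVar x (eval e σ) σ
exec (a [ i ]≔ e)         σ = setArr a (eval i σ) (eval e σ) σ
exec (c ⨾ d)              σ = exec d (exec c σ)
exec (IF b THEN c ELSE d) σ = if does (holds? b σ) then exec c σ else exec d σ
exec (WHILE b DO c)       σ = σ

-- The costs of the two branches are added instead of maximised, as only a constant is at stake.
maxCost : Program → ℕ
maxCost skip                 = 1
maxCost (x ≔ e)              = suc (cost e)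
maxCost (a [ i ]≔ e)         = suc (cost i + cost e)
maxCost (c ⨾ d)              = maxCost c + maxCost d
maxCost (IF b THEN c ELSE d) = costᵗ b + (maxCost c + maxCost d)
maxCost (WHILE b DO c)       = 0

run-loopFree : ∀ c σ → loopFree c ≡ true → Run c σ (maxCost c) (_≡ exec c σ)
run-loopFree skip         σ l = run ⇓-skip ≤-refl refl
run-loopFree (x ≔ e)      σ l = run ⇓-var ≤-refl refl
run-loopFree (a [ i ]≔ e) σ l = run ⇓-arr ≤-refl refl
run-loopFree (c ⨾ d)      σ l with run-loopFree c σ (∧-conicalˡ _ _ l)
... | run e t≤ refl with run-loopFree d (exec c σ) (∧-conicalʳ (loopFree c) _ l)
... | run f u≤ refl = run (⇓-seq e f) (+-mono-≤ t≤ u≤) refl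
run-loopFree (IF b THEN c ELSE d) σ l with holds? b σ
... | yes h with run-loopFree c σ (∧-conicalˡ _ _ l)
...   | run e t≤ refl =
        run (⇓-then h e) (+-monoʳ-≤ (costᵗ b) (≤-trans t≤ (m≤m+n _ _))) refl
run-loopFree (IF b THEN c ELSE d) σ l | no ¬h with run-loopFree d σ (∧-conicalʳ (loopFree c) _ l)
...   | run e t≤ refl =
        run (⇓-else ¬h e) (+-monoʳ-≤ (costᵗ b) (≤-trans t≤ (m≤n+m _ (maxCost c)))) refl

run-exec : ∀ c {σ Q} → loopFree c ≡ true → Q (exec c σ) → Run c σ (maxCost c) Q
run-exec c {σ} l q with run-loopFree c σ l
... | run e t≤ refl = run e t≤ q

-- Counting loops

setVar-same : ∀ x {v} σ → vars (setVar x v σ) x ≡ v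
setVar-same x {v} σ = cong (λ d → if does d then v else vars σ x) (≟-diag {x} refl)

infixr 2 FOR_<_DO_

FOR_<_DO_ : ℕ → ℕ → Program → Program
FOR x < y DO c = x ≔ lit 0ℤ ⨾ WHILE var x ⊕ lit (+ 1) ≼ var y DO (c ⨾ x ≔ var x ⊕ lit (+ 1))

-- `body` receives a frame back to the start of the loop, so `Inv` has to describe only what the
-- loop changes. The invariant is re-established in the store with the advanced counter, because the
-- increment follows `c`.
module _ {c : Program} {x y N T : ℕ} {σ₀ : Store} (Inv : ℕ → Store → Set)
  (x≢y : does (x ≟ y) ≡ false)
  (c-x : writesVar c x ≡ false) (c-y : writesVar c y ≡ false)
  (body : ∀ i τ → i < N → Frame (FOR x < y DO c) σ₀ τ → vars τ x ≡ + i → Inv i τ →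
          Run c τ T (λ υ → Inv (suc i) (setVar x (+ suc i) υ)))
  (y≡ : vars σ₀ y ≡ + N)
  where

  private
    b = var x ⊕ lit (+ 1) ≼ var y
    c⁺ = c ⨾ x ≔ var x ⊕ lit (+ 1)
    F = Frame (FOR x < y DO c) σ₀

    y≡′ : ∀ {σ} → F σ → vars σ y ≡ + N
    y≡′ fr = trans (sameVar fr y not-y) y≡
      where
      not-y : writesVar (FOR x < y DO c) y ≡ false
      not-y rewrite x≢y | c-y = refl

    next-frame : ∀ {σ τ v} → F σ → Frame c σ τ → F (setVar x v τ)
    next-frame {σ} {τ} {v} fr fc = record { sameVar = sv ; sameArr = sa }
      where
      sv : ∀ z → writesVar (FOR x < y DO c) z ≡ false → vars (setVar x v τ) z ≡ vars σ₀ z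
      sv z w = trans
        (cong (λ b → if b then v else vars τ z) (∨-conicalˡ (does (x ≟ z)) _ w))
        (trans (sameVar fc z (∨-conicalˡ _ _ (∨-conicalʳ (does (x ≟ z)) _ w)))
               (sameVar fr z w))
      sa : ∀ a → writesArr (FOR x < y DO c) a ≡ false → arrs τ a ≡ arrs σ₀ a
      sa a w = trans (sameArr fc a (∨-conicalˡ _ _ w)) (sameArr fr a w)

    loop : ∀ k i σ → k + i ≡ N → F σ → vars σ x ≡ + i → Inv i σ →
           Run (WHILE b DO c⁺) σ (5 + k * (T + 9)) (Inv N)
    loop zero i σ refl fr x≡ inv = run (⇓-exit exit) (m≤m+n 5 0) inv
      where
      exit : ¬ Holds b σ
      exit h rewrite x≡ | y≡′ fr | +-comm i 1 = <-irrefl refl (ℤ.drop‿+≤+ h)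
    loop (suc k) i σ eq fr x≡ inv = step (run-frame (body i σ i<N fr x≡ inv))
      where
      i<N : i < N
      i<N = subst (i <_) eq (s≤s (m≤n+m i k))
      enter : Holds b σ
      enter rewrite x≡ | y≡′ fr | +-comm i 1 = ℤ.+≤+ i<N
      step : Run c σ T (λ υ → Inv (suc i) (setVar x (+ suc i) υ) × Frame c σ υ) →
             Run (WHILE b DO c⁺) σ (5 + suc k * (T + 9)) (Inv N)
      step (run {τ} {t} e t≤T (inv′ , fc)) =
        conclude (loop k (suc i) τ′ (trans (+-suc k i) eq) (next-frame fr fc) x≡′ inv″)
        where
        τ′ = setVar x (vars τ x ℤ.+ + 1) τ
        incr : vars τ x ℤ.+ + 1 ≡ + suc i
        incr rewrite sameVar fc x c-x | x≡ | +-comm i 1 = refl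
        x≡′ : vars τ′ x ≡ + suc i
        x≡′ = trans (setVar-same x τ) incr
        inv″ : Inv (suc i) τ′
        inv″ = subst (λ v → Inv (suc i) (setVar x v τ)) (sym incr) inv′
        conclude : Run (WHILE b DO c⁺) τ′ (5 + k * (T + 9)) (Inv N) →
                   Run (WHILE b DO c⁺) σ (5 + suc k * (T + 9)) (Inv N)
        conclude (run {time = u} f u≤ q) = run (⇓-loop enter (⇓-seq e ⇓-var) f) time≤ q
          where
          open ≤-Reasoning
          time≤ : 5 + ((t + 4) + u) ≤ 5 + suc k * (T + 9)
          time≤ = begin
            5 + ((t + 4) + u)                  ≤⟨ +-monoʳ-≤ 5 (+-mono-≤ (+-monoˡ-≤ 4 t≤T) u≤) ⟩
            5 + ((T + 4) + (5 + k * (T + 9)))  ≡⟨ cong (λ z → 5 + z) (+-assoc (T + 4) 5 _) ⟨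
            5 + (((T + 4) + 5) + k * (T + 9))  ≡⟨ cong (λ z → 5 + (z + k * (T + 9))) (+-assoc T 4 5) ⟩
            5 + suc k * (T + 9)                ∎

  -- Initialisation costs 2, a test 5 and an increment 4: 7 outside the iterations and 9 in each of
  -- them. The sum 16 is what one level of nesting adds to a constant factor below.
  run-for : Inv 0 (setVar x 0ℤ σ₀) → Run (FOR x < y DO c) σ₀ (7 + N * (T + 9)) (Inv N)
  run-for inv = run-seq (run ⇓-var ≤-refl (loop N 0 (setVar x 0ℤ σ₀) (+-identityʳ N) start x≡ inv))
    where
    start : F (setVar x 0ℤ σ₀)
    start = record { sameVar = sv ; sameArr = λ _ _ → refl }
      where
      sv : ∀ z → writesVar (FOR x < y DO c) z ≡ false → vars (setVar x 0ℤ σ₀) z ≡ vars σ₀ z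
      sv z w rewrite ∨-conicalˡ (does (x ≟ z)) _ w = refl
    x≡ : vars (setVar x 0ℤ σ₀) x ≡ 0ℤ
    x≡ = setVar-same x σ₀

  -- With times measured in multiples of a product of loop bounds, nesting only adds constants.
  run-for* : ∀ {K X} → T ≤ K * X → 1 ≤ X → 1 ≤ N → Inv 0 (setVar x 0ℤ σ₀) →
             Run (FOR x < y DO c) σ₀ ((K + 16) * (N * X)) (Inv N)
  run-for* {K} {X} T≤ 1≤X 1≤N inv = run-mono time≤ id (run-for inv)
    where
    open ≤-Reasoning
    open +-*-Solver
    1≤NX = *-mono-≤ 1≤N 1≤X
    9N≤ : N * 9 ≤ 9 * (N * X)
    9N≤ = subst (_≤ 9 * (N * X)) (*-comm 9 N)
            (*-monoʳ-≤ 9 (subst (_≤ N * X) (*-identityʳ N) (*-monoʳ-≤ N 1≤X)))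
    time≤ : 7 + N * (T + 9) ≤ (K + 16) * (N * X)
    time≤ = begin
      7 + N * (T + 9)
        ≡⟨ cong (λ z → 7 + z) (*-distribˡ-+ N T 9) ⟩
      7 + (N * T + N * 9)
        ≤⟨ +-mono-≤ (*-monoʳ-≤ 7 1≤NX) (+-mono-≤ (*-monoʳ-≤ N T≤) 9N≤) ⟩
      7 * (N * X) + (N * (K * X) + 9 * (N * X))
        ≡⟨ solve 3 (λ n k x → con 7 :* (n :* x) :+ (n :* (k :* x) :+ con 9 :* (n :* x))
                              := (k :+ con 16) :* (n :* x)) refl N K X ⟩
      (K + 16) * (N * X) ∎

  run-for-flat : 1 ≤ N → Inv 0 (setVar x 0ℤ σ₀) → Run (FOR x < y DO c) σ₀ ((T + 16) * (N * 1)) (Inv N)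
  run-for-flat = run-for* {T} (≤-reflexive (sym (*-identityʳ T))) ≤-refl

-- Guarded sums and prefix sums

infixl 7 _when_

_when_ : ℕ → Bool → ℕ
v when b = if b then v else 0

when-true : ∀ v {b} → T b → v when b ≡ v
when-true v {true} _ = refl

when-false : ∀ v {b} → ¬ T b → v when b ≡ 0
when-false v {true}  ¬b = ⊥-elim (¬b _)
when-false v {false} ¬b = refl

when-≤ : ∀ v {b c} → (T b → T c) → v when b ≤ v when c
when-≤ v {true}  {c} b⇒c = ≤-reflexive (sym (when-true v {c} (b⇒c _)))
when-≤ v {false} b⇒c = z≤n

when-≡ : ∀ v {b c} → (T b → T c) → (T c → T b) → v when b ≡ v when c
when-≡ v b⇒c c⇒b = ≤-antisym (when-≤ v b⇒c) (when-≤ v c⇒b)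

-- Summed by `total-+≤`, this compares two disjoint sets of jobs with a common superset;
-- `when-cover` and `total-≤+` do the same for a covering by two sets.
when-disjoint : ∀ v {b c d} → (T b → T d) → (T c → T d) → (T b → T c → ⊥) →
                v when b + v when c ≤ v when d
when-disjoint v {true}  {true}  b⇒d c⇒d b#c = ⊥-elim (b#c _ _)
when-disjoint v {true}  {false} {d} b⇒d c⇒d b#c =
  subst (_≤ v when d) (sym (+-identityʳ v)) (when-≤ v {true} {d} b⇒d)
when-disjoint v {false} b⇒d c⇒d b#c = when-≤ v c⇒d

when-cover : ∀ v {b c d} → (T d → T b ⊎ T c) → v when d ≤ v when b + v when c
when-cover v {d = false} h = z≤n
when-cover v {b} {c} {true} h with h _
... | inj₁ tb = subst (λ z → v ≤ z + v when c) (sym (when-true v {b} tb)) (m≤m+n v _)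
... | inj₂ tc = subst (λ z → v ≤ v when b + z) (sym (when-true v {c} tc)) (m≤n+m v _)

total-cong : ∀ {n} {f g : Fin n → ℕ} → (∀ i → f i ≡ g i) → total f ≡ total g
total-cong = sum-cong-≗

total-mono : ∀ {n} {f g : Fin n → ℕ} → (∀ i → f i ≤ g i) → total f ≤ total g
total-mono {zero}  f≤g = z≤n
total-mono {suc n} f≤g = +-mono-≤ (f≤g fzero) (total-mono (f≤g ∘ fsuc))

total-≤+ : ∀ {n} {f g h : Fin n → ℕ} → (∀ i → h i ≤ f i + g i) → total h ≤ total f + total g
total-≤+ {n} {f} {g} h≤ = ≤-trans (total-mono {n} h≤) (≤-reflexive (∑-distrib-+ f g))

total-+≤ : ∀ {n} {f g h : Fin n → ℕ} → (∀ i → f i + g i ≤ h i) → total f + total g ≤ total h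
total-+≤ {n} {f} {g} ≤h = ≤-trans (≤-reflexive (sym (∑-distrib-+ f g))) (total-mono {n} ≤h)

total-permute : ∀ {n} (f : Fin n → ℕ) (π : Permutation′ n) → total f ≡ total (λ k → f (π ⟨$⟩ʳ k))
total-permute f π = sum-permute f π

term≤total : ∀ {n} (f : Fin n → ℕ) j → f j ≤ total f
term≤total f fzero    = m≤m+n _ _
term≤total f (fsuc j) = ≤-trans (term≤total (f ∘ fsuc) j) (m≤n+m _ _)

total-zero : ∀ {n} (f : Fin n → ℕ) → (∀ i → f i ≡ 0) → total f ≡ 0
total-zero {zero}  f f≡0 = refl
total-zero {suc n} f f≡0 = cong₂ _+_ (f≡0 fzero) (total-zero (f ∘ fsuc) (f≡0 ∘ fsuc))

total-at : ∀ {n} (f : Fin n → ℕ) j → total (λ i → f i when does (i Fin.≟ j)) ≡ f j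
total-at {suc n} f fzero    = trans (cong (λ z → f fzero + z) (total-zero {n} _ (λ _ → refl))) (+-identityʳ _)
total-at {suc n} f (fsuc j) = total-at (f ∘ fsuc) j

total-ones : ∀ n → total {n} (λ _ → 1) ≡ n
total-ones zero    = refl
total-ones (suc n) = cong suc (total-ones n)

prefix : (ℕ → ℕ) → ℕ → ℕ
prefix g k = total {k} (g ∘ toℕ)

prefix-suc : ∀ g k → prefix g (suc k) ≡ prefix g k + g k
prefix-suc g zero    = +-identityʳ (g 0)
prefix-suc g (suc k) = trans (cong (λ z → g 0 + z) (prefix-suc (g ∘ suc) k)) (sym (+-assoc (g 0) _ _))

prefix-≤ : ∀ g {k l} → k ≤ l → prefix g k ≤ prefix g l
prefix-≤ g z≤n       = z≤n
prefix-≤ g (s≤s k≤l) = +-monoʳ-≤ (g 0) (prefix-≤ (g ∘ suc) k≤l)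

prefix-≤+ : ∀ f g h k → (∀ i → i < k → h i ≤ f i + g i) → prefix h k ≤ prefix f k + prefix g k
prefix-≤+ f g h k h≤ = total-≤+ λ i → h≤ (toℕ i) (Fin.toℕ<n i)

prefix-+≤ : ∀ f g h k → (∀ i → i < k → f i + g i ≤ h i) → prefix f k + prefix g k ≤ prefix h k
prefix-+≤ f g h k ≤h = total-+≤ λ i → ≤h (toℕ i) (Fin.toℕ<n i)

total-below : ∀ {n} g k → k ≤ n → total {n} (λ i → g (toℕ i) when (toℕ i <ᵇ k)) ≡ prefix g k
total-below {n}     g zero    k≤n       = total-zero {n} _ (λ _ → refl)
total-below {suc n} g (suc k) (s≤s k≤n) = cong (λ z → g 0 + z) (total-below (g ∘ suc) k k≤n)

module _ {n} (f : Fin n → Fin n) (f-injective : ∀ {i j} → f i ≡ f j → i ≡ j) where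

  private
    preimage : ∀ j → ∃ λ i → f i ≡ j
    preimage j with Fin.any? (λ i → f i Fin.≟ j)
    ... | yes hit = hit
    ... | no miss = ⊥-elim (too-many n f f-injective j miss)
      where
      -- A value that is missed could be punched out, which would leave an injection into a smaller
      -- set.
      too-many : ∀ n (f : Fin n → Fin n) → (∀ {i j} → f i ≡ f j → i ≡ j) →
                 ∀ j → ¬ (∃ λ i → f i ≡ j) → ⊥
      too-many (suc n) f inj j miss =
        1+n≰n (Fin.injective⇒≤ {f = λ i → punchOut (j≢f i)} (inj ∘ Fin.punchOut-injective (j≢f _) (j≢f _)))
        where
        j≢f : ∀ i → j ≢ f i
        j≢f i eq = miss (i , sym eq)

  -- `f` becomes the direction `⟨$⟩ˡ`, since it will be a rank and send a job to its place.
  injection⇒permutation : Permutation′ n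
  injection⇒permutation = permutation (proj₁ ∘ preimage) f
    (λ i → f-injective (proj₂ (preimage (f i)))) (λ j → proj₂ (preimage j))

-- Ranks and stable sorting

module Rank {n} (key : Fin n → ℕ) (key-injective : ∀ {i j} → key i ≡ key j → i ≡ j) where

  below : ℕ → ℕ
  below x = total (λ i → 1 when (key i <ᵇ x))

  below-zero : below 0 ≡ 0
  below-zero = total-zero {n} _ (λ _ → refl)

  below-hit : ∀ j → below (suc (key j)) ≡ suc (below (key j))
  below-hit j = trans (total-cong {n} pointwise) (trans (∑-distrib-+ (λ i → 1 when (key i <ᵇ key j)) _)
    (trans (cong (λ z → below (key j) + z) (total-at (λ _ → 1) j)) (+-comm _ 1)))
    where
    pointwise : ∀ i → 1 when (key i <ᵇ suc (key j)) ≡ 1 when (key i <ᵇ key j) + 1 when does (i Fin.≟ j)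
    pointwise i with i Fin.≟ j
    ... | yes refl rewrite when-true 1 (<⇒<ᵇ (n<1+n (key i)))
                         | when-false 1 (λ t → <-irrefl {key i} refl (<ᵇ⇒< _ _ t)) = refl
    ... | no  i≢j = trans
      (when-≡ 1 (λ t → <⇒<ᵇ (≤∧≢⇒< (s≤s⁻¹ (<ᵇ⇒< (key i) _ t)) (i≢j ∘ key-injective)))
                (λ t → <⇒<ᵇ (m<n⇒m<1+n (<ᵇ⇒< (key i) _ t)))) (sym (+-identityʳ _))

  below-miss : ∀ x → (∀ j → key j ≢ x) → below (suc x) ≡ below x
  below-miss x miss = total-cong {n} λ i →
    when-≡ 1 (λ t → <⇒<ᵇ (≤∧≢⇒< (s≤s⁻¹ (<ᵇ⇒< (key i) _ t)) (miss i)))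
             (λ t → <⇒<ᵇ (m<n⇒m<1+n (<ᵇ⇒< (key i) _ t)))

  below-mono : ∀ {x y} → x ≤ y → below x ≤ below y
  below-mono x≤y = total-mono {n} λ i → when-≤ 1 (λ t → <⇒<ᵇ (<-≤-trans (<ᵇ⇒< (key i) _ t) x≤y))

  below-strict : ∀ {i y} → key i < y → below (key i) < below y
  below-strict {i} {y} i<y = subst (_≤ below y) (below-hit i) (below-mono i<y)

  below-key< : ∀ i → below (key i) < n
  below-key< i = ≤-trans (below-strict (n<1+n (key i)))
    (subst (below (suc (key i)) ≤_) (total-ones n)
      (total-mono {n} λ i′ → when-≤ 1 {key i′ <ᵇ suc (key i)} {true} _))

  rank : Fin n → Fin n
  rank i = fromℕ< (below-key< i)

  toℕ-rank : ∀ i → toℕ (rank i) ≡ below (key i)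
  toℕ-rank i = Fin.toℕ-fromℕ< (below-key< i)

  rank-mono : ∀ {i j} → key i ≤ key j → rank i Fin.≤ rank j
  rank-mono {i} {j} i≤j rewrite toℕ-rank i | toℕ-rank j = below-mono i≤j

  rank-reflects : ∀ {i j} → rank i Fin.≤ rank j → key i ≤ key j
  rank-reflects {i} {j} ri≤rj with key i ≤? key j
  ... | yes i≤j = i≤j
  ... | no  i≰j rewrite toℕ-rank i | toℕ-rank j =
    contradiction (below-strict (≰⇒> i≰j)) (≤⇒≯ ri≤rj)

  order : Permutation′ n
  order = injection⇒permutation rank λ {i} {j} eq → key-injective (≤-antisym
    (rank-reflects (Fin.≤-reflexive eq)) (rank-reflects (Fin.≤-reflexive (sym eq))))

module StableSort {n} (g : Fin n → ℕ) where

  -- The index is a last digit to radix `n`: keys are distinct, and jobs with equal `g` keep their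
  -- order.
  key : Fin n → ℕ
  key j = g j * n + toℕ j

  key< : ∀ {i j} → g i < g j → key i < key j
  key< {i} {j} gi<gj = begin-strict
    g i * n + toℕ i  <⟨ +-monoʳ-< (g i * n) (Fin.toℕ<n i) ⟩
    g i * n + n      ≡⟨ +-comm _ n ⟩
    suc (g i) * n    ≤⟨ *-monoˡ-≤ n gi<gj ⟩
    g j * n          ≤⟨ m≤m+n _ _ ⟩
    key j            ∎
    where open ≤-Reasoning

  key≤ : ∀ {i j} → key i ≤ key j → g i ≤ g j
  key≤ {i} {j} le = ≮⇒≥ λ gj<gi → <⇒≱ (key< gj<gi) le

  key≤′ : ∀ {i j} → g i ≡ g j → key i ≤ key j → toℕ i ≤ toℕ j
  key≤′ {i} {j} eq le rewrite eq = +-cancelˡ-≤ (g j * n) _ _ le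

  key-injective : ∀ {i j} → key i ≡ key j → i ≡ j
  key-injective {i} {j} eq = Fin.toℕ-injective (≤-antisym
    (key≤′ g≡ (≤-reflexive eq)) (key≤′ (sym g≡) (≤-reflexive (sym eq))))
    where g≡ = ≤-antisym (key≤ (≤-reflexive eq)) (key≤ (≤-reflexive (sym eq)))

  open Rank key key-injective public

-- Early before the block, early and late in it, early and late after it.  The block
-- consists of the jobs that are processed during the renting period.
data Class : Set where
  𝐀 𝐁 𝐁ˡ 𝐃 𝐃ˡ : Class

code : Class → ℕ
code 𝐀  = 0
code 𝐁  = 1
code 𝐁ˡ = 2
code 𝐃  = 3
code 𝐃ˡ = 4

decode : ℕ → Class
decode 0 = 𝐀
decode 1 = 𝐁
decode 2 = 𝐁ˡ
decode 3 = 𝐃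
decode _ = 𝐃ˡ

decode-code : ∀ x → decode (code x) ≡ x
decode-code 𝐀  = refl
decode-code 𝐁  = refl
decode-code 𝐁ˡ = refl
decode-code 𝐃  = refl
decode-code 𝐃ˡ = refl

code≡ᵇ⇒≡ : ∀ {x y} → T (code x ≡ᵇ code y) → x ≡ y
code≡ᵇ⇒≡ {x} {y} t = trans (sym (decode-code x)) (trans (cong decode (≡ᵇ⇒≡ (code x) (code y) t)) (decode-code y))

≡⇒code≡ᵇ : ∀ {x y} → x ≡ y → T (code x ≡ᵇ code y)
≡⇒code≡ᵇ {x} refl = ≡⇒≡ᵇ (code x) (code x) refl

isLate : Class → Bool
isLate 𝐁ˡ = true
isLate 𝐃ˡ = true
isLate _  = false

lateClass : Bool → Class
lateClass true  = 𝐁ˡ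
lateClass false = 𝐃ˡ

data Allowed : Bool → Class → Set where
  allowA  : Allowed false 𝐀
  allowB  : ∀ {r} → Allowed r 𝐁
  allowBˡ : Allowed true 𝐁ˡ
  allowD  : Allowed false 𝐃
  allowDˡ : Allowed false 𝐃ˡ

-- The phase is 0 while the due dates do not exceed the start of the block, 1
-- while they lie between its start and its end, and 2 afterwards.  The clock
-- is the time reached by the early jobs before, in, or after the block,
-- respectively; for the other two groups order no longer matters.  room is the
-- capacity left before the block, blockRoom the capacity left in the block when
-- all r-jobs are already accounted for.
record State : Set where
  constructor state
  field
    phase finish room blockRoom clock : ℕ

open State public

-- In phase 0 the clock and the room add up to the start of the block, so `t + α` is both the
-- threshold and the first value of the next clock. The steps are composed because a single job may
-- pass both thresholds.
settle₁ settle₂ : ℕ → State → State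
settle₁ q (state ph f α ε t) =
  if ph ≤ᵇ 0 then (if t + α + 1 ≤ᵇ q then state 1 f α ε (t + α) else state ph f α ε t) else state ph f α ε t
settle₂ q (state ph f α ε t) =
  if 1 ≤ᵇ ph then (if ph ≤ᵇ 1 then (if f + 1 ≤ᵇ q then state 2 f α ε f else state ph f α ε t)
                   else state ph f α ε t) else state ph f α ε t

opaque
  settle : ℕ → State → State
  settle q s = settle₂ q (settle₁ q s)

-- The letter is the class of an early job, the index the phase. `B₀`, `D₀` and `D₁` are missing: in
-- these phases the due date is at most the start or the end of the block, so a job of that class
-- would be late.
data Rule : Set where
  A₀ A₁ A₂ B₁ B₂ D₂ : Rule

opaque
  rules : List Rule
  rules = A₀ ∷ A₁ ∷ A₂ ∷ B₁ ∷ B₂ ∷ D₂ ∷ []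

  ∈-rules : ∀ ρ → ρ ∈ rules
  ∈-rules A₀ = here refl
  ∈-rules A₁ = there (here refl)
  ∈-rules A₂ = there (there (here refl))
  ∈-rules B₁ = there (there (there (here refl)))
  ∈-rules B₂ = there (there (there (there (here refl))))
  ∈-rules D₂ = there (there (there (there (there (here refl)))))

-- `ruleMaxR` is an upper bound for the indicator of r-jobs: 1 admits every job, 0 excludes the
-- r-jobs.
rulePhase ruleMaxR : Rule → ℕ
rulePhase A₀ = 0
rulePhase A₁ = 1
rulePhase A₂ = 2
rulePhase B₁ = 1
rulePhase B₂ = 2
rulePhase D₂ = 2
ruleMaxR B₁ = 1
ruleMaxR B₂ = 1
ruleMaxR _  = 0

ruleClass : Rule → Class
ruleClass A₀ = 𝐀
ruleClass A₁ = 𝐀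
ruleClass A₂ = 𝐀
ruleClass B₁ = 𝐁
ruleClass B₂ = 𝐁
ruleClass D₂ = 𝐃

-- The group of early jobs that the clock follows in the given phase.
phaseClass : ℕ → Class
phaseClass 0 = 𝐀
phaseClass 1 = 𝐁
phaseClass _ = 𝐃

ticks takesRoom takesBlockRoom : Rule → Bool
ticks          ρ = code (ruleClass ρ) ≡ᵇ code (phaseClass (rulePhase ρ))
takesRoom      ρ = code (ruleClass ρ) ≡ᵇ code 𝐀
takesBlockRoom ρ = code (ruleClass ρ) ≡ᵇ code 𝐁

record Candidate : Set where
  constructor candidate
  field
    value : ℕ
    class : Class
    next  : State

open Candidate public

-- The recurrence and its correctness for given S and F

module Programme (n : ℕ) (p q w : ℕ → ℕ) (isR : ℕ → Bool) where

  r po pr : ℕ → ℕ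
  r  k = 1 when isR k
  po k = p k when not (isR k)
  pr k = p k when isR k

  reserve : ℕ
  reserve = prefix pr n

  -- `needB` charges `po` instead of `p`, because the time of an r-job in the block is part of
  -- `reserve`.
  needA needB tick : Rule → ℕ → ℕ
  needA ρ k = p k when takesRoom ρ
  needB ρ k = po k when takesBlockRoom ρ
  tick  ρ k = p k when ticks ρ

  -- For a rule that does not move the clock, the limit is the tested value itself. The test is then
  -- vacuous, and all rules have conditions of the same shape.
  limit : Rule → ℕ → State → ℕ
  limit ρ k s = if ticks ρ then q k else clock s + tick ρ k + 1

  Applies : Rule → ℕ → State → Set
  Applies ρ k s = rulePhase ρ ≤ phase s × phase s ≤ rulePhase ρ × r k ≤ ruleMaxR ρ ×
                  needA ρ k ≤ room s × needB ρ k ≤ blockRoom s × clock s + tick ρ k + 1 ≤ limit ρ k s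

  applies? : ∀ ρ k s → Dec (Applies ρ k s)
  applies? ρ k s = rulePhase ρ ≤? phase s ×-dec phase s ≤? rulePhase ρ ×-dec r k ≤? ruleMaxR ρ ×-dec
                   needA ρ k ≤? room s ×-dec needB ρ k ≤? blockRoom s ×-dec
                   clock s + tick ρ k + 1 ≤? limit ρ k s

  fire : Rule → ℕ → State → State
  fire ρ k (state ph f α ε t) = state ph f (α ∸ needA ρ k) (ε ∸ needB ρ k) (t + tick ρ k)

  -- A late job leaves the state alone: in the block it is an r-job and covered by `reserve`,
  -- outside it follows all early jobs.
  data Move (k : ℕ) (s : State) : Class → ℕ → State → Set where
    late  : Move k s (lateClass (isR k)) (w k) s
    early : ∀ ρ → Applies ρ k s → Move k s (ruleClass ρ) 0 (fire ρ k s)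

  improve : Candidate → ℕ → Class → State → Candidate
  improve c v x s = if v + 1 ≤ᵇ value c then candidate v x s else c

  choose : ∀ {X : Set} → Dec X → Candidate → Candidate → Candidate
  choose (yes _) c c′ = c
  choose (no  _) c c′ = c′

  try : ℕ → (State → ℕ) → State → Candidate → Rule → Candidate
  try k W s c ρ = choose (applies? ρ k s) (improve c (W (fire ρ k s)) (ruleClass ρ) (fire ρ k s)) c

  best : ℕ → (State → ℕ) → State → Candidate
  best k W s = foldl (try k W s) (candidate (w k + W s) (lateClass (isR k)) s) rules

  -- The argument counts the jobs still to be placed, which makes the recursion structural; it is
  -- also the layer in the machine's table.
  V : ℕ → State → ℕ
  V zero    s = 0
  V (suc m) s = value (best (n ∸ suc m) (V m) (settle (q (n ∸ suc m)) s))

  module _ (k : ℕ) (W : State → ℕ) (s : State) where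

    private
      improve-≤ : ∀ c v x s′ → value (improve c v x s′) ≤ value c
      improve-≤ c v x s′ with v + 1 ≤ᵇ value c | ≤ᵇ⇒≤ (v + 1) (value c)
      ... | true  | lt = ≤-trans (m≤m+n v 1) (lt _)
      ... | false | _  = ≤-refl

      improve-≤′ : ∀ c v x s′ → value (improve c v x s′) ≤ v
      improve-≤′ c v x s′ with v + 1 ≤ᵇ value c | ≤⇒≤ᵇ {v + 1} {value c}
      ... | true  | _  = ≤-refl
      ... | false | ge with value c ≤? v
      ...   | yes c≤v = c≤v
      ...   | no  c≰v = ⊥-elim (ge (subst (_≤ value c) (+-comm 1 v) (≰⇒> c≰v)))

      try-≤ : ∀ c ρ → value (try k W s c ρ) ≤ value c
      try-≤ c ρ with applies? ρ k s
      ... | yes _ = improve-≤ c (W (fire ρ k s)) (ruleClass ρ) (fire ρ k s)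
      ... | no  _ = ≤-refl

      try-≤′ : ∀ c ρ → Applies ρ k s → value (try k W s c ρ) ≤ W (fire ρ k s)
      try-≤′ c ρ ap with applies? ρ k s
      ... | yes _  = improve-≤′ c (W (fire ρ k s)) (ruleClass ρ) (fire ρ k s)
      ... | no  na = contradiction ap na

      foldl-≤ : ∀ c ρs → value (foldl (try k W s) c ρs) ≤ value c
      foldl-≤ c []       = ≤-refl
      foldl-≤ c (ρ ∷ ρs) = ≤-trans (foldl-≤ (try k W s c ρ) ρs) (try-≤ c ρ)

      foldl-≤′ : ∀ {ρ} c ρs → ρ ∈ ρs → Applies ρ k s → value (foldl (try k W s) c ρs) ≤ W (fire ρ k s)
      foldl-≤′ c (ρ ∷ ρs) (here refl) ap = ≤-trans (foldl-≤ (try k W s c ρ) ρs) (try-≤′ c ρ ap)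
      foldl-≤′ c (ρ ∷ ρs) (there ρ∈)  ap = foldl-≤′ (try k W s c ρ) ρs ρ∈ ap

    best-≤ : ∀ {x c s′} → Move k s x c s′ → value (best k W s) ≤ c + W s′
    best-≤ late         = foldl-≤ _ rules
    best-≤ (early ρ ap) = foldl-≤′ _ rules (∈-rules ρ) ap

    -- Together with `best-≤` this makes `best` an exact minimum, witnessed by a move that the walk
    -- can follow.
    Achieved : Candidate → Set
    Achieved c = ∃[ u ] Move k s (class c) u (next c) × value c ≡ u + W (next c)

    private
      try-achieved : ∀ c ρ → Achieved c → Achieved (try k W s c ρ)
      try-achieved c ρ h with applies? ρ k s
      ... | no _   = h
      ... | yes ap = improved (W (fire ρ k s)) refl
        where
        improved : ∀ v → v ≡ W (fire ρ k s) → Achieved (improve c v (ruleClass ρ) (fire ρ k s))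
        improved v refl with v + 1 ≤ᵇ value c
        ... | true  = 0 , early ρ ap , refl
        ... | false = h

      foldl-achieved : ∀ c ρs → Achieved c → Achieved (foldl (try k W s) c ρs)
      foldl-achieved c []       h = h
      foldl-achieved c (ρ ∷ ρs) h = foldl-achieved (try k W s c ρ) ρs (try-achieved c ρ h)

    best-achieved : Achieved (best k W s)
    best-achieved = foldl-achieved _ rules (w k , late , refl)

  -- The block starts at time S and ends by time F.
  module Assignment (cls : ℕ → Class) (S F : ℕ) where

    share : (ℕ → ℕ) → Class → ℕ → ℕ
    share f x i = f i when (code (cls i) ≡ᵇ code x)

    load : (ℕ → ℕ) → Class → ℕ → ℕ
    load f x = prefix (share f x)

    load-suc : ∀ f x k {y} → cls k ≡ y → load f x (suc k) ≡ load f x k + f k when (code y ≡ᵇ code x)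
    load-suc f x k refl = prefix-suc (share f x) k

    weight : ℕ → ℕ
    weight k = w k when isLate (cls k)

    -- The inequalities are strict because being early means `C < q` for cut due dates. Jobs after
    -- the block are timed from `F` even if the block ends earlier.
    record Timely (k : ℕ) : Set where
      field
        onA : cls k ≡ 𝐀 → load p 𝐀 (suc k) < q k
        onB : cls k ≡ 𝐁 → S + load p 𝐁 (suc k) < q k
        onD : cls k ≡ 𝐃 → F + load p 𝐃 (suc k) < q k

    -- The loads required to be 0 belong to the groups not yet begun, so a new clock starts exactly
    -- at `S` or `F`. The bound on all remaining due dates replaces the clock of a group that is no
    -- longer followed.
    data Clock (k : ℕ) : ℕ → ℕ → Set where
      inA : ∀ {t} → t ≡ load p 𝐀 k → load p 𝐁 k ≡ 0 → load p 𝐃 k ≡ 0 → Clock k 0 t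
      inB : ∀ {t} → t ≡ S + load p 𝐁 k → load p 𝐃 k ≡ 0 → (∀ i → k ≤ i → i < n → S < q i) → Clock k 1 t
      inD : ∀ {t} → t ≡ F + load p 𝐃 k → (∀ i → k ≤ i → i < n → F < q i) → Clock k 2 t

    record Inv (k : ℕ) (s : State) : Set where
      field
        roomA   : room s + load p 𝐀 k ≡ S
        roomB   : blockRoom s + (load po 𝐁 k + (reserve + S)) ≡ F
        finish≡ : finish s ≡ F
        clocked : Clock k (phase s) (clock s)

    Settled : ℕ → ℕ → Set
    Settled k 0 = q k ≤ S
    Settled k 1 = q k ≤ F
    Settled k _ = ⊤

    S≤F : ∀ {k s} → Inv k s → S ≤ F
    S≤F {k} {s} inv = subst (S ≤_) roomB (≤-trans (m≤n+m S reserve) (≤-trans (m≤n+m _ (load po 𝐁 k)) (m≤n+m _ (blockRoom s))))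
      where open Inv inv

    p≡po+pr : ∀ k → p k ≡ po k + pr k
    p≡po+pr k with isR k
    ... | true  = refl
    ... | false = sym (+-identityʳ (p k))

    -- The r-jobs among the early jobs of the block are paid for by all r-jobs together.
    load-B≤ : ∀ k → k ≤ n → load p 𝐁 k ≤ load po 𝐁 k + reserve
    load-B≤ k k≤n = ≤-trans (prefix-≤+ (share po 𝐁) pr (share p 𝐁) k pointwise) (+-monoʳ-≤ (load po 𝐁 k) (prefix-≤ pr k≤n))
      where
      pointwise : ∀ i → i < k → p i when (code (cls i) ≡ᵇ 1) ≤ po i when (code (cls i) ≡ᵇ 1) + pr i
      pointwise i _ with code (cls i) ≡ᵇ 1
      ... | true  = ≤-reflexive (p≡po+pr i)
      ... | false = z≤n

    module _ (q-mono : ∀ {i j} → i ≤ j → j < n → q i ≤ q j) where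

      -- Due dates are sorted, so a threshold passed by job `k` is passed by all later jobs; if it
      -- is not passed, `q k` is bounded by it.
      settle₁-inv : ∀ {k s} → k < n → Inv k s →
                    Inv k (settle₁ (q k) s) × (phase (settle₁ (q k) s) ≡ 0 → q k ≤ S)
      settle₁-inv {k} {state 1 f α ε t} k<n inv = inv , λ ()
      settle₁-inv {k} {state 2 f α ε t} k<n inv = inv , λ ()
      settle₁-inv {k} {state (suc (suc (suc _))) f α ε t} k<n record { clocked = () }
      settle₁-inv {k} {state 0 f α ε t} k<n inv@record { roomA = rA ; clocked = inA refl b≡0 d≡0 }
        with t + α + 1 ≤ᵇ q k | ≤ᵇ⇒≤ (t + α + 1) (q k) | ≤⇒≤ᵇ {t + α + 1} {q k}
      ... | true | S<q | _ = record
              { roomA = rA ; roomB = Inv.roomB inv ; finish≡ = Inv.finish≡ inv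
              ; clocked = inB (trans t+α≡S (sym (trans (cong (λ z → S + z) b≡0) (+-identityʳ S)))) d≡0
                  (λ i k≤i i<n → <-≤-trans (subst (_≤ q k) (trans (+-comm _ 1) (cong suc t+α≡S)) (S<q _)) (q-mono k≤i i<n)) }
              , λ ()
        where
        t+α≡S : t + α ≡ S
        t+α≡S = trans (+-comm t α) rA
      ... | false | _ | q≤S = inv , λ _ → ≮⇒≥ λ S<q →
              q≤S (subst (_≤ q k) (sym (trans (+-comm _ 1) (cong suc (trans (+-comm t α) rA)))) S<q)

      settle₂-inv : ∀ {k s} → k < n → Inv k s → (phase s ≡ 0 → q k ≤ S) →
                    Inv k (settle₂ (q k) s) × Settled k (phase (settle₂ (q k) s))
      settle₂-inv {k} {state 0 f α ε t} k<n inv h = inv , h refl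
      settle₂-inv {k} {state 2 f α ε t} k<n inv h = inv , tt
      settle₂-inv {k} {state (suc (suc (suc _))) f α ε t} k<n record { clocked = () } h
      settle₂-inv {k} {state 1 f α ε t} k<n inv@record { finish≡ = refl ; clocked = inB t≡ d≡0 S<q } h
        with f + 1 ≤ᵇ q k | ≤ᵇ⇒≤ (f + 1) (q k) | ≤⇒≤ᵇ {f + 1} {q k}
      ... | true | F<q | _ = record
              { roomA = Inv.roomA inv ; roomB = Inv.roomB inv ; finish≡ = refl
              ; clocked = inD (sym (trans (cong (λ z → f + z) d≡0) (+-identityʳ f)))
                  (λ i k≤i i<n → <-≤-trans (subst (_≤ q k) (+-comm f 1) (F<q _)) (q-mono k≤i i<n)) }
              , tt
      ... | false | _ | q≤F = inv , ≮⇒≥ λ F<q → q≤F (subst (_≤ q k) (+-comm 1 f) F<q)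

      opaque
        unfolding settle

        settle-inv : ∀ {k s} → k < n → Inv k s →
                     Inv k (settle (q k) s) × Settled k (phase (settle (q k) s))
        settle-inv {k} {s} k<n inv with settle₁-inv k<n inv
        ... | inv₁ , h = settle₂-inv k<n inv₁ h

    -- Excludes the classes whose loads `Clock` keeps at 0 in this phase.
    Fits : ℕ → Class → Set
    Fits 0 x = (code x ≡ᵇ code 𝐁) ≡ false × (code x ≡ᵇ code 𝐃) ≡ false
    Fits 1 x = (code x ≡ᵇ code 𝐃) ≡ false
    Fits _ x = ⊤

    load-skip : ∀ f x k {y} → cls k ≡ y → (code y ≡ᵇ code x) ≡ false → load f x (suc k) ≡ load f x k
    load-skip f x k {y} eq miss = trans (load-suc f x k eq)
      (trans (cong (λ β → load f x k + f k when β) miss) (+-identityʳ _))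

    later : ∀ {k} {X : ℕ → Set} → (∀ i → k ≤ i → i < n → X i) → ∀ i → suc k ≤ i → i < n → X i
    later h i k<i = h i (<⇒≤ k<i)

    clock-step : ∀ {k ph t} y → cls k ≡ y → Fits ph y → Clock k ph t →
                 Clock (suc k) ph (t + p k when (code y ≡ᵇ code (phaseClass ph)))
    clock-step {k} y eq (notB , notD) (inA refl b≡0 d≡0) =
      inA (sym (load-suc p 𝐀 k eq)) (trans (load-skip p 𝐁 k eq notB) b≡0) (trans (load-skip p 𝐃 k eq notD) d≡0)
    clock-step {k} y eq notD (inB refl d≡0 S<q) =
      inB (trans (+-assoc S _ _) (cong (λ z → S + z) (sym (load-suc p 𝐁 k eq))))
          (trans (load-skip p 𝐃 k eq notD) d≡0) (later S<q)
    clock-step {k} y eq _ (inD refl F<q) =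
      inD (trans (+-assoc F _ _) (cong (λ z → F + z) (sym (load-suc p 𝐃 k eq)))) (later F<q)

    shift : ∀ {v u} l {z} → v ≤ u → u + (l + z) ≡ (u ∸ v) + ((l + v) + z)
    shift {v} {u} l {z} v≤u = trans (cong (λ x → x + (l + z)) (sym (m∸n+n≡m v≤u)))
      (solve 4 (λ d v l z → d :+ v :+ (l :+ z) := d :+ (l :+ v :+ z)) refl (u ∸ v) v l z)
      where open +-*-Solver

    rule-phase : ∀ k s ρ → Applies ρ k s → phase s ≡ rulePhase ρ
    rule-phase k s ρ (≤ph , ph≤ , _) = ≤-antisym ph≤ ≤ph

    rule-fits : ∀ ρ → Fits (rulePhase ρ) (ruleClass ρ)
    rule-fits A₀ = refl , refl
    rule-fits A₁ = refl
    rule-fits A₂ = tt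
    rule-fits B₁ = refl
    rule-fits B₂ = tt
    rule-fits D₂ = tt

    late-fits : ∀ ph β → Fits ph (lateClass β)
    late-fits 0 true  = refl , refl
    late-fits 0 false = refl , refl
    late-fits 1 true  = refl
    late-fits 1 false = refl
    late-fits (suc (suc _)) β = tt

    -- Phases 0 and 1 also stand for `𝐀` and `𝐁` here: `move-inv` uses these instances to see that a
    -- late job adds to neither load.
    late-untimed : ∀ ph β → (code (lateClass β) ≡ᵇ code (phaseClass ph)) ≡ false
    late-untimed 0 true  = refl
    late-untimed 0 false = refl
    late-untimed 1 true  = refl
    late-untimed 1 false = refl
    late-untimed (suc (suc _)) true  = refl
    late-untimed (suc (suc _)) false = refl

    move-inv : ∀ {k s x u s′} → cls k ≡ x → Move k s x u s′ → Inv k s → Inv (suc k) s′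
    move-inv {k} {s} eq late inv = record
      { roomA   = trans (cong (λ z → room s + z) (load-skip p 𝐀 k eq (late-untimed 0 (isR k)))) roomA
      ; roomB   = trans (cong (λ z → blockRoom s + (z + (reserve + S))) (load-skip po 𝐁 k eq (late-untimed 1 (isR k)))) roomB
      ; finish≡ = finish≡
      ; clocked = subst (Clock (suc k) (phase s))
          (trans (cong (λ β → clock s + p k when β) (late-untimed (phase s) (isR k))) (+-identityʳ _))
          (clock-step _ eq (late-fits (phase s) (isR k)) clocked) }
      where open Inv inv
    move-inv {k} {s} eq (early ρ ap@(_ , _ , _ , roomy , blockRoomy , _)) inv = record
      { roomA   = trans (cong (λ z → (room s ∸ needA ρ k) + z) (load-suc p 𝐀 k eq))
                   (trans (cong (λ z → (room s ∸ needA ρ k) + z) (sym (+-identityʳ _)))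
                    (trans (sym (shift (load p 𝐀 k) roomy)) (trans (cong (λ z → room s + z) (+-identityʳ _)) roomA)))
      ; roomB   = trans (cong (λ z → (blockRoom s ∸ needB ρ k) + (z + (reserve + S))) (load-suc po 𝐁 k eq))
                   (trans (sym (shift (load po 𝐁 k) blockRoomy)) roomB)
      ; finish≡ = finish≡
      ; clocked = subst (λ ph → Clock (suc k) (phase s) (clock s + p k when (code (ruleClass ρ) ≡ᵇ code (phaseClass ph)))) ph≡
          (clock-step _ eq (subst (λ ph → Fits ph (ruleClass ρ)) (sym ph≡) (rule-fits ρ)) clocked) }
      where
      open Inv inv
      ph≡ = rule-phase k s ρ ap

    move-weight : ∀ {k s x u s′} → cls k ≡ x → Move k s x u s′ → u ≡ weight k
    move-weight {k} eq late with isR k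
    ... | true  rewrite eq = refl
    ... | false rewrite eq = refl
    move-weight eq (early A₀ _) rewrite eq = refl
    move-weight eq (early A₁ _) rewrite eq = refl
    move-weight eq (early A₂ _) rewrite eq = refl
    move-weight eq (early B₁ _) rewrite eq = refl
    move-weight eq (early B₂ _) rewrite eq = refl
    move-weight eq (early D₂ _) rewrite eq = refl

    move-allowed : ∀ {k s x u s′} → Move k s x u s′ → Allowed (isR k) x
    move-allowed {k} late with isR k
    ... | true  = allowBˡ
    ... | false = allowDˡ
    move-allowed {k} (early ρ (_ , _ , r≤ , _)) = allowed ρ (isR k) r≤
      where
      allowed : ∀ ρ β → 1 when β ≤ ruleMaxR ρ → Allowed β (ruleClass ρ)
      allowed A₀ false _ = allowA
      allowed A₁ false _ = allowA
      allowed A₂ false _ = allowA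
      allowed B₁ _     _ = allowB
      allowed B₂ _     _ = allowB
      allowed D₂ false _ = allowD

    loadA≤S : ∀ {k s} → Inv k s → load p 𝐀 k ≤ S
    loadA≤S {k} {s} inv = subst (load p 𝐀 k ≤_) (Inv.roomA inv) (m≤n+m _ (room s))

    blockLoad≤F : ∀ {k s} → k ≤ n → Inv k s → S + load p 𝐁 k ≤ F
    blockLoad≤F {k} {s} k≤n inv = begin
      S + load p 𝐁 k                                 ≤⟨ +-monoʳ-≤ S (load-B≤ k k≤n) ⟩
      S + (load po 𝐁 k + reserve)                    ≡⟨ solve 3 (λ s l r → s :+ (l :+ r) := l :+ (r :+ s)) refl S (load po 𝐁 k) reserve ⟩
      load po 𝐁 k + (reserve + S)                    ≤⟨ m≤n+m _ (blockRoom s) ⟩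
      blockRoom s + (load po 𝐁 k + (reserve + S))    ≡⟨ Inv.roomB inv ⟩
      F                                              ∎
      where
      open ≤-Reasoning
      open +-*-Solver

    -- A job of the group that is being timed passes the test of its rule. For the other groups
    -- capacity suffices: the load of `𝐀` is at most `S`, the block's early jobs end by `F`, and in
    -- phases 1 and 2 the due date exceeds `S` and `F`, respectively.
    move-timely : ∀ {k s x u s′} → k < n → cls k ≡ x → Move k s x u s′ → Inv k s → Timely k
    move-timely {k} {s} k<n eq mv inv = timely eq mv inv′ clocked
      where
      open Inv inv
      inv′ = move-inv eq mv inv

      tight : ∀ {t} l x → cls k ≡ x → t ≡ l + load p x k → (code x ≡ᵇ code x) ≡ true →
              t + p k + 1 ≤ q k → l + load p x (suc k) < q k
      tight {t} l x e refl xx le = subst (_≤ q k) (trans (+-comm _ 1) (cong suc (trans (+-assoc l _ _)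
        (cong (λ z → l + z) (sym (trans (load-suc p x k e) (cong (λ β → load p x k + p k when β) xx))))))) le

      only : ∀ {x} → cls k ≡ x → (x ≡ 𝐀 → load p 𝐀 (suc k) < q k) → (x ≡ 𝐁 → S + load p 𝐁 (suc k) < q k) →
             (x ≡ 𝐃 → F + load p 𝐃 (suc k) < q k) → Timely k
      only e hA hB hD = record
        { onA = λ e′ → hA (trans (sym e) e′) ; onB = λ e′ → hB (trans (sym e) e′) ; onD = λ e′ → hD (trans (sym e) e′) }

      timely : ∀ {x u s′} → cls k ≡ x → Move k s x u s′ → Inv (suc k) s′ → Clock k (phase s) (clock s) → Timely k
      timely e late inv′ _ with isR k
      ... | true  = only e (λ ()) (λ ()) (λ ())
      ... | false = only e (λ ()) (λ ()) (λ ())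
      timely e (early A₀ ap@(_ , _ , _ , _ , _ , le)) inv′ c with phase s | rule-phase k s A₀ ap
      timely e (early A₀ (_ , _ , _ , _ , _ , le)) inv′ (inA t≡ _ _) | .0 | refl =
        only e (λ _ → tight 0 𝐀 e t≡ refl le) (λ ()) (λ ())
      timely e (early A₁ ap) inv′ c with phase s | rule-phase k s A₁ ap
      timely e (early A₁ ap) inv′ (inB _ _ S<q) | .1 | refl =
        only e (λ _ → ≤-<-trans (loadA≤S inv′) (S<q k ≤-refl k<n)) (λ ()) (λ ())
      timely e (early A₂ ap) inv′ c with phase s | rule-phase k s A₂ ap
      timely e (early A₂ ap) inv′ (inD _ F<q) | .2 | refl =
        only e (λ _ → ≤-<-trans (≤-trans (loadA≤S inv′) (S≤F inv)) (F<q k ≤-refl k<n)) (λ ()) (λ ())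
      timely e (early B₁ ap@(_ , _ , _ , _ , _ , le)) inv′ c with phase s | rule-phase k s B₁ ap
      timely e (early B₁ (_ , _ , _ , _ , _ , le)) inv′ (inB t≡ _ _) | .1 | refl =
        only e (λ ()) (λ _ → tight S 𝐁 e t≡ refl le) (λ ())
      timely e (early B₂ ap) inv′ c with phase s | rule-phase k s B₂ ap
      timely e (early B₂ ap) inv′ (inD _ F<q) | .2 | refl =
        only e (λ ()) (λ _ → ≤-<-trans (blockLoad≤F k<n inv′) (F<q k ≤-refl k<n)) (λ ())
      timely e (early D₂ ap@(_ , _ , _ , _ , _ , le)) inv′ c with phase s | rule-phase k s D₂ ap
      timely e (early D₂ (_ , _ , _ , _ , _ , le)) inv′ (inD t≡ _) | .2 | refl =
        only e (λ ()) (λ ()) (λ _ → tight F 𝐃 e t≡ refl le)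

    module _ (q-mono : ∀ {i j} → i ≤ j → j < n → q i ≤ q j) (allowed : ∀ k → k < n → Allowed (isR k) (cls k))
             (timely : ∀ k → k < n → Timely k) (roomA : load p 𝐀 n ≤ S) (roomB : load po 𝐁 n + (reserve + S) ≤ F) where

      private
        -- The load including job `k` is part of the final load, which respects the capacity, so the
        -- job fits into what is left.
        fits : ∀ f x {k c l} → k < n → cls k ≡ x → (code x ≡ᵇ code x) ≡ true → l ≡ c + load f x k →
               load f x n ≤ l → f k ≤ c
        fits f x {k} {c} k<n e xx refl le = +-cancelʳ-≤ (load f x k) (f k) c (begin
          f k + load f x k    ≡⟨ +-comm (f k) _ ⟩
          load f x k + f k    ≡⟨ cong (λ β → load f x k + f k when β) xx ⟨
          load f x k + f k when (code x ≡ᵇ code x) ≡⟨ load-suc f x k e ⟨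
          load f x (suc k)    ≤⟨ prefix-≤ (share f x) k<n ⟩
          load f x n          ≤⟨ le ⟩
          c + load f x k      ∎)
          where open ≤-Reasoning

        in-time : ∀ {t} l x {k} → cls k ≡ x → (code x ≡ᵇ code x) ≡ true → t ≡ l + load p x k →
                  l + load p x (suc k) < q k → t + p k + 1 ≤ q k
        in-time l x {k} e xx refl lt = subst (_≤ q k) (sym (trans (+-comm _ 1) (cong suc (trans (+-assoc l _ _)
          (cong (λ z → l + z) (sym (trans (load-suc p x k e) (cong (λ β → load p x k + p k when β) xx)))))))) lt

        free : ∀ {t} → t + 0 + 1 ≤ t + 0 + 1
        free = ≤-refl

      -- Class and phase determine the rule. The three combinations without a rule contradict each
      -- other: `Settled` bounds the due date by `S` or `F`, while `Timely` puts it above.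
      follow : ∀ {k s} → k < n → Inv k s → Settled k (phase s) → ∃[ s′ ] Move k s (cls k) (weight k) s′
      follow {k} {s} k<n inv settled = go (cls k) refl (isR k) refl (allowed k k<n) (phase s) refl settled (Inv.clocked inv)
        where
        open Timely (timely k k<n)
        r≡ : ∀ {β} → isR k ≡ β → r k ≡ 1 when β
        r≡ = cong (1 when_)
        po≡ : isR k ≡ false → po k ≡ p k
        po≡ e = cong (λ β → p k when not β) e
        S≤ : S ≤ F
        S≤ = S≤F inv
        α≥ : cls k ≡ 𝐀 → p k ≤ room s
        α≥ e = fits p 𝐀 k<n e refl (sym (Inv.roomA inv)) roomA
        ε≥ : cls k ≡ 𝐁 → po k ≤ blockRoom s
        ε≥ e = fits po 𝐁 {l = F ∸ (reserve + S)} k<n e refl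
          (trans (cong (_∸ (reserve + S)) (sym (trans (+-assoc (blockRoom s) _ _) (Inv.roomB inv)))) (m+n∸n≡m _ (reserve + S)))
          (m+n≤o⇒m≤o∸n _ roomB)
        by : ∀ {x} ρ → cls k ≡ x → ruleClass ρ ≡ x → isLate x ≡ false → Applies ρ k s → ∃[ s′ ] Move k s (cls k) (weight k) s′
        by ρ e refl l ap = _ , subst₂ (λ x u → Move k s x u (fire ρ k s)) (sym e)
          (sym (trans (cong (λ x → w k when isLate x) e) (cong (w k when_) l))) (early ρ ap)
        go : ∀ x → cls k ≡ x → ∀ β → isR k ≡ β → Allowed β x → ∀ ph → phase s ≡ ph → Settled k ph → Clock k ph (clock s) →
             ∃[ s′ ] Move k s (cls k) (weight k) s′
        go .𝐁ˡ e _ er allowBˡ ph _ _ _ = s , subst₂ (λ x u → Move k s x u s)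
          (trans (cong lateClass er) (sym e)) (cong (λ x → w k when isLate x) (sym e)) late
        go .𝐃ˡ e _ er allowDˡ ph _ _ _ = s , subst₂ (λ x u → Move k s x u s)
          (trans (cong lateClass er) (sym e)) (cong (λ x → w k when isLate x) (sym e)) late
        go .𝐀 e _ er allowA 0 ph≡ _ (inA t≡ _ _) = by A₀ e refl refl
          (z≤n , ≤-reflexive ph≡ , ≤-reflexive (r≡ er) , α≥ e , z≤n , in-time 0 𝐀 e refl t≡ (onA e))
        go .𝐀 e _ er allowA 1 ph≡ _ _ = by A₁ e refl refl
          (≤-reflexive (sym ph≡) , ≤-reflexive ph≡ , ≤-reflexive (r≡ er) , α≥ e , z≤n , free)
        go .𝐀 e _ er allowA 2 ph≡ _ _ = by A₂ e refl refl
          (≤-reflexive (sym ph≡) , ≤-reflexive ph≡ , ≤-reflexive (r≡ er) , α≥ e , z≤n , free)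
        go .𝐁 e β er allowB 0 ph≡ q≤S _ = contradiction (≤-trans (m≤m+n S _) (<⇒≤ (onB e))) (λ S≤q → <⇒≱ (onB e) (≤-trans q≤S (m≤m+n S _)))
        go .𝐁 e β er allowB 1 ph≡ _ (inB t≡ _ _) = by B₁ e refl refl
          (≤-reflexive (sym ph≡) , ≤-reflexive ph≡ , when-≤ 1 {isR k} {true} _ , z≤n , ε≥ e , in-time S 𝐁 e refl t≡ (onB e))
        go .𝐁 e β er allowB 2 ph≡ _ _ = by B₂ e refl refl
          (≤-reflexive (sym ph≡) , ≤-reflexive ph≡ , when-≤ 1 {isR k} {true} _ , z≤n , ε≥ e , free)
        go .𝐃 e _ er allowD 0 ph≡ q≤S _ = contradiction (≤-trans q≤S (≤-trans S≤ (m≤m+n F _))) (<⇒≱ (onD e))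
        go .𝐃 e _ er allowD 1 ph≡ q≤F _ = contradiction (≤-trans q≤F (m≤m+n F _)) (<⇒≱ (onD e))
        go .𝐃 e _ er allowD 2 ph≡ _ (inD t≡ _) = by D₂ e refl refl
          (≤-reflexive (sym ph≡) , ≤-reflexive ph≡ , ≤-reflexive (r≡ er) , z≤n , z≤n , in-time F 𝐃 e refl t≡ (onD e))

      private
        -- At each job the given assignment supplies one of the moves over which `best` minimises.
        -- Adding the weight of the jobs already placed makes the bounds telescope.
        V-≤ : ∀ m k s → k + m ≡ n → Inv k s → V m s + prefix weight k ≤ prefix weight n
        V-≤ zero    k s eq inv = ≤-reflexive (cong (prefix weight) (trans (sym (+-identityʳ k)) eq))
        -- `V` refers to its job as `n ∸ suc m`, which equals `k`.
        V-≤ (suc m) k s eq inv = subst (λ j → value (best j (V m) (settle (q j) s)) + prefix weight k ≤ prefix weight n)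
          (sym (trans (cong (_∸ suc m) (sym eq)) (m+n∸n≡m k (suc m)))) (step (settle-inv q-mono k<n inv))
          where
          eq′ : suc k + m ≡ n
          eq′ = trans (sym (+-suc k m)) eq
          k<n : k < n
          k<n = subst (suc k ≤_) eq′ (m≤m+n (suc k) m)
          step : Inv k (settle (q k) s) × Settled k (phase (settle (q k) s)) →
                 value (best k (V m) (settle (q k) s)) + prefix weight k ≤ prefix weight n
          step (inv₁ , settled) with follow k<n inv₁ settled
          ... | s′ , mv = begin
            value (best k (V m) (settle (q k) s)) + prefix weight k
              ≤⟨ +-monoˡ-≤ (prefix weight k) (best-≤ k (V m) (settle (q k) s) mv) ⟩
            weight k + V m s′ + prefix weight k
              ≡⟨ solve 3 (λ w v x → w :+ v :+ x := v :+ (x :+ w)) refl (weight k) (V m s′) (prefix weight k) ⟩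
            V m s′ + (prefix weight k + weight k)
              ≡⟨ cong (λ z → V m s′ + z) (prefix-suc weight k) ⟨
            V m s′ + prefix weight (suc k)
              ≤⟨ V-≤ m (suc k) s′ eq′ (move-inv refl mv inv₁) ⟩
            prefix weight n ∎
            where
            open ≤-Reasoning
            open +-*-Solver

      V-complete : ∀ s → Inv 0 s → V n s ≤ prefix weight n
      V-complete s inv = subst (_≤ prefix weight n) (+-identityʳ _) (V-≤ n 0 s refl inv)

  -- Walking along optimal moves

  initial : ℕ → ℕ → State
  initial S F = state 0 F S (F ∸ (reserve + S)) 0

  initial-inv : ∀ cls {S F} → reserve + S ≤ F → Assignment.Inv cls S F 0 (initial S F)
  initial-inv cls {S} {F} le = record
    { roomA = +-identityʳ S ; roomB = m∸n+n≡m le ; finish≡ = refl ; clocked = Assignment.inA refl refl refl }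

  module Walk (s₀ : State) where

    bestAt : ℕ → State → Candidate
    bestAt k s = best k (V (n ∸ suc k)) (settle (q k) s)

    position : ℕ → State
    position zero    = s₀
    position (suc k) = next (bestAt k (position k))

    chosen : ℕ → Class
    chosen k = class (bestAt k (position k))

    module _ {S F : ℕ} (q-mono : ∀ {i j} → i ≤ j → j < n → q i ≤ q j) where

      open Assignment chosen S F

      private
        step : ∀ k → k < n → Inv k (position k) →
               ∃[ u ] Move k (settle (q k) (position k)) (chosen k) u (position (suc k)) ×
                      V (n ∸ k) (position k) ≡ u + V (n ∸ suc k) (position (suc k))
        step k k<n inv with best-achieved k (V (n ∸ suc k)) (settle (q k) (position k))
        ... | u , mv , eq = u , mv , trans unfold eq
          where
          back : n ∸ suc (n ∸ suc k) ≡ k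
          back = trans (cong (n ∸_) (sym (+-∸-assoc 1 k<n))) (m∸[m∸n]≡n (<⇒≤ k<n))
          unfold : V (n ∸ k) (position k) ≡ value (bestAt k (position k))
          unfold = trans (cong (λ m → V m (position k)) (+-∸-assoc 1 k<n))
            (cong (λ j → value (best j (V (n ∸ suc k)) (settle (q j) (position k)))) back)

      -- The loads in the invariant are those of the assignment that the walk itself produces, so
      -- each move has the right class by `refl`.
      walk-inv : Inv 0 s₀ → ∀ k → k ≤ n → Inv k (position k)
      walk-inv inv zero    k≤n = inv
      walk-inv inv (suc k) k<n with walk-inv inv k (<⇒≤ k<n)
      ... | invₖ = move-inv refl (proj₁ (proj₂ (step k k<n invₖ))) (proj₁ (settle-inv q-mono k<n invₖ))

      walk-timely : Inv 0 s₀ → ∀ k → k < n → Timely k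
      walk-timely inv k k<n = move-timely k<n refl (proj₁ (proj₂ (step k k<n invₖ))) (proj₁ (settle-inv q-mono k<n invₖ))
        where invₖ = walk-inv inv k (<⇒≤ k<n)

      walk-allowed : Inv 0 s₀ → ∀ k → k < n → Allowed (isR k) (chosen k)
      walk-allowed inv k k<n = move-allowed (proj₁ (proj₂ (step k k<n (walk-inv inv k (<⇒≤ k<n)))))

      -- The minimum is attained at every job, so the remaining value plus the weight so far is
      -- constant along the walk.
      walk-weight : Inv 0 s₀ → prefix weight n ≡ V n s₀
      walk-weight inv = trans (sym (cong (λ m → V m (position n) + prefix weight n) (n∸n≡0 n))) (along n ≤-refl)
        where
        along : ∀ k → k ≤ n → V (n ∸ k) (position k) + prefix weight k ≡ V n s₀
        along zero    k≤n = +-identityʳ _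
        along (suc k) k<n with step k k<n (walk-inv inv k (<⇒≤ k<n))
        ... | u , mv , eq = begin
          V (n ∸ suc k) (position (suc k)) + prefix weight (suc k)
            ≡⟨ cong (λ z → V (n ∸ suc k) (position (suc k)) + z) (prefix-suc weight k) ⟩
          V (n ∸ suc k) (position (suc k)) + (prefix weight k + weight k)
            ≡⟨ solve 3 (λ v x w → v :+ (x :+ w) := w :+ v :+ x) refl (V (n ∸ suc k) (position (suc k))) (prefix weight k) (weight k) ⟩
          weight k + V (n ∸ suc k) (position (suc k)) + prefix weight k
            ≡⟨ cong (λ z → z + V (n ∸ suc k) (position (suc k)) + prefix weight k) (move-weight refl mv) ⟨
          u + V (n ∸ suc k) (position (suc k)) + prefix weight k
            ≡⟨ cong (_+ prefix weight k) eq ⟨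
          V (n ∸ k) (position k) + prefix weight k
            ≡⟨ along k (<⇒≤ k<n) ⟩
          V n s₀ ∎
          where
          open ≡-Reasoning
          open +-*-Solver

-- Truth values, extremal elements and cut due dates

is : ∀ {b} → b ≡ true → T b
is refl = tt

isn't : ∀ {b} → b ≡ false → ¬ T b
isn't refl ()

is⁻ : ∀ {b} → T b → b ≡ true
is⁻ {true} _ = refl

isn't⁻ : ∀ {b} → ¬ T b → b ≡ false
isn't⁻ {true}  ¬b = ⊥-elim (¬b tt)
isn't⁻ {false} ¬b = refl

is< : ∀ {m n} → (m <ᵇ n) ≡ true → m < n
is< {m} {n} e = <ᵇ⇒< m n (is e)

isn't< : ∀ {m n} → (m <ᵇ n) ≡ false → ¬ (m < n)
isn't< e = isn't e ∘ <⇒<ᵇ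

module _ {n} (X : Fin n → Bool) (g : Fin n → ℕ) {j : Fin n} (j∈X : T (X j)) where

  private
    xs : List (Fin n)
    xs = filter (T? ∘ X) (allFin n)
    ∈xs : ∀ {i} → T (X i) → i ∈ xs
    ∈xs {i} = ∈-filter⁺ (T? ∘ X) (∈-allFin i)

  maximal : ∃[ l ] T (X l) × (∀ i → T (X i) → g i ≤ g l)
  maximal = argmax g j xs , argmax-all g {P = T ∘ X} j∈X (All.all-filter (T? ∘ X) (allFin n)) ,
            λ i i∈X → All.lookup (f[xs]≤f[argmax] {f = g} j xs) (∈xs i∈X)

  minimal : ∃[ l ] T (X l) × (∀ i → T (X i) → g l ≤ g i)
  minimal = argmin g j xs , argmin-all g {P = T ∘ X} j∈X (All.all-filter (T? ∘ X) (allFin n)) ,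
            λ i i∈X → All.lookup (f[argmin]≤f[xs] {f = g} j xs) (∈xs i∈X)

-- For c ≤ P, c is at most d exactly if c < cutDue P d.
cutDue : ℕ → ℤ → ℕ
cutDue P (+ d)    = suc (d ⊓ P)
cutDue P -[1+ _ ] = 0

cutDue-bound : ∀ P d → cutDue P d ≤ suc P
cutDue-bound P (+ d)    = s≤s (m⊓n≤n d P)
cutDue-bound P -[1+ _ ] = z≤n

cutDue-early : ∀ {P c} d → c ≤ P → c < cutDue P d → ¬ (d ℤ.< + c)
cutDue-early (+ d) c≤P c<q (ℤ.+<+ d<c) = <⇒≱ d<c (≤-trans (s≤s⁻¹ c<q) (m⊓n≤m d _))

cutDue-late : ∀ {P c} d → c ≤ P → ¬ (c < cutDue P d) → d ℤ.< + c
cutDue-late (+ d)    c≤P late = ℤ.+<+ (≰⇒> λ c≤d → late (s≤s (⊓-glb c≤d c≤P)))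
cutDue-late -[1+ _ ] c≤P late = ℤ.-<+

-- The times of a sequence

module Times (I : Instance) (π : Sequence I) where

  open Instance I

  at : Fin n → Fin n
  at j = π ⟨$⟩ˡ j

  Cπ start : Fin n → ℕ
  Cπ = C I π
  start j = Cπ j ∸ p j

  isRJob : Fin n → Bool
  isRJob j = does (j ∈? Jʳ)

  q : Fin n → ℕ
  q j = cutDue (P I) (d j)

  at-injective : ∀ {i j} → at i ≡ at j → i ≡ j
  at-injective {i} {j} eq = trans (sym (inverseʳ π)) (trans (cong (π ⟨$⟩ʳ_) eq) (inverseʳ π))

  C≤P : ∀ j → Cπ j ≤ P I
  C≤P j = total-mono {n} λ i → when-≤ (p i) {c = true} _

  ≤ᵗ : ∀ {i j} → at i Fin.≤ at j → T (does (at i Fin.≤? at j))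
  ≤ᵗ = ≤⇒≤ᵇ
  ᵗ≤ : ∀ {i j} → T (does (at i Fin.≤? at j)) → at i Fin.≤ at j
  ᵗ≤ = ≤ᵇ⇒≤ _ _

  p≤C : ∀ j → p j ≤ Cπ j
  p≤C j = subst (_≤ Cπ j) (when-true (p j) (≤ᵗ {j} {j} ≤-refl)) (term≤total _ j)

  start+p : ∀ j → start j + p j ≡ Cπ j
  start+p j = m∸n+n≡m (p≤C j)

  before : Fin n → ℕ
  before j = total λ i → p i when (toℕ (at i) <ᵇ toℕ (at j))

  C-split : ∀ j → Cπ j ≤ before j + p j
  C-split j = subst (λ z → Cπ j ≤ before j + z) (total-at p j)
    (total-≤+ {n} λ i → when-cover (p i) {toℕ (at i) <ᵇ toℕ (at j)} {does (i Fin.≟ j)} (split i))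
    where
    split : ∀ i → T (does (at i Fin.≤? at j)) → T (toℕ (at i) <ᵇ toℕ (at j)) ⊎ T (does (i Fin.≟ j))
    split i le with i Fin.≟ j
    ... | yes _   = inj₂ tt
    ... | no  i≢j = inj₁ (<⇒<ᵇ (≤∧≢⇒< (ᵗ≤ {i} {j} le) (i≢j ∘ at-injective ∘ Fin.toℕ-injective)))

  -- The jobs up to `i` and the job `j` itself are disjoint, and all of them are completed by
  -- `Cπ j`.
  start-before : ∀ {i j} → toℕ (at i) < toℕ (at j) → Cπ i ≤ start j
  start-before {i} {j} i<j = m+n≤o⇒m≤o∸n (Cπ i) (subst (λ z → Cπ i + z ≤ Cπ j) (total-at p j)
    (total-+≤ {n} λ k → when-disjoint (p k) {does (at k Fin.≤? at i)} {does (k Fin.≟ j)}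
      (λ t → ≤ᵗ {k} {j} (≤-trans (ᵗ≤ {k} {i} t) (<⇒≤ i<j)))
      (λ t → ≤ᵗ {k} {j} (≤-reflexive (cong (toℕ ∘ at) (same k t))))
      (λ t u → <⇒≱ i<j (subst (λ z → toℕ (at z) ≤ toℕ (at i)) (same k u) (ᵗ≤ {k} {i} t)))))
    where
    same : ∀ k → T (does (k Fin.≟ j)) → k ≡ j
    same k t with k Fin.≟ j
    ... | yes k≡j = k≡j

  -- Let `f` and `l` be the jobs of `X` in the first and the last position. The jobs before `f` are
  -- disjoint from `X` and take at least `x`; both sets are completed by `Cπ l`. Positions rather
  -- than times are compared, because processing times may be 0.
  busy : ∀ (X : Fin n → Bool) {x j} → T (X j) → (∀ i → T (X i) → x ≤ start i) →
         ∃[ l ] T (X l) × x + total (λ i → p i when X i) ≤ Cπ l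
  busy X {x} j∈X x≤ with minimal X (toℕ ∘ at) j∈X | maximal X (toℕ ∘ at) j∈X
  ... | f , f∈X , f-min | l , l∈X , l-max = l , l∈X , ≤-trans (+-monoˡ-≤ _ x≤before)
    (total-+≤ {n} λ i → when-disjoint (p i) {toℕ (at i) <ᵇ toℕ (at f)} {X i}
      (λ t → ≤ᵗ {i} {l} (≤-trans (<⇒≤ (<ᵇ⇒< _ _ t)) (l-max f f∈X)))
      (λ t → ≤ᵗ {i} {l} (l-max i t))
      (λ t u → <⇒≱ (<ᵇ⇒< _ _ t) (f-min i u)))
    where
    x≤before : x ≤ before f
    x≤before = +-cancelʳ-≤ (p f) x _ (≤-trans
      (subst (x + p f ≤_) (start+p f) (+-monoˡ-≤ (p f) (x≤ f f∈X))) (C-split f))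

  -- If `X` is empty, there is no last job for `busy`, and the claim reduces to `x ≤ y`.
  occupied : ∀ (X : Fin n → Bool) {x y} → x ≤ y → (∀ i → T (X i) → x ≤ start i) →
             (∀ i → T (X i) → Cπ i ≤ y) → x + total (λ i → p i when X i) ≤ y
  occupied X {x} {y} x≤y x≤ ≤y with Fin.any? (λ i → T? (X i))
  ... | yes (j , j∈X) with busy X j∈X x≤
  ...   | l , l∈X , le = ≤-trans le (≤y l l∈X)
  occupied X {x} {y} x≤y x≤ ≤y | no none = subst (_≤ y)
    (sym (trans (cong (λ z → x + z) (total-zero {n} _ λ i → when-false (p i) λ t → none (i , t))) (+-identityʳ x))) x≤y

  early? : Fin n → Bool
  early? j = Cπ j <ᵇ q j

  U-early : ∀ j → Cπ j < q j → U I π j ≡ 0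
  U-early j c<q with d j ℤ.<? + Cπ j
  ... | yes d<C = contradiction d<C (cutDue-early (d j) (C≤P j) c<q)
  ... | no  _   = refl

  U-late : ∀ j → ¬ (Cπ j < q j) → U I π j ≡ 1
  U-late j c≮q with d j ℤ.<? + Cπ j
  ... | yes _   = refl
  ... | no  d≮C = contradiction (cutDue-late (d j) (C≤P j) c≮q) d≮C

  rentStart rentEnd : ℕ
  rentStart = min (P I) (map start (rJobs I))
  rentEnd   = max 0 (map Cπ (rJobs I))

  isRJob⇒∈ : ∀ {j} → T (isRJob j) → j ∈ rJobs I
  isRJob⇒∈ {j} t with j ∈? Jʳ | ∈-filter⁺ (_∈? Jʳ) (∈-allFin j)
  ... | yes j∈ | f = f j∈

  ∈⇒isRJob : ∀ {j} → j Subset.∈ Jʳ → T (isRJob j)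
  ∈⇒isRJob {j} j∈ with j ∈? Jʳ
  ... | yes _  = tt
  ... | no j∉ = j∉ j∈

  all-isRJob : All (T ∘ isRJob) (rJobs I)
  all-isRJob = All.map ∈⇒isRJob (All.all-filter (_∈? Jʳ) (allFin n))

  rentStart≤ : ∀ {j} → T (isRJob j) → rentStart ≤ start j
  rentStart≤ r = All.lookup (min≤xs (P I) _) (∈-map⁺ start (isRJob⇒∈ r))

  ≤rentEnd : ∀ {j} → T (isRJob j) → Cπ j ≤ rentEnd
  ≤rentEnd r = All.lookup (xs≤max 0 _) (∈-map⁺ Cπ (isRJob⇒∈ r))

  -- Any interval from `x` of length `y` that contains all r-jobs bounds the renting period. Starts
  -- are expressed as `x + p j ≤ Cπ j`, without truncated subtraction.
  er-≤ : ∀ {x y} → (∀ j → T (isRJob j) → x + p j ≤ Cπ j × Cπ j ≤ x + y) → er I π ≤ y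
  er-≤ {x} {y} h = m≤n+o⇒m∸n≤o rentEnd rentStart (≤-trans rentEnd≤ (+-monoˡ-≤ y ≤rentStart))
    where
    j = proj₁ Jʳ-nonempty
    -- The default value `P` of `min` has to be bounded below as well; some r-job gives
    -- `x ≤ Cπ j ≤ P`.
    ≤rentStart : x ≤ rentStart
    ≤rentStart = v≤min⁺ (≤-trans (m+n≤o⇒m≤o x (proj₁ (h j (∈⇒isRJob (proj₂ Jʳ-nonempty))))) (C≤P j))
      (All.map⁺ (All.map (λ {j} r → m+n≤o⇒m≤o∸n x (proj₁ (h j r))) all-isRJob))
    rentEnd≤ : rentEnd ≤ x + y
    rentEnd≤ = max≤v⁺ z≤n (All.map⁺ (All.map (λ {j} r → proj₂ (h j r)) all-isRJob))

  some-rJob : ∃[ j ] T (isRJob j)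
  some-rJob = proj₁ Jʳ-nonempty , ∈⇒isRJob (proj₂ Jʳ-nonempty)

  rentStart≤rentEnd : rentStart ≤ rentEnd
  rentStart≤rentEnd = ≤-trans (rentStart≤ r) (≤-trans (m∸n≤m (Cπ j) (p j)) (≤rentEnd r))
    where
    j = proj₁ some-rJob
    r = proj₂ some-rJob

  rentEnd≤P : rentEnd ≤ P I
  rentEnd≤P = max≤v⁺ z≤n (All.map⁺ (All.tabulate {xs = rJobs I} λ {j} _ → C≤P j))

  first-rJob : ∃[ j ] T (isRJob j) × start j ≤ rentStart
  first-rJob with minimal isRJob start {proj₁ some-rJob} (proj₂ some-rJob)
  ... | f , r , f-min = f , r , v≤min⁺ (≤-trans (m∸n≤m (Cπ f) (p f)) (C≤P f))
        (All.map⁺ (All.map (λ {j} → f-min j) all-isRJob))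

  last-rJob : ∃[ j ] T (isRJob j) × rentEnd ≤ Cπ j
  last-rJob with maximal isRJob Cπ {proj₁ some-rJob} (proj₂ some-rJob)
  ... | l , r , l-max = l , r , max≤v⁺ z≤n (All.map⁺ (All.map (λ {j} → l-max j) all-isRJob))

  -- If `j` had its position before the r-job that starts first, it would be completed by the rent
  -- start; after the r-job that ends last, it would not start before the rent end.
  inside : ∀ j → ¬ T (isRJob j) → ¬ (Cπ j ≤ rentStart) → ¬ (rentEnd ≤ start j) →
           rentStart ≤ start j × Cπ j ≤ rentEnd
  inside j o C≰ ≰S = after first-rJob , ahead last-rJob
    where
    after : (∃[ f ] T (isRJob f) × start f ≤ rentStart) → rentStart ≤ start j
    after (f , r , f≤) with <-cmp (toℕ (at f)) (toℕ (at j))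
    ... | tri< f<j _ _ = ≤-trans (rentStart≤ r) (≤-trans (m∸n≤m (Cπ f) (p f)) (start-before f<j))
    ... | tri≈ _ f≡j _ = contradiction (subst (T ∘ isRJob) (at-injective (Fin.toℕ-injective f≡j)) r) o
    ... | tri> _ _ j<f = contradiction (≤-trans (start-before j<f) f≤) C≰
    ahead : (∃[ l ] T (isRJob l) × rentEnd ≤ Cπ l) → Cπ j ≤ rentEnd
    ahead (l , r , ≤l) with <-cmp (toℕ (at j)) (toℕ (at l))
    ... | tri< j<l _ _ = ≤-trans (start-before j<l) (≤-trans (m∸n≤m (Cπ l) (p l)) (≤rentEnd r))
    ... | tri≈ _ j≡l _ = contradiction (subst (T ∘ isRJob) (sym (at-injective (Fin.toℕ-injective j≡l))) r) o
    ... | tri> _ _ l<j = contradiction (≤-trans ≤l (start-before l<j)) ≰S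

-- Numbering the jobs by due dates

extend : ∀ {n} {X : Set} → X → (Fin n → X) → ℕ → X
extend {n} z f i with i <? n
... | yes i<n = f (fromℕ< i<n)
... | no  _   = z

extend-toℕ : ∀ {n} {X : Set} (z : X) (f : Fin n → X) j → extend z f (toℕ j) ≡ f j
extend-toℕ {n} z f j with toℕ j <? n
... | yes j<n = cong f (Fin.fromℕ<-toℕ j j<n)
... | no  j≮n = contradiction (Fin.toℕ<n j) j≮n

-- Jobs are identified with their positions in the order of due dates.
module DueDateOrder (I : Instance) where

  open Instance I

  q : Fin n → ℕ
  q j = cutDue (P I) (d j)

  isRJob : Fin n → Bool
  isRJob j = does (j ∈? Jʳ)

  open StableSort q public using (order)
  module Q = StableSort q

  opaque
    pos : Fin n → ℕ
    pos j = toℕ (Q.rank j)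

    pos≡ : ∀ j → pos j ≡ toℕ (Q.rank j)
    pos≡ j = refl

  job : Fin n → Fin n
  job k = order ⟨$⟩ʳ k

  rank-job : ∀ k → Q.rank (job k) ≡ k
  rank-job k = inverseˡ order

  opaque
    unfolding pos

    byPos : ∀ {X : Set} → X → (Fin n → X) → ℕ → X
    byPos z f = extend z (f ∘ job)

    byPos-pos : ∀ {X : Set} (z : X) (f : Fin n → X) j → byPos z f (pos j) ≡ f j
    byPos-pos z f j = trans (extend-toℕ z (f ∘ job) (Q.rank j)) (cong f (inverseʳ order))

    byPos-all : ∀ {X : Set} (R : X → Set) {z f} → R z → (∀ j → R (f j)) → ∀ k → R (byPos z f k)
    byPos-all R {z} {f} Rz Rf k with k <? n
    ... | yes k<n = Rf (job (fromℕ< k<n))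
    ... | no  _   = Rz

  pos-job : ∀ k → pos (job k) ≡ toℕ k
  pos-job k = trans (pos≡ (job k)) (cong toℕ (rank-job k))

  p′ q′ w′ : ℕ → ℕ
  p′ = byPos 0 p
  q′ = byPos 0 q
  w′ = byPos 0 w

  isR′ : ℕ → Bool
  isR′ = byPos false isRJob

  open Programme n p′ q′ w′ isR′ public

  pos<n : ∀ j → pos j < n
  pos<n j = subst (_< n) (sym (pos≡ j)) (Fin.toℕ<n (Q.rank j))

  at-pos : ∀ {X : ℕ → Set} → (∀ j → X (pos j)) → ∀ k → k < n → X k
  at-pos {X} h k k<n = subst X (trans (pos-job (fromℕ< k<n)) (Fin.toℕ-fromℕ< k<n)) (h (job (fromℕ< k<n)))

  q′-mono : ∀ {i j} → i ≤ j → j < n → q′ i ≤ q′ j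
  q′-mono {i} {j} i≤j j<n = at-pos {λ j → ∀ i → i ≤ j → q′ i ≤ q′ j} (λ j i i≤j →
    at-pos {λ i → i ≤ pos j → q′ i ≤ q′ (pos j)} (λ i i≤j →
      subst₂ _≤_ (sym (byPos-pos 0 q i)) (sym (byPos-pos 0 q j)) (Q.key≤ (Q.rank-reflects (subst₂ _≤_ (pos≡ i) (pos≡ j) i≤j))))
    i (≤-<-trans i≤j (pos<n j)) i≤j) j j<n i i≤j

  -- The bridge between the two numberings: the recurrence sums over positions in the order of due
  -- dates, the times of a sequence are sums over jobs.
  prefix-jobs : ∀ g k → k ≤ n → prefix g k ≡ total (λ j → g (pos j) when (pos j <ᵇ k))
  prefix-jobs g k k≤n = trans (sym (total-below g k k≤n)) (trans
    (total-cong {n} λ i → cong (λ i → g i when (i <ᵇ k)) (sym (pos-job i)))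
    (sym (total-permute (λ j → g (pos j) when (pos j <ᵇ k)) order)))

  prefix-all : ∀ g → prefix g n ≡ total (λ j → g (pos j))
  prefix-all g = trans (prefix-jobs g n ≤-refl) (total-cong {n} λ j → when-true (g (pos j)) (<⇒<ᵇ (pos<n j)))

  reserve-jobs : reserve ≡ total (λ j → p j when isRJob j)
  reserve-jobs = trans (prefix-all pr) (total-cong {n} λ j →
    cong₂ _when_ (byPos-pos 0 p j) (byPos-pos false isRJob j))

  module _ (cls : ℕ → Class) (S F : ℕ) where

    open Assignment cls S F

    share-pos : ∀ x j → share p′ x (pos j) ≡ p j when (code (cls (pos j)) ≡ᵇ code x)
    share-pos x j = cong (_when (code (cls (pos j)) ≡ᵇ code x)) (byPos-pos 0 p j)

    load-jobs : ∀ x k → k ≤ n →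
      load p′ x k ≡ total (λ j → p j when ((code (cls (pos j)) ≡ᵇ code x) ∧ (pos j <ᵇ k)))
    load-jobs x k k≤n = trans (prefix-jobs (share p′ x) k k≤n) (total-cong {n} λ j →
      trans (cong (_when (pos j <ᵇ k)) (share-pos x j)) (when-∧ (p j) (code (cls (pos j)) ≡ᵇ code x)))
      where
      when-∧ : ∀ v b {c} → v when b when c ≡ v when (b ∧ c)
      when-∧ v true      = refl
      when-∧ v false {true}  = refl
      when-∧ v false {false} = refl

    load-all : ∀ x → load p′ x n ≡ total (λ j → p j when (code (cls (pos j)) ≡ᵇ code x))
    load-all x = trans (prefix-all (share p′ x)) (total-cong {n} (share-pos x))

  load-member : ∀ (cls : ℕ → Class) x {k} j → T ((code (cls (pos j)) ≡ᵇ code x) ∧ (pos j <ᵇ k)) →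
                cls (pos j) ≡ x × pos j < k
  load-member cls x j t with Equivalence.to T-∧ t
  ... | c , l = code≡ᵇ⇒≡ c , <ᵇ⇒< _ _ l

  -- From a sequence to an assignment of no greater weight

  module FromSequence (π : Sequence I) where

    open Times I π hiding (q; isRJob)

    -- A late job that is not an r-job gets `𝐃ˡ` wherever it is processed; even within the renting
    -- period it can only leave more room for the others.
    classOf : Fin n → Class
    classOf j = if isRJob j then (if early? j then 𝐁 else 𝐁ˡ)
                else if early? j then (if Cπ j ≤ᵇ rentStart then 𝐀 else if rentEnd ≤ᵇ start j then 𝐃 else 𝐁)
                else 𝐃ˡ

    data Placed (j : Fin n) : Class → Set where
      placedA  : ¬ T (isRJob j) → Cπ j < q j → Cπ j ≤ rentStart → Placed j 𝐀
      placedB  : Cπ j < q j → rentStart ≤ start j → Cπ j ≤ rentEnd → Placed j 𝐁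
      placedBˡ : T (isRJob j) → ¬ (Cπ j < q j) → Placed j 𝐁ˡ
      placedD  : ¬ T (isRJob j) → Cπ j < q j → rentEnd ≤ start j → Placed j 𝐃
      placedDˡ : ¬ T (isRJob j) → ¬ (Cπ j < q j) → Placed j 𝐃ˡ

    placed : ∀ j → Placed j (classOf j)
    placed j with isRJob j in r | Cπ j <ᵇ q j in e | Cπ j ≤ᵇ rentStart in s | rentEnd ≤ᵇ start j in f
    ... | true  | true  | _ | _ = placedB (is< e) (rentStart≤ (is r)) (≤rentEnd (is r))
    ... | true  | false | _ | _ = placedBˡ (is r) (isn't< e)
    ... | false | true  | true  | _     = placedA (isn't r) (is< e) (≤ᵇ⇒≤ _ _ (is s))
    ... | false | true  | false | true  = placedD (isn't r) (is< e) (≤ᵇ⇒≤ _ _ (is f))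
    ... | false | true  | false | false = placedB (is< e) (proj₁ within) (proj₂ within)
      where within = inside j (isn't r) (isn't s ∘ ≤⇒≤ᵇ) (isn't f ∘ ≤⇒≤ᵇ)
    ... | false | false | _ | _ = placedDˡ (isn't r) (isn't< e)

    cls : ℕ → Class
    cls = byPos 𝐃ˡ classOf

    placed′ : ∀ {j x} → cls (pos j) ≡ x → Placed j x
    placed′ {j} e = subst (Placed j) (trans (sym (byPos-pos 𝐃ˡ classOf j)) e) (placed j)

    open Assignment cls rentStart rentEnd

    private
      -- The exchange argument for due dates: among the jobs of class `x` up to `j`, some job `l` is
      -- completed only after the whole load. It is early, and its due date is at most that of `j`.
      on-time : ∀ x {base} → (∀ j → Placed j x → base ≤ start j × Cπ j < q j) →
                ∀ j → cls (pos j) ≡ x → base + load p′ x (suc (pos j)) < q′ (pos j)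
      on-time x {base} h j e = conclude (busy X {base} {j} j∈X λ i i∈X → proj₁ (h i (placed′ (proj₁ (member i i∈X)))))
        where
        X : Fin n → Bool
        X i = (code (cls (pos i)) ≡ᵇ code x) ∧ (pos i <ᵇ suc (pos j))
        member : ∀ i → T (X i) → cls (pos i) ≡ x × pos i < suc (pos j)
        member = load-member cls x
        j∈X : T (X j)
        j∈X = Equivalence.from T-∧ (≡⇒code≡ᵇ e , <⇒<ᵇ (n<1+n (pos j)))
        conclude : (∃[ l ] T (X l) × base + total (λ i → p i when X i) ≤ Cπ l) →
                   base + load p′ x (suc (pos j)) < q′ (pos j)
        conclude (l , l∈X , le) = begin-strict
          base + load p′ x (suc (pos j))    ≡⟨ cong (λ z → base + z) (load-jobs cls rentStart rentEnd x (suc (pos j)) (pos<n j)) ⟩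
          base + total (λ i → p i when X i) ≤⟨ le ⟩
          Cπ l                              <⟨ proj₂ (h l (placed′ (proj₁ (member l l∈X)))) ⟩
          q l                               ≡⟨ byPos-pos 0 q l ⟨
          q′ (pos l)                        ≤⟨ q′-mono (s≤s⁻¹ (proj₂ (member l l∈X))) (pos<n j) ⟩
          q′ (pos j)                        ∎
          where open ≤-Reasoning

    timely : ∀ k → k < n → Timely k
    timely = at-pos λ j → record
      { onA = on-time 𝐀 (λ { i (placedA _ c<q _) → z≤n , c<q }) j
      ; onB = on-time 𝐁 (λ { i (placedB c<q s _) → s , c<q }) j
      ; onD = on-time 𝐃 (λ { i (placedD _ c<q s) → s , c<q }) j }

    allowed : ∀ k → k < n → Allowed (isR′ k) (cls k)
    allowed = at-pos λ j → subst₂ Allowed (sym (byPos-pos false isRJob j)) (sym (byPos-pos 𝐃ˡ classOf j)) (go j (placed j))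
      where
      go : ∀ j {x} → Placed j x → Allowed (isRJob j) x
      go j (placedA o _ _)  = subst (λ β → Allowed β 𝐀) (sym (isn't⁻ o)) allowA
      go j (placedB _ _ _)  = allowB
      go j (placedBˡ r _)   = subst (λ β → Allowed β 𝐁ˡ) (sym (is⁻ r)) allowBˡ
      go j (placedD o _ _)  = subst (λ β → Allowed β 𝐃) (sym (isn't⁻ o)) allowD
      go j (placedDˡ o _)   = subst (λ β → Allowed β 𝐃ˡ) (sym (isn't⁻ o)) allowDˡ

    roomA : load p′ 𝐀 n ≤ rentStart
    roomA = subst (_≤ rentStart) (sym (load-all cls rentStart rentEnd 𝐀)) (occupied _ z≤n (λ _ _ → z≤n)
      λ j t → done (placed′ (code≡ᵇ⇒≡ {cls (pos j)} t)))
      where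
      done : ∀ {j} → Placed j 𝐀 → Cπ j ≤ rentStart
      done (placedA _ _ s) = s

    private
      inBlock : Fin n → Bool
      inBlock j = isRJob j ∨ (code (cls (pos j)) ≡ᵇ code 𝐁)

      inBlock-times : ∀ j → T (inBlock j) → rentStart ≤ start j × Cπ j ≤ rentEnd
      inBlock-times j t with Equivalence.to T-∨ t
      ... | inj₁ r = rentStart≤ r , ≤rentEnd r
      ... | inj₂ c = times (placed′ (code≡ᵇ⇒≡ {cls (pos j)} c))
        where
        times : Placed j 𝐁 → rentStart ≤ start j × Cπ j ≤ rentEnd
        times (placedB _ s f) = s , f

      -- `po` vanishes on r-jobs, so an early r-job is counted only once, through `reserve`.
      block-load : load po 𝐁 n + reserve ≤ total (λ j → p j when inBlock j)
      block-load = subst (_≤ total (λ j → p j when inBlock j))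
        (sym (cong₂ _+_ (prefix-all (share po 𝐁)) reserve-jobs)) (total-+≤ {n} pointwise)
        where
        pointwise : ∀ j → share po 𝐁 (pos j) + p j when isRJob j ≤ p j when inBlock j
        pointwise j rewrite byPos-pos false isRJob j | byPos-pos 0 p j with isRJob j | code (cls (pos j)) ≡ᵇ 1
        ... | true  | true  = ≤-refl
        ... | true  | false = ≤-refl
        ... | false | true  = ≤-reflexive (+-identityʳ (p j))
        ... | false | false = z≤n

    block-fits : rentStart + (load po 𝐁 n + reserve) ≤ rentEnd
    block-fits = ≤-trans (+-monoʳ-≤ rentStart block-load) (occupied inBlock rentStart≤rentEnd
      (λ j → proj₁ ∘ inBlock-times j) (λ j → proj₂ ∘ inBlock-times j))

    roomB : load po 𝐁 n + (reserve + rentStart) ≤ rentEnd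
    roomB = subst (_≤ rentEnd) (trans (+-comm rentStart _) (+-assoc (load po 𝐁 n) reserve rentStart)) block-fits

    reserve≤ : reserve + rentStart ≤ rentEnd
    reserve≤ = m+n≤o⇒n≤o (load po 𝐁 n) roomB

    weight-jobs : prefix weight n ≡ weightedTardy I π
    weight-jobs = trans (prefix-all weight) (total-cong {n} λ j → trans
      (cong₂ (λ v x → v when isLate x) (byPos-pos 0 w j) (byPos-pos 𝐃ˡ classOf j)) (tardy j (placed j)))
      where
      tardy : ∀ j {x} → Placed j x → w j when isLate x ≡ w j * U I π j
      tardy j (placedA _ c<q _) rewrite U-early j c<q = sym (*-zeroʳ (w j))
      tardy j (placedB c<q _ _) rewrite U-early j c<q = sym (*-zeroʳ (w j))
      tardy j (placedD _ c<q _) rewrite U-early j c<q = sym (*-zeroʳ (w j))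
      tardy j (placedBˡ _ c≮q)  rewrite U-late j c≮q  = sym (*-identityʳ (w j))
      tardy j (placedDˡ _ c≮q)  rewrite U-late j c≮q  = sym (*-identityʳ (w j))

    V≤weightedTardy : V n (initial rentStart rentEnd) ≤ weightedTardy I π
    V≤weightedTardy = subst (V n (initial rentStart rentEnd) ≤_) weight-jobs
      (V-complete q′-mono allowed timely roomA roomB _ (initial-inv cls reserve≤))

-- From an assignment to a sequence, and optimality

module Schedule (I : Instance) where

  open Instance I
  open DueDateOrder I

  module ToSequence (cls : ℕ → Class) where

    module K = StableSort {n} (λ k → code (cls (toℕ k)))

    opaque
      -- The positions in the order of due dates are sorted by class; stability keeps each class in
      -- that order.
      sequence : Sequence I
      sequence = K.order ∘ₚ order

      sequence-at : ∀ j → sequence ⟨$⟩ˡ j ≡ K.rank (Q.rank j)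
      sequence-at j = refl

      sequence-job : ∀ k → sequence ⟨$⟩ʳ k ≡ job (K.order ⟨$⟩ʳ k)
      sequence-job k = refl

    open Times I sequence hiding (q; isRJob)

    codeOf : Fin n → ℕ
    codeOf j = code (cls (pos j))

    private
      codeOf≡ : ∀ j → code (cls (toℕ (Q.rank j))) ≡ codeOf j
      codeOf≡ j = cong (code ∘ cls) (sym (pos≡ j))

      rank≤ : ∀ {i j} → at i Fin.≤ at j → K.rank (Q.rank i) Fin.≤ K.rank (Q.rank j)
      rank≤ {i} {j} = subst₂ Fin._≤_ (sequence-at i) (sequence-at j)

    at≤⇒code≤ : ∀ {i j} → at i Fin.≤ at j → codeOf i ≤ codeOf j
    at≤⇒code≤ {i} {j} le = subst₂ _≤_ (codeOf≡ i) (codeOf≡ j) (K.key≤ (K.rank-reflects (rank≤ {i} {j} le)))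

    at≤⇒pos≤ : ∀ {i j} → codeOf i ≡ codeOf j → at i Fin.≤ at j → pos i ≤ pos j
    at≤⇒pos≤ {i} {j} eq le = subst₂ _≤_ (sym (pos≡ i)) (sym (pos≡ j))
      (K.key≤′ (trans (codeOf≡ i) (trans eq (sym (codeOf≡ j)))) (K.rank-reflects (rank≤ {i} {j} le)))

    code<⇒at≤ : ∀ {i j} → codeOf i < codeOf j → at i Fin.≤ at j
    code<⇒at≤ {i} {j} lt =
      subst₂ Fin._≤_ (sym (sequence-at i)) (sym (sequence-at j)) $ K.rank-mono (<⇒≤ (K.key< (subst₂ _<_ (sym (codeOf≡ i)) (sym (codeOf≡ j)) lt)))

    -- The time at which the class with code `c` starts: the block occupies the time from `under 1`
    -- to `under 3`.
    under : ℕ → ℕ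
    under c = total λ i → p i when (codeOf i <ᵇ c)

    module _ {S F : ℕ} where

      open Assignment cls S F

      under-suc : ∀ x → under (suc (code x)) ≤ under (code x) + load p′ x n
      under-suc x = subst (λ z → under (suc (code x)) ≤ under (code x) + z) (sym (load-all cls S F x))
        (total-≤+ {n} λ i → when-cover (p i) {codeOf i <ᵇ code x} {codeOf i ≡ᵇ code x} (split i))
        where
        split : ∀ i → T (codeOf i <ᵇ suc (code x)) → T (codeOf i <ᵇ code x) ⊎ T (codeOf i ≡ᵇ code x)
        split i lt with m≤n⇒m<n∨m≡n (s≤s⁻¹ (<ᵇ⇒< (codeOf i) _ lt))
        ... | inj₁ c< = inj₁ (<⇒<ᵇ c<)
        ... | inj₂ c≡ = inj₂ (≡⇒≡ᵇ _ _ c≡)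

      -- A job placed no later than `j` has a smaller code, or the same code and a position in the
      -- order of due dates that is not beyond that of `j`.
      C-bound : ∀ {j x} → cls (pos j) ≡ x → Cπ j ≤ under (code x) + load p′ x (suc (pos j))
      C-bound {j} {x} e = subst (λ z → Cπ j ≤ under (code x) + z) (sym (load-jobs cls S F x (suc (pos j)) (pos<n j)))
        (total-≤+ {n} λ i → when-cover (p i) {codeOf i <ᵇ code x}
          {(codeOf i ≡ᵇ code x) ∧ (pos i <ᵇ suc (pos j))} (split i))
        where
        split : ∀ i → T (does (at i Fin.≤? at j)) →
                T (codeOf i <ᵇ code x) ⊎ T ((codeOf i ≡ᵇ code x) ∧ (pos i <ᵇ suc (pos j)))
        split i t with m≤n⇒m<n∨m≡n (at≤⇒code≤ {i} {j} (ᵗ≤ {i} {j} t))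
        ... | inj₁ c< = inj₁ (<⇒<ᵇ (subst (codeOf i <_) (cong code e) c<))
        ... | inj₂ c≡ = inj₂ (Equivalence.from T-∧
                (≡⇒≡ᵇ _ _ (trans c≡ (cong code e)) , <⇒<ᵇ (s≤s (at≤⇒pos≤ {i} {j} c≡ (ᵗ≤ {i} {j} t)))))

      module _ (timely : ∀ k → k < n → Timely k) (allowed : ∀ k → k < n → Allowed (isR′ k) (cls k))
               (roomA : load p′ 𝐀 n ≤ S) (roomB : load po 𝐁 n + (reserve + S) ≤ F) where

        blockLoad : ℕ
        blockLoad = load p′ 𝐁 n + load p′ 𝐁ˡ n

        -- Only r-jobs are allowed in `𝐁ˡ`. Hence every job of the block is either an r-job, counted
        -- in `reserve`, or counted by `po` in `𝐁`.
        blockLoad≤ : blockLoad ≤ load po 𝐁 n + reserve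
        blockLoad≤ = ≤-trans (prefix-+≤ (share p′ 𝐁) (share p′ 𝐁ˡ) h n pointwise)
                             (prefix-≤+ (share po 𝐁) pr h n (λ _ _ → ≤-refl))
          where
          h : ℕ → ℕ
          h k = share po 𝐁 k + pr k
          pointwise : ∀ k → k < n → share p′ 𝐁 k + share p′ 𝐁ˡ k ≤ h k
          pointwise k k<n with cls k | isR′ k | allowed k k<n
          ... | 𝐀  | _     | _ = z≤n
          ... | 𝐁  | true  | _ = ≤-reflexive (+-identityʳ _)
          ... | 𝐁  | false | _ = ≤-refl
          ... | 𝐁ˡ | true  | _ = ≤-refl
          ... | 𝐃  | _     | _ = z≤n
          ... | 𝐃ˡ | _     | _ = z≤n

        S+blockLoad≤F : S + blockLoad ≤ F
        S+blockLoad≤F = ≤-trans (+-monoʳ-≤ S blockLoad≤) (subst (_≤ F)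
          (trans (sym (+-assoc (load po 𝐁 n) reserve S)) (+-comm _ S)) roomB)

        under1≤ : under 1 ≤ S
        under1≤ = ≤-trans (under-suc 𝐀) (subst (λ z → z + load p′ 𝐀 n ≤ S) (sym under0) roomA)
          where
          under0 : under 0 ≡ 0
          under0 = total-zero {n} _ λ _ → refl

        under3≤ : under 3 ≤ under 1 + blockLoad
        under3≤ = ≤-trans (under-suc 𝐁ˡ) (≤-trans (+-monoˡ-≤ _ (under-suc 𝐁)) (≤-reflexive (+-assoc (under 1) _ _)))

        on-time : ∀ j → isLate (cls (pos j)) ≡ false → Cπ j < q j
        on-time j e with cls (pos j) in c
        ... | 𝐀 = subst (Cπ j <_) (byPos-pos 0 q j) (≤-<-trans
                    (≤-trans (C-bound {j} c) (≤-reflexive (cong (_+ load p′ 𝐀 (suc (pos j))) (total-zero {n} _ λ _ → refl))))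
                    (Timely.onA (timely (pos j) (pos<n j)) c))
        ... | 𝐁 = subst (Cπ j <_) (byPos-pos 0 q j) (≤-<-trans
                    (≤-trans (C-bound {j} c) (+-monoˡ-≤ _ under1≤))
                    (Timely.onB (timely (pos j) (pos<n j)) c))
        ... | 𝐃 = subst (Cπ j <_) (byPos-pos 0 q j) (≤-<-trans
                    (≤-trans (C-bound {j} c) (+-monoˡ-≤ _ (≤-trans under3≤ (≤-trans (+-monoˡ-≤ blockLoad under1≤) S+blockLoad≤F))))
                    (Timely.onD (timely (pos j) (pos<n j)) c))

        -- Equality may fail: a job assigned to a late class can turn out to be early.
        sequence-weight : weightedTardy I sequence ≤ prefix weight n
        sequence-weight = subst (weightedTardy I sequence ≤_) (sym (prefix-all weight)) (total-mono {n} pointwise)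
          where
          U≤1 : ∀ j → U I sequence j ≤ 1
          U≤1 j = when-≤ 1 {c = true} _
          pointwise : ∀ j → w j * U I sequence j ≤ weight (pos j)
          pointwise j with isLate (cls (pos j)) in l
          ... | true  = subst (w j * U I sequence j ≤_) (trans (*-identityʳ (w j)) (sym (byPos-pos 0 w j))) (*-monoʳ-≤ (w j) (U≤1 j))
          ... | false rewrite U-early j (on-time j l) = ≤-reflexive (*-zeroʳ (w j))

        -- The block starts at `under 1`, possibly before `S`, but its length `blockLoad` is still
        -- at most `F ∸ S`.
        sequence-er : er I sequence ≤ F ∸ S
        sequence-er = ≤-trans (er-≤ {under 1} {blockLoad} rJob-times) (m+n≤o⇒m≤o∸n blockLoad (subst (_≤ F) (+-comm S blockLoad) S+blockLoad≤F))
          where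
          block-codes : ∀ j → T (isRJob j) → 0 < codeOf j × codeOf j < 3
          block-codes j r with cls (pos j)
            | subst (λ β → Allowed β (cls (pos j))) (trans (byPos-pos false isRJob j) (is⁻ r)) (allowed (pos j) (pos<n j))
          ... | 𝐁  | _ = s≤s z≤n , s≤s (s≤s z≤n)
          ... | 𝐁ˡ | _ = s≤s z≤n , s≤s (s≤s (s≤s z≤n))
          rJob-times : ∀ j → T (isRJob j) → under 1 + p j ≤ Cπ j × Cπ j ≤ under 1 + blockLoad
          rJob-times j r = subst (λ z → under 1 + z ≤ Cπ j) (total-at p j)
              (total-+≤ {n} λ i → when-disjoint (p i) {codeOf i <ᵇ 1} {does (i Fin.≟ j)}
                (λ t → ≤ᵗ {i} {j} (code<⇒at≤ {i} {j} (<-≤-trans (<ᵇ⇒< (codeOf i) 1 t) (proj₁ (block-codes j r)))))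
                (λ t → ≤ᵗ {i} {j} (≤-reflexive (cong (toℕ ∘ at) (same i t))))
                (λ t u → <⇒≱ (proj₁ (block-codes j r)) (s≤s⁻¹ (subst (λ k → codeOf k < 1) (same i u) (<ᵇ⇒< (codeOf i) 1 t)))))
            , ≤-trans (total-mono {n} λ i → when-≤ (p i) {does (at i Fin.≤? at j)} {codeOf i <ᵇ 3}
                (λ t → <⇒<ᵇ (≤-<-trans (at≤⇒code≤ {i} {j} (ᵗ≤ {i} {j} t)) (proj₂ (block-codes j r))))) under3≤
            where
            same : ∀ i → T (does (i Fin.≟ j)) → i ≡ j
            same i t with i Fin.≟ j
            ... | yes i≡j = i≡j

  -- The budget is added to `S` in ℤ because `Kʳ` may be negative.
  record Window (S F : ℕ) : Set where
    field
      spacious : reserve + S ≤ F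
      bounded  : F ≤ P I
      cheap    : + F ℤ.≤ + S ℤ.+ Kʳ

  module _ (π : Sequence I) (feasible : Feasible I π) where

    open FromSequence π
    open Times I π using (rentStart; rentEnd; rentEnd≤P; rentStart≤rentEnd)

    rent-window : Window rentStart rentEnd
    rent-window = record
      { spacious = reserve≤ ; bounded = rentEnd≤P
      ; cheap = subst (λ z → + z ℤ.≤ + rentStart ℤ.+ Kʳ) (m+[n∸m]≡n rentStart≤rentEnd) (ℤ.+-monoʳ-≤ (+ rentStart) feasible) }

    -- All r-jobs are processed within the renting period. Conversely, if they fit the budget, the
    -- pair `0`, `reserve` is a window, so this inequality alone decides whether a feasible sequence
    -- exists.
    reserve≤Kʳ : + reserve ℤ.≤ Kʳ
    reserve≤Kʳ = ℤ.≤-trans (ℤ.+≤+ (m+n≤o⇒m≤o∸n reserve reserve≤)) feasible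

  reserve≤P : reserve ≤ P I
  reserve≤P = subst (_≤ P I) (sym reserve-jobs) (total-mono {n} λ j → when-≤ (p j) {c = true} _)

  answer : ℕ → ℕ → Sequence I
  answer S F = ToSequence.sequence (Walk.chosen (initial S F))

  -- The renting period of any feasible sequence is itself a window, so it competes in the minimum
  -- that selects `S` and `F`.
  answer-optimal : ∀ {S F} → Window S F →
    (∀ {S′ F′} → Window S′ F′ → V n (initial S F) ≤ V n (initial S′ F′)) → Optimal I (answer S F)
  answer-optimal {S} {F} win best = feasible , λ π feasibleπ → begin
    weightedTardy I (answer S F)           ≤⟨ sequence-weight timely allowed roomA roomB ⟩
    prefix weight n                        ≡⟨ walk-weight {S} {F} q′-mono inv ⟩
    V n (initial S F)                      ≤⟨ best (rent-window π feasibleπ) ⟩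
    V n (initial _ _)                      ≤⟨ FromSequence.V≤weightedTardy π ⟩
    weightedTardy I π                      ∎
    where
    open ≤-Reasoning
    open Window win
    open Walk (initial S F)
    open Assignment chosen S F
    open ToSequence chosen
    inv : Inv 0 (initial S F)
    inv = initial-inv chosen spacious
    timely = walk-timely {S} {F} q′-mono inv
    allowed = walk-allowed {S} {F} q′-mono inv
    end : Inv n (position n)
    end = walk-inv q′-mono inv n ≤-refl
    roomA : load p′ 𝐀 n ≤ S
    roomA = loadA≤S end
    roomB : load po 𝐁 n + (reserve + S) ≤ F
    roomB = subst (load po 𝐁 n + (reserve + S) ≤_) (Inv.roomB end) (m≤n+m _ (blockRoom (position n)))
    F∸S≤Kʳ : + (F ∸ S) ℤ.≤ Kʳ
    F∸S≤Kʳ = cancel (+ S) (subst (λ z → + z ℤ.≤ + S ℤ.+ Kʳ)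
      (sym (m+[n∸m]≡n (m+n≤o⇒n≤o reserve spacious))) cheap)
      where
      cancel : ∀ s {x y} → s ℤ.+ x ℤ.≤ s ℤ.+ y → x ℤ.≤ y
      cancel s {x} {y} le = subst₂ ℤ._≤_ (undo x) (undo y) (ℤ.+-monoʳ-≤ (ℤ.- s) le)
        where
        undo : ∀ z → ℤ.- s ℤ.+ (s ℤ.+ z) ≡ z
        undo z = trans (sym (ℤ.+-assoc (ℤ.- s) s z)) (trans (cong (ℤ._+ z) (ℤ.+-inverseˡ s)) (ℤ.+-identityˡ z))
    feasible : Feasible I (answer S F)
    feasible = ℤ.≤-trans (ℤ.+≤+ (sequence-er timely allowed roomA roomB)) F∸S≤Kʳ

-- Digits, and effects of programs on stores

digit-< : ∀ {y d X} B → y * B + d < X * B → y < X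
digit-< {y} {d} {X} B lt = ≰⇒> λ X≤y → <⇒≱ lt (≤-trans (*-monoˡ-≤ B X≤y) (m≤m+n (y * B) d))

digits-< : ∀ {y d X B} → y < X → d < B → y * B + d < X * B
digits-< {y} {d} {X} {B} y<X d<B = begin-strict
  y * B + d  <⟨ +-monoʳ-< (y * B) d<B ⟩
  y * B + B  ≡⟨ +-comm (y * B) B ⟩
  suc y * B  ≤⟨ *-monoˡ-≤ B y<X ⟩
  X * B      ∎
  where open ≤-Reasoning

digits-injective : ∀ {y d y′ d′} B → d < B → d′ < B → y * B + d ≡ y′ * B + d′ → y ≡ y′ × d ≡ d′
digits-injective {y} {d} {y′} {d′} B d<B d′<B eq with y≡y′
  where
  y≡y′ : y ≡ y′
  y≡y′ = ≤-antisym
    (s≤s⁻¹ (digit-< B (subst (_< suc y′ * B) (sym eq) (digits-< (n<1+n y′) d′<B))))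
    (s≤s⁻¹ (digit-< B (subst (_< suc y * B) eq (digits-< (n<1+n y) d<B))))
... | refl = refl , +-cancelˡ-≡ (y * B) d d′ eq

Num : Store → ℕ → ℕ → Set
Num σ x v = vars σ x ≡ + v

exec-frame : ∀ c σ → loopFree c ≡ true → Frame c σ (exec c σ)
exec-frame c σ l with run-frame (run-loopFree c σ l)
... | run _ _ (refl , fr) = fr

exec-IF : ∀ b c d σ (Q : Store → Set) → (Holds b σ → Q (exec c σ)) → (¬ Holds b σ → Q (exec d σ)) →
          Q (exec (IF b THEN c ELSE d) σ)
exec-IF b c d σ Q then else = cases (holds? b σ) then else
  where
  cases : ∀ {X : Set} (x? : Dec X) → (X → Q (exec c σ)) → (¬ X → Q (exec d σ)) →
          Q (if does x? then exec c σ else exec d σ)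
  cases (yes x) then else = then x
  cases (no ¬x) then else = else ¬x

holds⇒≤ : ∀ {x y m n} → x ≡ + m → y ≡ + n → x ℤ.≤ y → m ≤ n
holds⇒≤ e≡ f≡ h = ℤ.drop‿+≤+ (subst₂ ℤ._≤_ e≡ f≡ h)

≤⇒holds : ∀ {x y m n} → x ≡ + m → y ≡ + n → m ≤ n → x ℤ.≤ y
≤⇒holds e≡ f≡ le = subst₂ ℤ._≤_ (sym e≡) (sym f≡) (ℤ.+≤+ le)

setArr-same : ∀ a i {v} σ → arrs (setArr a i v σ) a i ≡ v
setArr-same a i {v} σ rewrite dec-true (a ≟ a) refl | dec-true (i ℤ.≟ i) refl = refl

setArr-other : ∀ a {i j v} σ → i ≢ j → arrs (setArr a i v σ) a j ≡ arrs σ a j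
setArr-other a {i} {j} σ i≢j rewrite dec-true (a ≟ a) refl | dec-false (i ℤ.≟ j) i≢j = refl

-- Bucket sort

vM vδ vJ vBound : ℕ
vBound = 60
vM     = 61
vδ     = 62
vJ     = 63

module SORTING (ak av ao : ℕ) where

  -- All `n` entries are scanned once for every key value. This is affordable for at most `P + 2`
  -- values, and scanning in index order makes the sort stable.
  MOVE PUT SCAN SORT : Program
  MOVE = ao [ var vM ]≔ av [ var vJ ] ⨾ vM ≔ var vM ⊕ lit 1ℤ
  PUT  = IF ak [ var vJ ] ≼ var vδ THEN IF var vδ ≼ ak [ var vJ ] THEN MOVE ELSE skip ELSE skip
  SCAN = FOR vJ < 0 DO PUT
  SORT = vM ≔ lit 0ℤ ⨾ FOR vδ < vBound DO SCAN

  module _ {n} (g : Fin n → ℕ) (ao≢ak : does (ao ≟ ak) ≡ false) (ao≢av : does (ao ≟ av) ≡ false)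
           (σ₀ : Store) (keys : ∀ j → arrs σ₀ ak (+ toℕ j) ≡ + g j) where

    private
      module K = StableSort g

      -- When bucket `δ` is scanned at entry `j`, the number `δ * n + j` is the sort key that this
      -- entry would have in this bucket. A single threshold `x` thus serves both loops, and
      -- `below x` entries have been moved.
      record Filled (x : ℕ) (count : ℤ) (out : ℤ → ℤ) : Set where
        field
          counted : count ≡ + K.below x
          stored  : ∀ i → K.key i < x → out (+ K.below (K.key i)) ≡ arrs σ₀ av (+ toℕ i)

      Inv : ℕ → Store → Set
      Inv x τ = Filled x (vars τ vM) (arrs τ ao)

      put : ∀ {δ} (j : Fin n) τ → Num τ vδ δ → Num τ vJ (toℕ j) →
            arrs τ ak ≡ arrs σ₀ ak → arrs τ av ≡ arrs σ₀ av →
            Inv (δ * n + toℕ j) τ → Inv (suc (δ * n + toℕ j)) (exec PUT τ)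
      put {δ} j τ δ≡ j≡ ak≡ av≡ inv = exec-IF (ak [ var vJ ] ≼ var vδ) (IF var vδ ≼ ak [ var vJ ] THEN MOVE ELSE skip) skip τ (Inv (suc x))
          (λ k≤δ → exec-IF (var vδ ≼ ak [ var vJ ]) MOVE skip τ (Inv (suc x)) (λ δ≤k → hit (≤-antisym (holds⇒≤ key≡ δ≡ k≤δ) (holds⇒≤ δ≡ key≡ δ≤k)))
                                          (λ δ≰k → miss λ e → δ≰k (≤⇒holds δ≡ key≡ (≤-reflexive (sym e)))))
          (λ k≰δ → miss λ e → k≰δ (≤⇒holds key≡ δ≡ (≤-reflexive e)))
        where
        open Filled inv
        x = δ * n + toℕ j
        key≡ : eval (ak [ var vJ ]) τ ≡ + g j
        key≡ = trans (cong (arrs τ ak) j≡) (trans (cong-app ak≡ (+ toℕ j)) (keys j))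
        miss : g j ≢ δ → Inv (suc x) τ
        miss g≢δ = record
          { counted = trans counted (cong +_ (sym (K.below-miss x other)))
          ; stored = λ i i<sx → stored i (≤∧≢⇒< (s≤s⁻¹ i<sx) (other i)) }
          where
          other : ∀ i → K.key i ≢ x
          other i eq with digits-injective {g i} {toℕ i} {δ} {toℕ j} n (Fin.toℕ<n i) (Fin.toℕ<n j) eq
          ... | g≡ , i≡j with Fin.toℕ-injective i≡j
          ... | refl = g≢δ g≡
        hit : g j ≡ δ → Inv (suc x) (exec MOVE τ)
        hit refl = record
          { counted = trans (cong (ℤ._+ 1ℤ) counted)
              (cong +_ (trans (+-comm _ 1) (sym (K.below-hit j))))
          ; stored = stored′ }
          where
          τ′ = setArr ao (vars τ vM) (arrs τ av (vars τ vJ)) τ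
          stored′ : ∀ i → K.key i < suc x → arrs τ′ ao (+ K.below (K.key i)) ≡ arrs σ₀ av (+ toℕ i)
          stored′ i i<sx with i Fin.≟ j
          ... | yes refl = trans (cong (arrs τ′ ao) (sym counted)) (trans (setArr-same ao (vars τ vM) τ)
                  (trans (cong (arrs τ av) j≡) (cong-app av≡ (+ toℕ j))))
          ... | no i≢j = trans (setArr-other ao τ fresh) (stored i i<x)
            where
            i<x : K.key i < x
            i<x = ≤∧≢⇒< (s≤s⁻¹ i<sx) λ eq → i≢j (K.key-injective eq)
            -- Entries with smaller keys are stored before place `below x`, so the new write does
            -- not hit them.
            fresh : vars τ vM ≢ + K.below (K.key i)
            fresh eq = <⇒≢ (K.below-strict i<x) (ℤ.+-injective (trans (sym eq) counted))

    sort : ∀ {b} → 1 ≤ n → 1 ≤ b → (∀ j → g j < b) → Num σ₀ 0 n → Num σ₀ vBound b →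
           Run SORT σ₀ (2 + (maxCost PUT + 16 + 16) * (b * (n * 1)))
             (λ τ → ∀ i → arrs τ ao (+ K.below (K.key i)) ≡ arrs σ₀ av (+ toℕ i))
    sort {b} 1≤n 1≤b g<b n≡ b≡ = run-seq (run ⇓-var ≤-refl (run-mono ≤-refl (λ {τ} → conclude {τ}) outer))
      where
      σ₁ = exec (vM ≔ lit 0ℤ) σ₀
      OuterInv : ℕ → Store → Set
      OuterInv δ = Inv (δ * n)
      conclude : ∀ {τ} → Inv (b * n) τ → ∀ i → arrs τ ao (+ K.below (K.key i)) ≡ arrs σ₀ av (+ toℕ i)
      conclude inv i = Filled.stored inv i (digits-< (g<b i) (Fin.toℕ<n i))
      unread : ∀ a → does (ao ≟ a) ≡ false → writesArr (FOR vδ < vBound DO SCAN) a ≡ false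
      unread a h rewrite h = refl
      unread′ : ∀ a → does (ao ≟ a) ≡ false → writesArr SCAN a ≡ false
      unread′ a h rewrite h = refl
      outer : Run (FOR vδ < vBound DO SCAN) σ₁ ((maxCost PUT + 16 + 16) * (b * (n * 1))) (OuterInv b)
      outer = run-for* {SCAN} {vδ} {vBound} {b} OuterInv refl refl refl scan b≡ {K = maxCost PUT + 16} ≤-refl 1≤X 1≤b
        (record { counted = cong +_ (sym K.below-zero) ; stored = λ i () })
        where
        1≤X : 1 ≤ n * 1
        1≤X = subst (1 ≤_) (sym (*-identityʳ n)) 1≤n
        scan : ∀ δ τ → δ < b → Frame (FOR vδ < vBound DO SCAN) σ₁ τ → Num τ vδ δ → OuterInv δ τ →
               Run SCAN τ ((maxCost PUT + 16) * (n * 1)) (λ υ → OuterInv (suc δ) (setVar vδ (+ suc δ) υ))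
        scan δ τ δ<b fr δ≡ inv = run-mono ≤-refl (λ {υ} → subst (λ x → Inv x υ) (+-comm (δ * n) n))
          (run-for-flat {PUT} {vJ} {0} {n} (λ j → Inv (δ * n + j)) refl refl refl step
            (trans (sameVar fr 0 refl) n≡) 1≤n
            (subst (λ x → Inv x τ) (sym (+-identityʳ _)) inv))
          where
          step : ∀ j υ → j < n → Frame SCAN τ υ → Num υ vJ j → Inv (δ * n + j) υ →
                 Run PUT υ (maxCost PUT) (λ ϕ → Inv (δ * n + suc j) (setVar vJ (+ suc j) ϕ))
          step j υ j<n fr′ j≡ inv = run-exec PUT refl (subst (λ x → Inv x (exec PUT υ)) x≡
            (put (fromℕ< j<n) υ (trans (sameVar fr′ vδ refl) δ≡) (trans j≡ (cong +_ (sym toℕj)))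
              (trans (sameArr fr′ ak (unread′ ak ao≢ak)) (sameArr fr ak (unread ak ao≢ak)))
              (trans (sameArr fr′ av (unread′ av ao≢av)) (sameArr fr av (unread av ao≢av)))
              (subst (λ x → Inv (δ * n + x) υ) (sym toℕj) inv)))
            where
            toℕj : toℕ (fromℕ< j<n) ≡ j
            toℕj = Fin.toℕ-fromℕ< j<n
            x≡ : suc (δ * n + toℕ (fromℕ< j<n)) ≡ δ * n + suc j
            x≡ = trans (cong (λ z → suc (δ * n + z)) toℕj) (sym (+-suc (δ * n) j))

-- Tabulated products and addresses of states

vB vThree vL vZ vX vY vI vAcc aM aV : ℕ
vB     = 5
vThree = 8
vL     = 13
vZ     = 14
vX     = 15
vY     = 16
vI     = 17
vAcc   = 18
aM     = 9
aV     = 10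

-- Products by the radix B are tabulated, as the machine cannot multiply.

TRIPLE ADDL SCALE FILL TABLE : Program
TRIPLE = vL ≔ var 0 ⊕ lit 1ℤ ⨾ vL ≔ var vL ⊕ var vL ⊕ var vL
ADDL   = vZ ≔ var vZ ⊕ var vL
SCALE  = vZ ≔ lit 0ℤ ⨾ FOR vY < vB DO ADDL ⨾ vL ≔ var vZ
FILL   = aM [ var vI ]≔ var vAcc ⨾ vAcc ≔ var vAcc ⊕ var vB
TABLE  = TRIPLE ⨾ (FOR vX < vThree DO SCALE) ⨾ vAcc ≔ lit 0ℤ ⨾ FOR vI < vL DO FILL

MulTable : ℕ → ℕ → Store → Set
MulTable L B σ = ∀ i → i < L → arrs σ aM (+ i) ≡ + (i * B)

kTable : ℕ
kTable = maxCost TRIPLE + ((maxCost ADDL + 36) * 3 + (2 + (maxCost FILL + 16)))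

module _ {B : ℕ} (1≤B : 1 ≤ B) where

  scale : ∀ {l σ} → Num σ vB B → Num σ vL l →
          Run SCALE σ (2 + ((maxCost ADDL + 16) * (B * 1) + 2)) (λ τ → Num τ vL (B * l))
  scale {l} {σ} B≡ l≡ = run-seq {vZ ≔ lit 0ℤ} (run ⇓-var ≤-refl (run-seq
    (run-mono ≤-refl (λ {τ} z≡ → run {vL ≔ var vZ} {τ} ⇓-var ≤-refl z≡)
      (run-for-flat {ADDL} {vY} {vB} {B} {maxCost ADDL} (λ i τ → Num τ vZ (i * l)) refl refl refl add B≡ 1≤B refl))))
    where
    σ₁ = exec (vZ ≔ lit 0ℤ) σ
    add : ∀ i τ → i < B → Frame (FOR vY < vB DO ADDL) σ₁ τ → Num τ vY i → Num τ vZ (i * l) →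
          Run ADDL τ (maxCost ADDL) (λ υ → Num (setVar vY (+ suc i) υ) vZ (suc i * l))
    add i τ _ fr _ z≡ = run-exec ADDL refl
      (trans (cong₂ ℤ._+_ z≡ (trans (sameVar fr vL refl) l≡)) (cong +_ (+-comm (i * l) l)))

  scales : ∀ {l σ} → Num σ vB B → Num σ vThree 3 → Num σ vL l →
           Run (FOR vX < vThree DO SCALE) σ (((maxCost ADDL + 20) + 16) * (3 * (B * 1)))
             (λ τ → Num τ vL (B ^ 3 * l))
  scales {l} {σ} B≡ three≡ l≡ = run-for* {SCALE} {vX} {vThree} {3} (λ i τ → Num τ vL (B ^ i * l)) refl refl refl step three≡
    {K = maxCost ADDL + 20} time≤ 1≤X (s≤s z≤n) (trans l≡ (cong +_ (sym (*-identityˡ l))))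
    where
    1≤X : 1 ≤ B * 1
    1≤X = subst (1 ≤_) (sym (*-identityʳ B)) 1≤B
    -- The two assignments around the inner loop cost 2 each, which turns 16 into 20.
    time≤ : 2 + ((maxCost ADDL + 16) * (B * 1) + 2) ≤ (maxCost ADDL + 20) * (B * 1)
    time≤ = begin
      2 + ((maxCost ADDL + 16) * (B * 1) + 2)
        ≤⟨ +-mono-≤ (*-monoʳ-≤ 2 1≤X) (+-monoʳ-≤ ((maxCost ADDL + 16) * (B * 1)) (*-monoʳ-≤ 2 1≤X)) ⟩
      2 * (B * 1) + ((maxCost ADDL + 16) * (B * 1) + 2 * (B * 1))
        ≡⟨ solve 2 (λ k x → con 2 :* x :+ ((k :+ con 16) :* x :+ con 2 :* x) := (k :+ con 20) :* x) refl (maxCost ADDL) (B * 1) ⟩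
      (maxCost ADDL + 20) * (B * 1) ∎
      where
      open ≤-Reasoning
      open +-*-Solver
    step : ∀ i τ → i < 3 → Frame (FOR vX < vThree DO SCALE) σ τ → Num τ vX i → Num τ vL (B ^ i * l) →
           Run SCALE τ (2 + ((maxCost ADDL + 16) * (B * 1) + 2)) (λ υ → Num (setVar vX (+ suc i) υ) vL (B ^ suc i * l))
    step i τ _ fr _ l≡ = run-mono ≤-refl (λ e → trans e (cong +_ (sym (*-assoc B (B ^ i) l))))
      (scale (trans (sameVar fr vB refl) B≡) l≡)

  module _ {n : ℕ} where

    private
      N = suc n + suc n + suc n
      L = B ^ 3 * N

      1≤L : 1 ≤ L
      1≤L = *-mono-≤ (subst (_≤ B ^ 3) (^-zeroˡ 3) (^-monoˡ-≤ 3 1≤B)) (s≤s z≤n)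

    fill : ∀ {σ} → Num σ vB B → Num σ vL L → Num σ vAcc 0 →
           Run (FOR vI < vL DO FILL) σ ((maxCost FILL + 16) * (L * 1)) (MulTable L B)
    fill {σ} B≡ L≡ acc≡ = run-mono ≤-refl proj₂
      (run-for-flat {FILL} {vI} {vL} {L} (λ i τ → Num τ vAcc (i * B) × MulTable i B τ) refl refl refl step L≡ 1≤L (acc≡ , λ i ()))
      where
      step : ∀ i τ → i < L → Frame (FOR vI < vL DO FILL) σ τ → Num τ vI i → Num τ vAcc (i * B) × MulTable i B τ →
             Run FILL τ (maxCost FILL) (λ υ → Num (setVar vI (+ suc i) υ) vAcc (suc i * B) × MulTable (suc i) B (setVar vI (+ suc i) υ))
      step i τ _ fr i≡ (acc≡ , table) = run-exec FILL refl
        (trans (cong₂ ℤ._+_ acc≡ (trans (sameVar fr vB refl) B≡)) (cong +_ (+-comm (i * B) B)) , table′)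
        where
        table′ : MulTable (suc i) B (exec FILL τ)
        table′ i′ i′<si with i′ ≟ i
        ... | yes refl = trans (cong (arrs (exec FILL τ) aM) (sym i≡)) (trans (setArr-same aM (vars τ vI) τ) acc≡)
        ... | no  i′≢i = trans (setArr-other aM τ (λ eq → i′≢i (ℤ.+-injective (trans (sym eq) i≡))))
                               (table i′ (≤∧≢⇒< (s≤s⁻¹ i′<si) i′≢i))

    table : ∀ {σ} → Num σ 0 n → Num σ vB B → Num σ vThree 3 → Run TABLE σ (kTable * L) (MulTable L B)
    table {σ} n≡ B≡ three≡ = run-mono time≤ id
      (run-seq (run-exec TRIPLE {σ} refl (run-seq (run-mono ≤-refl
        (λ {τ} (l≡ , fr) → run-seq {vAcc ≔ lit 0ℤ} (run ⇓-var ≤-refl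
          (fill (trans (sameVar fr vB refl) B≡) l≡ refl)))
        (run-frame (scales B≡ three≡ N≡))))))
      where
      n+1≡ : vars σ 0 ℤ.+ 1ℤ ≡ + suc n
      n+1≡ = trans (cong (ℤ._+ 1ℤ) n≡) (cong +_ (+-comm n 1))
      N≡ : Num (exec TRIPLE σ) vL N
      N≡ = cong (λ z → z ℤ.+ z ℤ.+ z) n+1≡
      B≤L : 3 * (B * 1) ≤ 3 * L
      B≤L = *-monoʳ-≤ 3 (≤-trans (*-mono-≤ (≤-refl {B}) (subst (_≤ B ^ 2) (^-zeroˡ 2) (^-monoˡ-≤ 2 1≤B))) (m≤m*n (B ^ 3) N))
      time≤ : maxCost TRIPLE + ((maxCost ADDL + 20 + 16) * (3 * (B * 1)) + (2 + (maxCost FILL + 16) * (L * 1))) ≤ kTable * L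
      time≤ = begin
        maxCost TRIPLE + ((maxCost ADDL + 20 + 16) * (3 * (B * 1)) + (2 + (maxCost FILL + 16) * (L * 1)))
          ≤⟨ +-mono-≤ (m≤m*n′ (maxCost TRIPLE)) (+-mono-≤ (*-monoʳ-≤ (maxCost ADDL + 20 + 16) B≤L) (+-monoˡ-≤ _ (m≤m*n′ 2))) ⟩
        maxCost TRIPLE * L + ((maxCost ADDL + 20 + 16) * (3 * L) + (2 * L + (maxCost FILL + 16) * (L * 1)))
          ≡⟨ solve 4 (λ a b c l → a :* l :+ ((b :+ con 20 :+ con 16) :* (con 3 :* l) :+ (con 2 :* l :+ (c :+ con 16) :* (l :* con 1)))
                               := (a :+ ((b :+ con 36) :* con 3 :+ (con 2 :+ (c :+ con 16)))) :* l) refl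
                     (maxCost TRIPLE) (maxCost ADDL) (maxCost FILL) L ⟩
        kTable * L ∎
        where
        open ≤-Reasoning
        open +-*-Solver
        m≤m*n′ : ∀ m → m ≤ m * L
        m≤m*n′ m = subst (_≤ m * L) (*-identityʳ m) (*-monoʳ-≤ m 1≤L)

ENC : Expr → Expr → Expr → Expr → Expr → Expr
ENC u f α ε t = aM [ aM [ aM [ aM [ u ] ⊕ f ] ⊕ α ] ⊕ ε ] ⊕ t

record InRange (B : ℕ) (s : State) : Set where
  constructor inRange
  field
    phase<3     : phase s < 3
    finish<B    : finish s < B
    room<B      : room s < B
    blockRoom<B : blockRoom s < B
    clock<B     : clock s < B

module Address (n B : ℕ) (1≤B : 1 ≤ B) where

  -- `ENC` multiplies by `B` four times. The first factor is below `3 (n + 1)`, so the last is below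
  -- `3 (n + 1) B³`; the clock is only added.
  tableSize : ℕ
  tableSize = B ^ 3 * (suc n + suc n + suc n)

  -- The layer is the leading digit, so each layer lies before the next, and nested loops over the
  -- digits visit the addresses in increasing order.
  address : ℕ → State → ℕ
  address m (state ph f α ε t) = ((((m * 3 + ph) * B + f) * B + α) * B + ε) * B + t

  address-injective : ∀ {m m′ s s′} → InRange B s → InRange B s′ → address m s ≡ address m′ s′ → m ≡ m′ × s ≡ s′
  address-injective {m} {m′} {s} {s′} (inRange p₁ f₁ a₁ e₁ t₁) (inRange p₂ f₂ a₂ e₂ t₂) eq
    with digits-injective {_} {clock s} {_} {clock s′} B t₁ t₂ eq
  ... | eq₁ , refl with digits-injective {_} {blockRoom s} {_} {blockRoom s′} B e₁ e₂ eq₁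
  ... | eq₂ , refl with digits-injective {(m * 3 + phase s) * B + finish s} {room s} {(m′ * 3 + phase s′) * B + finish s′} {room s′} B a₁ a₂ eq₂
  ... | eq₃ , refl with digits-injective {m * 3 + phase s} {finish s} {m′ * 3 + phase s′} {finish s′} B f₁ f₂ eq₃
  ... | eq₄ , refl with digits-injective {m} {phase s} {m′} {phase s′} 3 p₁ p₂ eq₄
  ... | refl , refl = refl , refl

  module _ {σ : Store} (mul : MulTable tableSize B σ) where

    private
      N = suc n * 3
      size : N * B * B * B ≡ tableSize
      size = solve 2 (λ n b → (con 1 :+ n) :* con 3 :* b :* b :* b
                            := b :* (b :* (b :* con 1)) :* ((con 1 :+ n) :+ (con 1 :+ n) :+ (con 1 :+ n))) refl n B
        where open +-*-Solver
      grow : ∀ x → x ≤ x * B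
      grow x = subst (_≤ x * B) (*-identityʳ x) (*-monoʳ-≤ x 1≤B)
      N³≤ = ≤-reflexive size
      N²≤ = ≤-trans (grow (N * B * B)) N³≤
      N¹≤ = ≤-trans (grow (N * B)) N²≤
      N⁰≤ = ≤-trans (grow N) N¹≤

      times : ∀ {e x} → eval e σ ≡ + x → x < tableSize → eval (aM [ e ]) σ ≡ + (x * B)
      times e≡ x< = trans (cong (arrs σ aM) e≡) (mul _ x<)

    eval-ENC : ∀ {eu ef eα eε et m} s → m ≤ n → InRange B s → eval eu σ ≡ + (m * 3 + phase s) →
               eval ef σ ≡ + finish s → eval eα σ ≡ + room s → eval eε σ ≡ + blockRoom s → eval et σ ≡ + clock s →
               eval (ENC eu ef eα eε et) σ ≡ + address m s
    eval-ENC {eu} {ef} {eα} {eε} {et} {m} s m≤n (inRange p f a e t) u≡ f≡ α≡ ε≡ t≡ =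
      cong₂ ℤ._+_ (times {aM [ aM [ aM [ eu ] ⊕ ef ] ⊕ eα ] ⊕ eε}
        (cong₂ ℤ._+_ (times {aM [ aM [ eu ] ⊕ ef ] ⊕ eα}
          (cong₂ ℤ._+_ (times {aM [ eu ] ⊕ ef}
            (cong₂ ℤ._+_ (times {eu} u≡ (<-≤-trans u< N⁰≤)) f≡) (<-≤-trans f< N¹≤)) α≡) (<-≤-trans α< N²≤)) ε≡)
        (<-≤-trans (digits-< α< e) N³≤)) t≡
      where
      u< : m * 3 + phase s < N
      u< = digits-< (s≤s m≤n) p
      f< : (m * 3 + phase s) * B + finish s < N * B
      f< = digits-< u< f
      α< : ((m * 3 + phase s) * B + finish s) * B + room s < N * B * B
      α< = digits-< f< a

-- Unchanged cells and guarded programs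

quiet : List ℕ → List ℕ → Program → Bool
quiet xs as c = all (λ x → not (writesVar c x)) xs ∧ all (λ a → not (writesArr c a)) as

record Same (xs as : List ℕ) (σ τ : Store) : Set where
  constructor same
  field
    varsKept : All (λ x → vars τ x ≡ vars σ x) xs
    arrsKept : All (λ a → arrs τ a ≡ arrs σ a) as

-- The condition on `c` computes, so `refl` carries over all that is known about the listed cells at
-- once.
frame⇒same : ∀ {xs as c σ τ} → Frame c σ τ → quiet xs as c ≡ true → Same xs as σ τ
frame⇒same {xs} {as} {c} {σ} {τ} fr q = same (go-vars xs (∧-conicalˡ _ _ q)) (go-arrs as (∧-conicalʳ (all _ xs) _ q))
  where
  not-true : ∀ {b} → not b ≡ true → b ≡ false
  not-true {false} _ = refl
  go-vars : ∀ xs → all (λ x → not (writesVar c x)) xs ≡ true → All (λ x → vars τ x ≡ vars σ x) xs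
  go-vars []       _ = []
  go-vars (x ∷ xs) q = sameVar fr x (not-true (∧-conicalˡ _ _ q)) ∷ go-vars xs (∧-conicalʳ (not (writesVar c x)) _ q)
  go-arrs : ∀ as → all (λ a → not (writesArr c a)) as ≡ true → All (λ a → arrs τ a ≡ arrs σ a) as
  go-arrs []       _ = []
  go-arrs (a ∷ as) q = sameArr fr a (not-true (∧-conicalˡ _ _ q)) ∷ go-arrs as (∧-conicalʳ (not (writesArr c a)) _ q)

GUARD : List Test → Program → Program
GUARD []       c = c
GUARD (b ∷ bs) c = IF b THEN GUARD bs c ELSE skip

exec-GUARD : ∀ bs c σ (Q : Store → Set) → (All (λ b → Holds b σ) bs → Q (exec c σ)) →
             (¬ All (λ b → Holds b σ) bs → Q σ) → Q (exec (GUARD bs c) σ)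
exec-GUARD []       c σ Q then else = then []
exec-GUARD (b ∷ bs) c σ Q then else = exec-IF b (GUARD bs c) skip σ Q
  (λ h → exec-GUARD bs c σ Q (λ hs → then (h ∷ hs)) (λ ¬hs → else λ { (_ ∷ hs) → ¬hs hs }))
  (λ ¬h → else λ { (h ∷ _) → ¬h h })

sub≡ : ∀ {x y m n} → x ≡ + m → y ≡ + n → n ≤ m → x ℤ.- y ≡ + (m ∸ n)
sub≡ {m = m} {n} refl refl n≤m = trans (ℤ.m-n≡m⊖n m n) (ℤ.⊖-≥ n≤m)

if-yes : ∀ {X : Set} {m n} {x y : X} → m ≤ n → (if m ≤ᵇ n then x else y) ≡ x
if-yes {m = m} {n} m≤n with m ≤ᵇ n | ≤⇒≤ᵇ m≤n
... | true | _ = refl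

if-no : ∀ {X : Set} {m n} {x y : X} → ¬ (m ≤ n) → (if m ≤ᵇ n then x else y) ≡ y
if-no {m = m} {n} m≰n with m ≤ᵇ n | ≤ᵇ⇒≤ m n
... | true  | m≤n = ⊥-elim (m≰n (m≤n _))
... | false | _   = refl

-- The recursion step

vLayer vK vJob vp vpo vq vw vr vPh vF vα vε vt vBest vCls vα′ vε′ vt′ vV : ℕ
vLayer = 20
vK     = 21
vJob   = 22
vp     = 23
vpo    = 24
vq     = 25
vw     = 26
vr     = 27
vPh    = 30
vF     = 31
vα     = 32
vε     = 33
vt     = 34
vBest  = 40
vCls   = 41
vα′    = 42
vε′    = 43
vt′    = 44
vV     = 45

stateVars jobVars : List ℕ
stateVars = vPh ∷ vF ∷ vα ∷ vε ∷ vt ∷ []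
jobVars   = vp ∷ vpo ∷ vq ∷ vw ∷ vr ∷ []

SETTLE₁ SETTLE₂ : Program
SETTLE₁ = GUARD ((var vPh ≼ lit 0ℤ) ∷ (var vt ⊕ var vα ⊕ lit 1ℤ ≼ var vq) ∷ []) (vt ≔ var vt ⊕ var vα ⨾ vPh ≔ lit 1ℤ)
SETTLE₂ = GUARD ((lit 1ℤ ≼ var vPh) ∷ (var vPh ≼ lit 1ℤ) ∷ (var vF ⊕ lit 1ℤ ≼ var vq) ∷ []) (vPh ≔ lit (+ 2) ⨾ vt ≔ var vF)

takenA takenB passed bound : Rule → Expr
takenA ρ = if takesRoom ρ then var vp else lit 0ℤ
takenB ρ = if takesBlockRoom ρ then var vpo else lit 0ℤ
passed ρ = if ticks ρ then var vp else lit 0ℤ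
bound  ρ = if ticks ρ then var vq else var vt ⊕ passed ρ ⊕ lit 1ℤ

-- The phase is a digit to radix 3, so the layer is multiplied by its radix with two additions.
layerEntry : Expr → Expr → Expr → Expr
layerEntry α ε t = aV [ ENC (var vLayer ⊕ var vLayer ⊕ var vLayer ⊕ var vPh) (var vF) α ε t ]

-- `4 - r - r` is the code of the late class: 4 for `𝐃ˡ`, 2 for `𝐁ˡ`.
START : Program
START = vV ≔ layerEntry (var vα) (var vε) (var vt) ⨾ vBest ≔ var vw ⊕ var vV ⨾
        vCls ≔ lit (+ 4) ⊖ var vr ⊖ var vr ⨾ vα′ ≔ var vα ⨾ vε′ ≔ var vε ⨾ vt′ ≔ var vt

SELECT IMPROVE TRY : Rule → Program
SELECT ρ  = vBest ≔ var vV ⨾ vCls ≔ lit (+ code (ruleClass ρ)) ⨾ vα′ ≔ var vα ⊖ takenA ρ ⨾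
            vε′ ≔ var vε ⊖ takenB ρ ⨾ vt′ ≔ var vt ⊕ passed ρ
IMPROVE ρ = vV ≔ layerEntry (var vα ⊖ takenA ρ) (var vε ⊖ takenB ρ) (var vt ⊕ passed ρ) ⨾
            IF var vV ⊕ lit 1ℤ ≼ var vBest THEN SELECT ρ ELSE skip

guards : Rule → List Test
guards ρ = (lit (+ rulePhase ρ) ≼ var vPh) ∷ (var vPh ≼ lit (+ rulePhase ρ)) ∷ (var vr ≼ lit (+ ruleMaxR ρ)) ∷
           (takenA ρ ≼ var vα) ∷ (takenB ρ ≼ var vε) ∷ (var vt ⊕ passed ρ ⊕ lit 1ℤ ≼ bound ρ) ∷ []

TRY ρ = GUARD (guards ρ) (IMPROVE ρ)

TRIES : List Rule → Program
TRIES []       = skip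
TRIES (ρ ∷ ρs) = TRY ρ ⨾ TRIES ρs

STEP : Program
STEP = SETTLE₁ ⨾ SETTLE₂ ⨾ START ⨾ TRIES (A₀ ∷ A₁ ∷ A₂ ∷ B₁ ∷ B₂ ∷ D₂ ∷ [])

kStep : ℕ
kStep = maxCost STEP

StateAt : State → Store → Set
StateAt s σ = Num σ vPh (phase s) × Num σ vF (finish s) × Num σ vα (room s) × Num σ vε (blockRoom s) × Num σ vt (clock s)

StateAt-same : ∀ {s σ τ as} → Same stateVars as σ τ → StateAt s σ → StateAt s τ
StateAt-same (same (e₁ ∷ e₂ ∷ e₃ ∷ e₄ ∷ e₅ ∷ []) _) (h₁ , h₂ , h₃ , h₄ , h₅) =
  trans e₁ h₁ , trans e₂ h₂ , trans e₃ h₃ , trans e₄ h₄ , trans e₅ h₅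

module _ {q : ℕ} where

  settle₁-exec : ∀ s σ → Num σ vq q → StateAt s σ → StateAt (settle₁ q s) (exec SETTLE₁ σ)
  settle₁-exec s@(state ph f α ε t) σ q≡ at@(ph≡ , f≡ , α≡ , ε≡ , t≡) =
    exec-GUARD ((var vPh ≼ lit 0ℤ) ∷ (var vt ⊕ var vα ⊕ lit 1ℤ ≼ var vq) ∷ []) (vt ≔ var vt ⊕ var vα ⨾ vPh ≔ lit 1ℤ) σ (StateAt (settle₁ q s))
      (λ { (h₁ ∷ h₂ ∷ []) → subst (λ s′ → StateAt s′ τ) (sym (trans (if-yes (holds⇒≤ ph≡ refl h₁)) (if-yes (holds⇒≤ sum≡ q≡ h₂))))
             (refl , f≡ , α≡ , ε≡ , cong₂ ℤ._+_ t≡ α≡) })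
      (λ ¬h → subst (λ s′ → StateAt s′ σ) (sym (unchanged ¬h)) at)
    where
    τ = exec (vt ≔ var vt ⊕ var vα ⨾ vPh ≔ lit 1ℤ) σ
    sum≡ : vars σ vt ℤ.+ vars σ vα ℤ.+ 1ℤ ≡ + (t + α + 1)
    sum≡ = cong (ℤ._+ 1ℤ) (cong₂ ℤ._+_ t≡ α≡)
    unchanged : ¬ All (λ b → Holds b σ) ((var vPh ≼ lit 0ℤ) ∷ (var vt ⊕ var vα ⊕ lit 1ℤ ≼ var vq) ∷ []) → settle₁ q s ≡ s
    unchanged ¬h with ph ≤? 0
    ... | no ph≰  = if-no ph≰
    ... | yes ph≤ = trans (if-yes ph≤) (if-no λ le → ¬h (≤⇒holds ph≡ refl ph≤ ∷ ≤⇒holds sum≡ q≡ le ∷ []))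

  settle₂-exec : ∀ s σ → Num σ vq q → StateAt s σ → StateAt (settle₂ q s) (exec SETTLE₂ σ)
  settle₂-exec s@(state ph f α ε t) σ q≡ at@(ph≡ , f≡ , α≡ , ε≡ , t≡) =
    exec-GUARD ((lit 1ℤ ≼ var vPh) ∷ (var vPh ≼ lit 1ℤ) ∷ (var vF ⊕ lit 1ℤ ≼ var vq) ∷ []) (vPh ≔ lit (+ 2) ⨾ vt ≔ var vF) σ (StateAt (settle₂ q s))
      (λ { (h₁ ∷ h₂ ∷ h₃ ∷ []) → subst (λ s′ → StateAt s′ τ)
             (sym (trans (if-yes (holds⇒≤ refl ph≡ h₁)) (trans (if-yes (holds⇒≤ ph≡ refl h₂)) (if-yes (holds⇒≤ sum≡ q≡ h₃)))))
             (refl , f≡ , α≡ , ε≡ , f≡) })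
      (λ ¬h → subst (λ s′ → StateAt s′ σ) (sym (unchanged ¬h)) at)
    where
    τ = exec (vPh ≔ lit (+ 2) ⨾ vt ≔ var vF) σ
    sum≡ : vars σ vF ℤ.+ 1ℤ ≡ + (f + 1)
    sum≡ = cong (ℤ._+ 1ℤ) f≡
    unchanged : ¬ All (λ b → Holds b σ) ((lit 1ℤ ≼ var vPh) ∷ (var vPh ≼ lit 1ℤ) ∷ (var vF ⊕ lit 1ℤ ≼ var vq) ∷ []) → settle₂ q s ≡ s
    unchanged ¬h with 1 ≤? ph | ph ≤? 1
    ... | no ≰ph  | _       = if-no ≰ph
    ... | yes ≤ph | no ph≰  = trans (if-yes ≤ph) (if-no ph≰)
    ... | yes ≤ph | yes ph≤ = trans (if-yes ≤ph) (trans (if-yes ph≤)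
            (if-no λ le → ¬h (≤⇒holds refl ph≡ ≤ph ∷ ≤⇒holds ph≡ refl ph≤ ∷ ≤⇒holds sum≡ q≡ le ∷ [])))

  module _ {B : ℕ} (q≤B : q ≤ B) where

    settle₁-range : ∀ {s} → InRange B s → InRange B (settle₁ q s)
    settle₁-range {state ph f α ε t} r@(inRange r₁ r₂ r₃ r₄ r₅) with ph ≤ᵇ 0 | t + α + 1 ≤ᵇ q | ≤ᵇ⇒≤ (t + α + 1) q
    ... | false | _     | _  = r
    ... | true  | false | _  = r
    -- The new clock `t + α` is below `q` by the test, hence below `B`.
    ... | true  | true  | le = inRange (s≤s (s≤s z≤n)) r₂ r₃ r₄ (≤-trans (subst (_≤ q) (+-comm _ 1) (le _)) q≤B)

    settle₂-range : ∀ {s} → InRange B s → InRange B (settle₂ q s)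
    settle₂-range {state ph f α ε t} r@(inRange r₁ r₂ r₃ r₄ r₅) with 1 ≤ᵇ ph | ph ≤ᵇ 1 | f + 1 ≤ᵇ q
    ... | false | _     | _     = r
    ... | true  | false | _     = r
    ... | true  | true  | false = r
    ... | true  | true  | true  = inRange ≤-refl r₂ r₃ r₄ r₂

opaque
  unfolding settle rules

  settle≡ : ∀ q s → settle q s ≡ settle₂ q (settle₁ q s)
  settle≡ q s = refl

  settle-range : ∀ {q B s} → q ≤ B → InRange B s → InRange B (settle q s)
  settle-range q≤B r = settle₂-range q≤B (settle₁-range q≤B r)

  rules≡ : rules ≡ A₀ ∷ A₁ ∷ A₂ ∷ B₁ ∷ B₂ ∷ D₂ ∷ []
  rules≡ = refl

module Step (n B : ℕ) (1≤B : 1 ≤ B) (p q w : ℕ → ℕ) (isR : ℕ → Bool) (q≤B : ∀ k → q k ≤ B) where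

  open Address n B 1≤B
  open Programme n p q w isR

  JobAt : ℕ → Store → Set
  JobAt k σ = Num σ vp (p k) × Num σ vpo (po k) × Num σ vq (q k) × Num σ vw (w k) × Num σ vr (r k)

  -- `W` is the function tabulated in layer `m`. The recursion step is verified once and then used
  -- both to fill the table and to walk through it.
  record Env (m k : ℕ) (W : State → ℕ) (σ : Store) : Set where
    field
      m≤n    : m ≤ n
      layer≡ : Num σ vLayer m
      job≡   : JobAt k σ
      mul    : MulTable tableSize B σ
      values : ∀ s → InRange B s → arrs σ aV (+ address m s) ≡ + W s

  envVars envArrs : List ℕ
  envVars = vLayer ∷ jobVars
  envArrs = aM ∷ aV ∷ []

  Env-same : ∀ {m k W σ τ} → Same envVars envArrs σ τ → Env m k W σ → Env m k W τ
  Env-same {m} (same (e ∷ e₁ ∷ e₂ ∷ e₃ ∷ e₄ ∷ e₅ ∷ []) (a₁ ∷ a₂ ∷ [])) env = record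
    { m≤n = m≤n
    ; layer≡ = trans e layer≡
    ; job≡ = let (h₁ , h₂ , h₃ , h₄ , h₅) = job≡ in trans e₁ h₁ , trans e₂ h₂ , trans e₃ h₃ , trans e₄ h₄ , trans e₅ h₅
    ; mul = λ i i< → trans (cong-app a₁ (+ i)) (mul i i<)
    ; values = λ s r → trans (cong-app a₂ (+ address m s)) (values s r) }
    where open Env env

  CandAt : Candidate → Store → Set
  CandAt c σ = Num σ vBest (value c) × Num σ vCls (code (class c)) ×
               Num σ vα′ (room (next c)) × Num σ vε′ (blockRoom (next c)) × Num σ vt′ (clock (next c))

  eval-when : ∀ β x {v σ} → Num σ x v → eval (if β then var x else lit 0ℤ) σ ≡ + (v when β)
  eval-when true  x h = h
  eval-when false x h = refl

  -- Rules change neither phase nor finish, which is why a candidate's machine representation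
  -- consists of the other three components.
  Sibling : State → Candidate → Set
  Sibling s c = phase (next c) ≡ phase s × finish (next c) ≡ finish s

  module _ {m k : ℕ} {W : State → ℕ} {s : State} (range : InRange B s) where

    eval-entry : ∀ α ε t {σ} s′ → Env m k W σ → InRange B s′ → phase s′ ≡ phase s → finish s′ ≡ finish s → StateAt s σ →
                 eval α σ ≡ + room s′ → eval ε σ ≡ + blockRoom s′ → eval t σ ≡ + clock s′ →
                 eval (layerEntry α ε t) σ ≡ + W s′
    eval-entry α ε t {σ} s′ env r′ ph≡ f≡ at α≡ ε≡ t≡ = trans
      (cong (arrs σ aV) (eval-ENC {σ} mul {eu = var vLayer ⊕ var vLayer ⊕ var vLayer ⊕ var vPh} {var vF} {α} {ε} {t} s′ m≤n r′
        (trans (cong₂ (λ x y → x ℤ.+ x ℤ.+ x ℤ.+ y) layer≡ (trans (proj₁ at) (cong +_ (sym ph≡))))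
               (cong +_ (cong (_+ phase s′) triple)))
        (trans (proj₁ (proj₂ at)) (cong +_ (sym f≡))) α≡ ε≡ t≡))
      (values s′ r′)
      where
      open Env env
      triple : m + m + m ≡ m * 3
      triple = solve 1 (λ m → m :+ m :+ m := m :* con 3) refl m
        where open +-*-Solver

    start-exec : ∀ σ → Env m k W σ → StateAt s σ → CandAt (candidate (w k + W s) (lateClass (isR k)) s) (exec START σ)
    start-exec σ env at@(_ , _ , α≡ , ε≡ , t≡) =
      cong₂ ℤ._+_ w≡ (eval-entry (var vα) (var vε) (var vt) s env range refl refl at α≡ ε≡ t≡) , class≡ , α≡ , ε≡ , t≡
      where
      open Env env
      w≡ = proj₁ (proj₂ (proj₂ (proj₂ job≡)))
      r≡ = proj₂ (proj₂ (proj₂ (proj₂ job≡)))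
      class≡ : + 4 ℤ.- vars σ vr ℤ.- vars σ vr ≡ + code (lateClass (isR k))
      class≡ with isR k | r≡
      ... | true  | r≡ = cong (λ x → + 4 ℤ.- x ℤ.- x) r≡
      ... | false | r≡ = cong (λ x → + 4 ℤ.- x ℤ.- x) r≡

    -- If the clock moves, the test keeps it below the cut due date, which is at most `B`.
    fire-range : ∀ ρ → Applies ρ k s → InRange B (fire ρ k s)
    fire-range ρ (_ , _ , _ , _ , _ , le) = inRange phase<3 finish<B
      (≤-<-trans (m∸n≤m (room s) (needA ρ k)) room<B) (≤-<-trans (m∸n≤m (blockRoom s) (needB ρ k)) blockRoom<B) (clock< le)
      where
      open InRange range
      clock< : clock s + tick ρ k + 1 ≤ limit ρ k s → clock s + tick ρ k < B
      clock< le with ticks ρ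
      ... | true  = ≤-trans (subst (_≤ q k) (+-comm _ 1) le) (q≤B k)
      ... | false = subst (_< B) (sym (+-identityʳ (clock s))) clock<B

    choose-yes : ∀ {X : Set} (x? : Dec X) {c c′} → X → choose x? c c′ ≡ c
    choose-yes (yes _) _ = refl
    choose-yes (no ¬x) x = contradiction x ¬x

    choose-no : ∀ {X : Set} (x? : Dec X) {c c′} → ¬ X → choose x? c c′ ≡ c′
    choose-no (yes x) ¬x = contradiction x ¬x
    choose-no (no _)  _  = refl

    try-exec : ∀ ρ {c} σ → Env m k W σ → StateAt s σ → CandAt c σ → CandAt (try k W s c ρ) (exec (TRY ρ) σ)
    try-exec ρ {c} σ env at@(ph≡ , f≡ , α≡ , ε≡ , t≡) cand@(best≡ , _ , _ , _ , _) =
      exec-GUARD (guards ρ) (IMPROVE ρ) σ (CandAt (try k W s c ρ))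
        (λ { (h₁ ∷ h₂ ∷ h₃ ∷ h₄ ∷ h₅ ∷ h₆ ∷ []) → improved (holds⇒≤ refl ph≡ h₁ , holds⇒≤ ph≡ refl h₂ , holds⇒≤ r≡ refl h₃ ,
               holds⇒≤ takenA≡ α≡ h₄ , holds⇒≤ takenB≡ ε≡ h₅ , holds⇒≤ after≡ bound≡ h₆) })
        (λ ¬h → subst (λ c → CandAt c σ) (sym (choose-no (applies? ρ k s) λ (h₁ , h₂ , h₃ , h₄ , h₅ , h₆) →
            ¬h (≤⇒holds refl ph≡ h₁ ∷ ≤⇒holds ph≡ refl h₂ ∷ ≤⇒holds r≡ refl h₃ ∷
                ≤⇒holds takenA≡ α≡ h₄ ∷ ≤⇒holds takenB≡ ε≡ h₅ ∷ ≤⇒holds after≡ bound≡ h₆ ∷ []))) cand)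
      where
      open Env env
      p≡ = proj₁ job≡
      po≡ = proj₁ (proj₂ job≡)
      q≡ = proj₁ (proj₂ (proj₂ job≡))
      r≡ = proj₂ (proj₂ (proj₂ (proj₂ job≡)))
      takenA≡ : eval (takenA ρ) σ ≡ + needA ρ k
      takenA≡ = eval-when (takesRoom ρ) vp p≡
      takenB≡ : eval (takenB ρ) σ ≡ + needB ρ k
      takenB≡ = eval-when (takesBlockRoom ρ) vpo po≡
      clock≡ : eval (var vt ⊕ passed ρ) σ ≡ + (clock s + tick ρ k)
      clock≡ = cong₂ ℤ._+_ t≡ (eval-when (ticks ρ) vp p≡)
      after≡ : eval (var vt ⊕ passed ρ ⊕ lit 1ℤ) σ ≡ + (clock s + tick ρ k + 1)
      after≡ = cong (ℤ._+ 1ℤ) clock≡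
      bound≡ : eval (bound ρ) σ ≡ + limit ρ k s
      bound≡ = pick (ticks ρ) {tick ρ k} {passed ρ} after≡
        where
        pick : ∀ β {d e} → eval (var vt ⊕ e ⊕ lit 1ℤ) σ ≡ + (clock s + d + 1) →
               eval (if β then var vq else var vt ⊕ e ⊕ lit 1ℤ) σ ≡ + (if β then q k else clock s + d + 1)
        pick true  _ = q≡
        pick false h = h
      improved : Applies ρ k s → CandAt (try k W s c ρ) (exec (IMPROVE ρ) σ)
      improved ap@(_ , _ , _ , a≤ , b≤ , _) = subst (λ c → CandAt c (exec (IMPROVE ρ) σ)) (sym (choose-yes (applies? ρ k s) ap))
        (exec-IF (var vV ⊕ lit 1ℤ ≼ var vBest) (SELECT ρ) skip τ (CandAt c′)
          (λ h → subst (λ c → CandAt c (exec (SELECT ρ) τ)) (sym (if-yes (holds⇒≤ v+1≡ best≡ h)))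
                   (v≡ , refl , sub≡ α≡ (eval-when (takesRoom ρ) vp {σ = τ₂} p≡) a≤ ,
                    sub≡ ε≡ (eval-when (takesBlockRoom ρ) vpo {σ = τ₃} po≡) b≤ , cong₂ ℤ._+_ t≡ (eval-when (ticks ρ) vp {σ = τ₄} p≡)))
          (λ ¬h → subst (λ c → CandAt c τ) (sym (if-no λ le → ¬h (≤⇒holds v+1≡ best≡ le))) cand))
        where
        c′ = improve c (W (fire ρ k s)) (ruleClass ρ) (fire ρ k s)
        entry = layerEntry (var vα ⊖ takenA ρ) (var vε ⊖ takenB ρ) (var vt ⊕ passed ρ)
        τ  = exec (vV ≔ entry) σ
        τ₂ = exec (vBest ≔ var vV ⨾ vCls ≔ lit (+ code (ruleClass ρ))) τ
        τ₃ = exec (vα′ ≔ var vα ⊖ takenA ρ) τ₂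
        τ₄ = exec (vε′ ≔ var vε ⊖ takenB ρ) τ₃
        fα≡ : eval (var vα ⊖ takenA ρ) σ ≡ + (room s ∸ needA ρ k)
        fα≡ = sub≡ α≡ takenA≡ a≤
        fε≡ : eval (var vε ⊖ takenB ρ) σ ≡ + (blockRoom s ∸ needB ρ k)
        fε≡ = sub≡ ε≡ takenB≡ b≤
        v≡ : eval entry σ ≡ + W (fire ρ k s)
        v≡ = eval-entry (var vα ⊖ takenA ρ) (var vε ⊖ takenB ρ) (var vt ⊕ passed ρ) (fire ρ k s) env (fire-range ρ ap) refl refl at fα≡ fε≡ clock≡
        v+1≡ : eval entry σ ℤ.+ 1ℤ ≡ + (W (fire ρ k s) + 1)
        v+1≡ = cong (ℤ._+ 1ℤ) v≡

    tries-exec : ∀ ρs {c} σ → Env m k W σ → StateAt s σ → CandAt c σ → CandAt (foldl (try k W s) c ρs) (exec (TRIES ρs) σ)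
    tries-exec []       σ env at cand = cand
    tries-exec (ρ ∷ ρs) σ env at cand = tries-exec ρs (exec (TRY ρ) σ)
      (Env-same (frame⇒same fr refl) env) (StateAt-same {as = []} (frame⇒same fr refl) at) (try-exec ρ σ env at cand)
      where
      fr : Frame (TRY ρ) σ (exec (TRY ρ) σ)
      fr = exec-frame (TRY ρ) σ refl

  foldl-sibling : ∀ k W s ρs c → Sibling s c → Sibling s (foldl (try k W s) c ρs)
  foldl-sibling k W s []       c h = h
  foldl-sibling k W s (ρ ∷ ρs) c h = foldl-sibling k W s ρs _ (try-sibling (applies? ρ k s))
    where
    improve-sibling : ∀ v → Sibling s (improve c v (ruleClass ρ) (fire ρ k s))
    improve-sibling v with v + 1 ≤ᵇ value c
    ... | true  = refl , refl
    ... | false = h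
    try-sibling : ∀ {X : Set} (x? : Dec X) → Sibling s (choose x? (improve c (W (fire ρ k s)) (ruleClass ρ) (fire ρ k s)) c)
    try-sibling (yes _) = improve-sibling (W (fire ρ k s))
    try-sibling (no _)  = h

  best-sibling : ∀ {k W s} → Sibling s (best k W s)
  best-sibling {k} {W} {s} = foldl-sibling k W s rules _ (refl , refl)

  step-run : ∀ {m k W s σ} → InRange B s → Env m k W σ → StateAt s σ →
             Run STEP σ kStep (λ τ → CandAt (best k W (settle (q k) s)) τ × StateAt (settle (q k) s) τ)
  step-run {m} {k} {W} {s} {σ} range env at =
    run-then {Q = λ τ → Env m k W τ × StateAt (settle₁ (q k) s) τ} (run-exec SETTLE₁ refl
      (Env-same (frame⇒same (exec-frame SETTLE₁ σ refl) refl) env , settle₁-exec s σ (q≡ env) at)) λ σ₁ (env₁ , at₁) →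
    run-then {Q = λ τ → Env m k W τ × StateAt s′ τ} (run-exec SETTLE₂ refl
      (Env-same (frame⇒same (exec-frame SETTLE₂ σ₁ refl) refl) env₁ ,
       subst (λ s → StateAt s (exec SETTLE₂ σ₁)) (sym (settle≡ (q k) s)) (settle₂-exec _ σ₁ (q≡ env₁) at₁))) λ σ₂ (env₂ , at₂) →
    run-then {Q = λ τ → Env m k W τ × StateAt s′ τ × CandAt c₀ τ} (run-exec START refl
      (Env-same (frame⇒same (exec-frame START σ₂ refl) refl) env₂ ,
       StateAt-same {as = []} (frame⇒same (exec-frame START σ₂ refl) refl) at₂ , start-exec range′ σ₂ env₂ at₂)) λ σ₃ (env₃ , at₃ , cand) →
    run-exec (TRIES ρs) refl
      (subst (λ ρs′ → CandAt (foldl (try k W s′) c₀ ρs′) (exec (TRIES ρs) σ₃)) (sym rules≡) (tries-exec range′ ρs σ₃ env₃ at₃ cand) ,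
       StateAt-same {as = []} (frame⇒same (exec-frame (TRIES ρs) σ₃ refl) refl) at₃)
    where
    ρs = A₀ ∷ A₁ ∷ A₂ ∷ B₁ ∷ B₂ ∷ D₂ ∷ []
    s′ = settle (q k) s
    c₀ = candidate (w k + W s′) (lateClass (isR k)) s′
    range′ : InRange B s′
    range′ = settle-range (q≤B k) range
    q≡ : ∀ {σ} → Env m k W σ → Num σ vq (q k)
    q≡ env = proj₁ (proj₂ (proj₂ (Env.job≡ env)))

-- The cut due dates are in array 5, the processing times of the jobs that are not
-- r-jobs in array 6, and the jobs in order of due dates in array aOrd.
xPh xF xα xε xt aOrd : ℕ
xPh  = 50
xF   = 51
xα   = 52
xε   = 53
xt   = 54
aOrd = 8

cellLayer cellAddress : Expr
cellLayer   = (var vLayer ⊕ lit 1ℤ) ⊕ (var vLayer ⊕ lit 1ℤ) ⊕ (var vLayer ⊕ lit 1ℤ) ⊕ var xPh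
cellAddress = ENC cellLayer (var xF) (var xα) (var xε) (var xt)

GETJOB COPY STORE CELL LOOPt LOOPε LOOPα LOOPf LOOPph LAYER LAYERS : Program
GETJOB = vJob ≔ aOrd [ var vK ] ⨾ vp ≔ 0 [ var vJob ] ⨾ vpo ≔ 6 [ var vJob ] ⨾ vq ≔ 5 [ var vJob ] ⨾
         vw ≔ 2 [ var vJob ] ⨾ vr ≔ 3 [ var vJob ]
COPY   = vPh ≔ var xPh ⨾ vF ≔ var xF ⨾ vα ≔ var xα ⨾ vε ≔ var xε ⨾ vt ≔ var xt
STORE  = aV [ cellAddress ]≔ var vBest
CELL   = COPY ⨾ STEP ⨾ STORE
LOOPt  = FOR xt < vB DO CELL
LOOPε  = FOR xε < vB DO LOOPt
LOOPα  = FOR xα < vB DO LOOPε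
LOOPf  = FOR xF < vB DO LOOPα
LOOPph = FOR xPh < vThree DO LOOPf
LAYER  = (vK ≔ var 0 ⊖ var vLayer ⊖ lit 1ℤ ⨾ GETJOB) ⨾ LOOPph
LAYERS = FOR vLayer < 0 DO LAYER

kCell kLayer : ℕ
kCell  = maxCost COPY + (kStep + maxCost STORE)
kLayer = maxCost (vK ≔ var 0 ⊖ var vLayer ⊖ lit 1ℤ ⨾ GETJOB) + (kCell + 16 + 16 + 16 + 16 + 16) * 3

-- Filling the table

module Fill (n B : ℕ) (1≤n : 1 ≤ n) (1≤B : 1 ≤ B) (p q w : ℕ → ℕ) (isR : ℕ → Bool) (q≤B : ∀ k → q k ≤ B) where

  open Address n B 1≤B
  open Programme n p q w isR
  open Step n B 1≤B p q w isR q≤B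

  -- One threshold for addresses is the invariant of all six loops. While a cell is computed, the
  -- whole preceding layer lies below the threshold.
  Filled : ℕ → Store → Set
  Filled h σ = ∀ m s → m ≤ n → InRange B s → address m s < h → arrs σ aV (+ address m s) ≡ + V m s

  address< : ∀ {m X s} → m < X → InRange B s → address m s < X * (3 * (B ^ 4))
  address< {m} {X} {s} m<X (inRange r₁ r₂ r₃ r₄ r₅) = subst (address m s <_)
    (solve 2 (λ x b → x :* con 3 :* b :* b :* b :* b := x :* (con 3 :* (b :* (b :* (b :* (b :* con 1)))))) refl X B)
    (digits-< (digits-< (digits-< (digits-< (digits-< m<X r₁) r₂) r₃) r₄) r₅)
    where open +-*-Solver

  address<⁻ : ∀ m X s → address m s < X * (3 * (B ^ 4)) → m < X
  address<⁻ m X s lt = digit-< 3 (digit-< B (digit-< B (digit-< B (digit-< B (subst (address m s <_)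
    (solve 2 (λ x b → x :* (con 3 :* (b :* (b :* (b :* (b :* con 1))))) := x :* con 3 :* b :* b :* b :* b) refl X B) lt)))))
    where open +-*-Solver

  address-mono : ∀ {m m′ s s′} → m < m′ → InRange B s → address m s < address m′ s′
  address-mono {m} {m′} {s} {s′} m<m′ (inRange r₁ r₂ r₃ r₄ r₅) = up r₅ (up r₄ (up r₃ (up r₂ (up r₁ m<m′))))
    where
    up : ∀ {y X d d′ B} → d < B → y < X → y * B + d < X * B + d′
    up d<B y<X = <-≤-trans (digits-< y<X d<B) (m≤m+n _ _)

  record Ctx (m : ℕ) (σ : Store) : Set where
    field
      layer≡ : Num σ vLayer m
      job≡   : JobAt (n ∸ suc m) σ
      radix≡ : Num σ vB B
      three≡ : Num σ vThree 3
      mul    : MulTable tableSize B σ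

  ctxVars : List ℕ
  ctxVars = vLayer ∷ vB ∷ vThree ∷ jobVars

  Ctx-same : ∀ {m σ τ} → Same ctxVars (aM ∷ []) σ τ → Ctx m σ → Ctx m τ
  Ctx-same (same (e ∷ b ∷ c ∷ e₁ ∷ e₂ ∷ e₃ ∷ e₄ ∷ e₅ ∷ []) (a₁ ∷ [])) ctx = record
    { layer≡ = trans e layer≡ ; radix≡ = trans b radix≡ ; three≡ = trans c three≡
    ; job≡ = let (h₁ , h₂ , h₃ , h₄ , h₅) = job≡ in trans e₁ h₁ , trans e₂ h₂ , trans e₃ h₃ , trans e₄ h₄ , trans e₅ h₅
    ; mul = λ i i< → trans (cong-app a₁ (+ i)) (mul i i<) }
    where open Ctx ctx

  DigitsAt : State → Store → Set
  DigitsAt s σ = Num σ xPh (phase s) × Num σ xF (finish s) × Num σ xα (room s) × Num σ xε (blockRoom s) × Num σ xt (clock s)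

  digitVars : List ℕ
  digitVars = xPh ∷ xF ∷ xα ∷ xε ∷ xt ∷ []

  DigitsAt-same : ∀ {s σ τ as} → Same digitVars as σ τ → DigitsAt s σ → DigitsAt s τ
  DigitsAt-same (same (e₁ ∷ e₂ ∷ e₃ ∷ e₄ ∷ e₅ ∷ []) _) (h₁ , h₂ , h₃ , h₄ , h₅) =
    trans e₁ h₁ , trans e₂ h₂ , trans e₃ h₃ , trans e₄ h₄ , trans e₅ h₅

  eval-cell : ∀ {m s σ} → m < n → InRange B s → Ctx m σ → DigitsAt s σ → eval cellAddress σ ≡ + address (suc m) s
  eval-cell {m} {s} {σ} m<n range ctx (ph≡ , f≡ , α≡ , ε≡ , t≡) =
    eval-ENC {σ} (Ctx.mul ctx) {cellLayer} {var xF} {var xα} {var xε} {var xt} s m<n range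
      (trans (cong₂ (λ x y → (x ℤ.+ 1ℤ) ℤ.+ (x ℤ.+ 1ℤ) ℤ.+ (x ℤ.+ 1ℤ) ℤ.+ y) (Ctx.layer≡ ctx) ph≡)
             (cong +_ (cong (_+ phase s) triple)))
      f≡ α≡ ε≡ t≡
    where
    triple : m + 1 + (m + 1) + (m + 1) ≡ suc m * 3
    triple = solve 1 (λ m → m :+ con 1 :+ (m :+ con 1) :+ (m :+ con 1) := (con 1 :+ m) :* con 3) refl m
      where open +-*-Solver

  -- By injectivity of addresses, raising the threshold by one adds no state other than `s`.
  store-exec : ∀ {m s σ} → m < n → InRange B s → Ctx m σ → DigitsAt s σ → Num σ vBest (V (suc m) s) →
               Filled (address (suc m) s) σ → Filled (suc (address (suc m) s)) (exec STORE σ)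
  store-exec {m} {s} {σ} m<n range ctx digits best≡ filled m′ s′ m′≤n range′ h<
    with address m′ s′ ≟ address (suc m) s
  ... | no neq = trans (setArr-other aV σ λ eq → neq (ℤ.+-injective (trans (sym eq) (eval-cell m<n range ctx digits))))
                       (filled m′ s′ m′≤n range′ (≤∧≢⇒< (s≤s⁻¹ h<) neq))
  ... | yes eq with address-injective {m′} {suc m} {s′} {s} range′ range eq
  ...   | refl , refl = trans (cong (arrs (exec STORE σ) aV) (sym (eval-cell m<n range ctx digits)))
                              (trans (setArr-same aV (eval cellAddress σ) σ) best≡)

  Filled-arr : ∀ h σ τ → arrs τ aV ≡ arrs σ aV → Filled h σ → Filled h τ
  Filled-arr h σ τ e filled m s m≤n r h< = trans (cong-app e (+ address m s)) (filled m s m≤n r h<)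

  cell : ∀ {m s σ} → m < n → InRange B s → Ctx m σ → DigitsAt s σ → Filled (address (suc m) s) σ →
         Run CELL σ kCell (Filled (suc (address (suc m) s)))
  cell {m} {s} {σ} m<n range ctx digits filled =
    run-then {Q = λ τ → Frame COPY σ τ × StateAt s τ} (run-exec COPY refl (exec-frame COPY σ refl , digits)) λ σ₁ (fr₁ , at₁) →
    run-then (run-frame (step-run {m} {n ∸ suc m} {V m} range (env σ₁ fr₁) at₁)) λ σ₂ ((cand , _) , fr₂) →
    run-exec STORE refl (store-exec m<n range
      (Ctx-same (frame⇒same fr₂ refl) (Ctx-same (frame⇒same fr₁ refl) ctx))
      (DigitsAt-same {as = []} (frame⇒same fr₂ refl) (DigitsAt-same {as = []} (frame⇒same fr₁ refl) digits))
      (proj₁ cand)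
      (Filled-arr (address (suc m) s) σ σ₂ (trans (sameArr fr₂ aV refl) (sameArr fr₁ aV refl)) filled))
    where
    env : ∀ τ → Frame COPY σ τ → Env m (n ∸ suc m) (V m) τ
    env τ fr = record
      { m≤n = <⇒≤ m<n ; layer≡ = layer≡ ; job≡ = job≡ ; mul = mul
      ; values = λ s′ r → trans (cong-app (sameArr fr aV refl) (+ address m s′))
                   (filled m s′ (<⇒≤ m<n) r (address-mono (n<1+n m) r)) }
      where open Ctx (Ctx-same (frame⇒same fr refl) ctx)

  -- One digit of the address: `X` is the number formed by the leading digits, `N` the radix of this
  -- digit and `Z` the number of addresses for the digits after it.
  level : ∀ {x y c N X Z T K Y σ} → does (x ≟ y) ≡ false → writesVar c x ≡ false → writesVar c y ≡ false →
          T ≤ K * Y → 1 ≤ Y → 1 ≤ N → Num σ y N →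
          (∀ i τ → i < N → Frame (FOR x < y DO c) σ τ → Num τ x i → Filled ((X * N + i) * Z) τ →
            Run c τ T (Filled (suc (X * N + i) * Z))) →
          Filled (X * (N * Z)) σ → Run (FOR x < y DO c) σ ((K + 16) * (N * Y)) (Filled (suc X * (N * Z)))
  level {x} {y} {c} {N} {X} {Z} {T} {K} {Y} {σ} x≢y c-x c-y T≤ 1≤Y 1≤N y≡ body filled =
    run-mono ≤-refl (λ {τ} → subst (λ h → Filled h τ) last)
      (run-for* {c} {x} {y} {N} {T} (λ i → Filled ((X * N + i) * Z)) x≢y c-x c-y
        (λ i τ i<N fr x≡ inv → run-mono ≤-refl (λ {υ} → subst (λ h → Filled h υ) (cong (_* Z) (sym (+-suc (X * N) i))))
          (body i τ i<N fr x≡ inv))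
        y≡ {K = K} T≤ 1≤Y 1≤N (subst (λ h → Filled h σ) first filled))
    where
    first : X * (N * Z) ≡ (X * N + 0) * Z
    first = trans (sym (*-assoc X N Z)) (cong (_* Z) (sym (+-identityʳ (X * N))))
    last : (X * N + N) * Z ≡ suc X * (N * Z)
    last = trans (cong (_* Z) (+-comm (X * N) N)) (*-assoc (suc X) N Z)

  private
    1≤ : ∀ {x} → 1 ≤ x → 1 ≤ B * x
    1≤ = *-mono-≤ 1≤B

  module _ {m : ℕ} (m<n : m < n) where

    private
      u : ℕ → ℕ
      u ph = suc m * 3 + ph

    loop-t : ∀ {ph f α ε σ} → ph < 3 → f < B → α < B → ε < B → Ctx m σ →
             Num σ xPh ph → Num σ xF f → Num σ xα α → Num σ xε ε → let X = ((u ph * B + f) * B + α) * B + ε in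
             Filled (X * (B * 1)) σ → Run LOOPt σ ((kCell + 16) * (B * 1)) (Filled (suc X * (B * 1)))
    loop-t {ph} {f} {α} {ε} r₁ r₂ r₃ r₄ ctx ph≡ f≡ α≡ ε≡ =
      level {N = B} {((u ph * B + f) * B + α) * B + ε} {Z = 1} {K = kCell} {Y = 1}
        refl refl refl (≤-reflexive (sym (*-identityʳ kCell))) ≤-refl 1≤B (Ctx.radix≡ ctx)
        λ t τ t<B fr t≡ filled → run-mono ≤-refl (λ {υ} → subst (λ h → Filled h υ) (sym (*-identityʳ _)))
          (cell {s = state ph f α ε t} m<n (inRange r₁ r₂ r₃ r₄ t<B) (Ctx-same (frame⇒same fr refl) ctx)
            (trans (sameVar fr xPh refl) ph≡ , trans (sameVar fr xF refl) f≡ ,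
             trans (sameVar fr xα refl) α≡ , trans (sameVar fr xε refl) ε≡ , t≡)
            (subst (λ h → Filled h τ) (*-identityʳ _) filled))

    loop-ε : ∀ {ph f α σ} → ph < 3 → f < B → α < B → Ctx m σ →
             Num σ xPh ph → Num σ xF f → Num σ xα α → let X = (u ph * B + f) * B + α in
             Filled (X * (B * (B * 1))) σ → Run LOOPε σ ((kCell + 16 + 16) * (B * (B * 1))) (Filled (suc X * (B * (B * 1))))
    loop-ε {ph} {f} {α} r₁ r₂ r₃ ctx ph≡ f≡ α≡ =
      level {N = B} {(u ph * B + f) * B + α} {Z = B * 1} {K = kCell + 16} {Y = B * 1} refl refl refl ≤-refl (1≤ ≤-refl) 1≤B (Ctx.radix≡ ctx)
        λ ε τ ε<B fr ε≡ → loop-t r₁ r₂ r₃ ε<B (Ctx-same (frame⇒same fr refl) ctx)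
          (trans (sameVar fr xPh refl) ph≡) (trans (sameVar fr xF refl) f≡)
          (trans (sameVar fr xα refl) α≡) ε≡

    loop-α : ∀ {ph f σ} → ph < 3 → f < B → Ctx m σ → Num σ xPh ph → Num σ xF f → let X = u ph * B + f in
             Filled (X * (B ^ 3)) σ →
             Run LOOPα σ ((kCell + 16 + 16 + 16) * (B ^ 3)) (Filled (suc X * (B ^ 3)))
    loop-α {ph} {f} r₁ r₂ ctx ph≡ f≡ =
      level {N = B} {u ph * B + f} {Z = B * (B * 1)} {K = kCell + 16 + 16} {Y = B * (B * 1)}
        refl refl refl ≤-refl (1≤ (1≤ ≤-refl)) 1≤B (Ctx.radix≡ ctx)
        λ α τ α<B fr α≡ → loop-ε r₁ r₂ α<B (Ctx-same (frame⇒same fr refl) ctx)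
          (trans (sameVar fr xPh refl) ph≡) (trans (sameVar fr xF refl) f≡) α≡

    loop-f : ∀ {ph σ} → ph < 3 → Ctx m σ → Num σ xPh ph →
             Filled (u ph * (B ^ 4)) σ →
             Run LOOPf σ ((kCell + 16 + 16 + 16 + 16) * (B ^ 4)) (Filled (suc (u ph) * (B ^ 4)))
    loop-f {ph} r₁ ctx ph≡ =
      level {N = B} {u ph} {Z = B ^ 3} {K = kCell + 16 + 16 + 16} {Y = B ^ 3} refl refl refl ≤-refl (1≤ (1≤ (1≤ ≤-refl))) 1≤B (Ctx.radix≡ ctx)
        λ f τ f<B fr f≡ → loop-α r₁ f<B (Ctx-same (frame⇒same fr refl) ctx) (trans (sameVar fr xPh refl) ph≡) f≡

    loop-ph : ∀ {σ} → Ctx m σ → Filled (suc m * (3 * (B ^ 4))) σ →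
              Run LOOPph σ ((kCell + 16 + 16 + 16 + 16 + 16) * (3 * (B ^ 4))) (Filled (suc (suc m) * (3 * (B ^ 4))))
    loop-ph ctx =
      level {N = 3} {suc m} {Z = B ^ 4} {K = kCell + 16 + 16 + 16 + 16} {Y = B ^ 4}
        refl refl refl ≤-refl (1≤ (1≤ (1≤ (1≤ ≤-refl)))) (s≤s z≤n) (Ctx.three≡ ctx)
        λ ph τ ph<3 fr ph≡ → loop-f ph<3 (Ctx-same (frame⇒same fr refl) ctx) ph≡

  JobArrays : Store → Set
  JobArrays σ = ∀ k → k < n → ∃[ j ] arrs σ aOrd (+ k) ≡ j × arrs σ 0 j ≡ + p k × arrs σ 6 j ≡ + po k ×
                arrs σ 5 j ≡ + q k × arrs σ 2 j ≡ + w k × arrs σ 3 j ≡ + r k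

  JobArrays-same : ∀ {xs σ τ} → Same xs (aOrd ∷ 0 ∷ 6 ∷ 5 ∷ 2 ∷ 3 ∷ []) σ τ → JobArrays σ → JobArrays τ
  JobArrays-same {σ = σ} {τ} (same _ (e ∷ e₁ ∷ e₂ ∷ e₃ ∷ e₄ ∷ e₅ ∷ [])) jobs k k<n with jobs k k<n
  ... | j , h , h₁ , h₂ , h₃ , h₄ , h₅ = j , on e h , on e₁ h₁ , on e₂ h₂ , on e₃ h₃ , on e₄ h₄ , on e₅ h₅
    where
    on : ∀ {a i v} → arrs τ a ≡ arrs σ a → arrs σ a i ≡ v → arrs τ a i ≡ v
    on {i = i} e h = trans (cong-app e i) h

  getjob-exec : ∀ {k σ} → k < n → JobArrays σ → Num σ vK k → JobAt k (exec GETJOB σ)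
  getjob-exec {k} {σ} k<n jobs k≡ with jobs k k<n
  ... | j , h , h₁ , h₂ , h₃ , h₄ , h₅ = on h₁ , on h₂ , on h₃ , on h₄ , on h₅
    where
    on : ∀ {a v} → arrs σ a j ≡ + v → arrs σ a (arrs σ aOrd (vars σ vK)) ≡ + v
    on {a} e = trans (cong (arrs σ a) (trans (cong (arrs σ aOrd) k≡) h)) e

  record Ready (σ : Store) : Set where
    field
      n≡     : Num σ 0 n
      radix≡ : Num σ vB B
      three≡ : Num σ vThree 3
      mul    : MulTable tableSize B σ
      jobs   : JobArrays σ

  readyArrs : List ℕ
  readyArrs = aM ∷ aOrd ∷ 0 ∷ 6 ∷ 5 ∷ 2 ∷ 3 ∷ []

  Ready-same : ∀ {σ τ} → Same (0 ∷ vB ∷ vThree ∷ []) readyArrs σ τ → Ready σ → Ready τ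
  Ready-same {σ} {τ} (same (e ∷ b ∷ c ∷ []) (a₁ ∷ as)) ready = record
    { n≡ = trans e n≡ ; radix≡ = trans b radix≡ ; three≡ = trans c three≡
    ; mul = λ i i< → trans (cong-app a₁ (+ i)) (mul i i<) ; jobs = JobArrays-same {[]} {σ} {τ} (same [] as) jobs }
    where open Ready ready

  remaining : ∀ {m x y} → m < n → x ≡ + n → y ≡ + m → x ℤ.- y ℤ.- 1ℤ ≡ + (n ∸ suc m)
  remaining {m} m<n x≡ y≡ = trans (sub≡ {n = 1} (sub≡ x≡ y≡ (<⇒≤ m<n)) refl (m<n⇒0<n∸m m<n))
    (cong +_ (trans (∸-+-assoc n m 1) (cong (n ∸_) (+-comm m 1))))

  layers : ∀ {σ} → Ready σ → (∀ i → arrs σ aV i ≡ 0ℤ) →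
           Run LAYERS σ ((kLayer + 16) * (n * (B ^ 4))) (λ τ → ∀ m s → m ≤ n → InRange B s → arrs τ aV (+ address m s) ≡ + V m s)
  layers {σ} ready empty = run-mono ≤-refl (λ filled m s m≤n r → filled m s m≤n r (address< (s≤s m≤n) r))
    (run-for* {LAYER} {vLayer} {0} {n} (λ m → Filled (suc m * (3 * Z))) refl refl refl layer (Ready.n≡ ready) {K = kLayer} time≤ 1≤Z 1≤n
      -- Layer 0 is never written: `V 0` is 0, and so is the initial content of the array.
      λ { zero s _ r _ → empty _ ; (suc m) s _ r lt → contradiction (address<⁻ (suc m) 1 s lt) λ { (s≤s ()) } })
    where
    Z = B ^ 4
    1≤Z : 1 ≤ Z
    1≤Z = 1≤ (1≤ (1≤ (1≤ ≤-refl)))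
    kPre = maxCost (vK ≔ var 0 ⊖ var vLayer ⊖ lit 1ℤ ⨾ GETJOB)
    time≤ : kPre + (kCell + 16 + 16 + 16 + 16 + 16) * (3 * Z) ≤ kLayer * Z
    time≤ = begin
      kPre + (kCell + 16 + 16 + 16 + 16 + 16) * (3 * Z)
        ≤⟨ +-mono-≤ (subst (_≤ kPre * Z) (*-identityʳ kPre) (*-monoʳ-≤ kPre 1≤Z))
          (≤-reflexive (sym (*-assoc (kCell + 16 + 16 + 16 + 16 + 16) 3 Z))) ⟩
      kPre * Z + (kCell + 16 + 16 + 16 + 16 + 16) * 3 * Z
        ≡⟨ *-distribʳ-+ Z kPre ((kCell + 16 + 16 + 16 + 16 + 16) * 3) ⟨
      kLayer * Z ∎
      where open ≤-Reasoning
    layer : ∀ m τ → m < n → Frame LAYERS σ τ → Num τ vLayer m → Filled (suc m * (3 * Z)) τ →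
            Run LAYER τ (kPre + (kCell + 16 + 16 + 16 + 16 + 16) * (3 * Z)) (Filled (suc (suc m) * (3 * Z)))
    layer m τ m<n fr m≡ filled =
      run-then {Q = λ υ → Ctx m υ × Filled (suc m * (3 * Z)) υ} (run-exec PRE refl (ctx , Filled-arr (suc m * (3 * Z)) τ (exec PRE τ) refl filled))
        λ υ (ctx , filled) →
      loop-ph m<n ctx filled
      where
      PRE = vK ≔ var 0 ⊖ var vLayer ⊖ lit 1ℤ ⨾ GETJOB
      ready′ : Ready τ
      ready′ = Ready-same (frame⇒same fr refl) ready
      τ₁ = exec (vK ≔ var 0 ⊖ var vLayer ⊖ lit 1ℤ) τ
      ctx : Ctx m (exec PRE τ)
      ctx = record
        { layer≡ = m≡ ; radix≡ = Ready.radix≡ ready′ ; three≡ = Ready.three≡ ready′ ; mul = Ready.mul ready′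
        ; job≡ = getjob-exec {σ = τ₁} (m∸1+n<m m<n) (Ready.jobs ready′) (remaining m<n (Ready.n≡ ready′) m≡) }
        where
        m∸1+n<m : m < n → n ∸ suc m < n
        m∸1+n<m m<n = ∸-monoʳ-< (s≤s z≤n) m<n

-- Choosing a window and recovering the classes

vS vE bS bE vLeast aCls : ℕ
vS     = 64
vE     = 65
bS     = 66
bE     = 67
vLeast = 68
aCls   = 11

windowEntry : ℕ → ℕ → Expr
windowEntry S E = aV [ ENC (var 0 ⊕ var 0 ⊕ var 0) (var E) (var S) (var E ⊖ (var 4 ⊕ var S)) (lit 0ℤ) ]

windowTests : List Test
windowTests = (var 4 ⊕ var vS ≼ var vE) ∷ (var vE ≼ var vS ⊕ var 1) ∷ []

-- `FIRST` starts the search with the window from 0 to `reserve`, which is admissible once `reserve`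
-- is within the budget, so no artificial infinite value occurs.
FIRST TAKE COMPARE WINDOW WINDOWS CHOOSE RESET KEEP WALKSTEP WALK : Program
FIRST    = bS ≔ lit 0ℤ ⨾ bE ≔ var 4 ⨾ vLeast ≔ windowEntry bS bE
TAKE     = vLeast ≔ var vV ⨾ bS ≔ var vS ⨾ bE ≔ var vE
COMPARE  = vV ≔ windowEntry vS vE ⨾ IF var vV ⊕ lit 1ℤ ≼ var vLeast THEN TAKE ELSE skip
WINDOW   = GUARD windowTests COMPARE
WINDOWS  = FOR vE < vB DO WINDOW
CHOOSE   = FIRST ⨾ FOR vS < vB DO WINDOWS
RESET    = vPh ≔ lit 0ℤ ⨾ vF ≔ var bE ⨾ vα ≔ var bS ⨾ vε ≔ var bE ⊖ (var 4 ⊕ var bS) ⨾ vt ≔ lit 0ℤ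
KEEP     = aCls [ var vK ]≔ var vCls ⨾ vα ≔ var vα′ ⨾ vε ≔ var vε′ ⨾ vt ≔ var vt′
WALKSTEP = (vLayer ≔ var 0 ⊖ var vK ⊖ lit 1ℤ ⨾ GETJOB) ⨾ STEP ⨾ KEEP
WALK     = RESET ⨾ FOR vK < 0 DO WALKSTEP

kChoose : ℕ
kChoose = maxCost FIRST + (maxCost WINDOW + 16 + 16)

module Search (n B : ℕ) (1≤n : 1 ≤ n) (1≤B : 1 ≤ B) (p q w : ℕ → ℕ) (isR : ℕ → Bool) (q≤B : ∀ k → q k ≤ B) (K : ℤ) where

  open Address n B 1≤B
  open Programme n p q w isR
  open Step n B 1≤B p q w isR q≤B
  open Fill n B 1≤n 1≤B p q w isR q≤B

  record Known (σ : Store) : Set where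
    field
      ready    : Ready σ
      reserve≡ : Num σ 4 reserve
      budget≡  : vars σ 1 ≡ K
      values   : ∀ m s → m ≤ n → InRange B s → arrs σ aV (+ address m s) ≡ + V m s

  Known-same : ∀ {σ τ} → Same (0 ∷ vB ∷ vThree ∷ 4 ∷ 1 ∷ []) (aV ∷ readyArrs) σ τ → Known σ → Known τ
  Known-same (same (e ∷ b ∷ c ∷ e₁ ∷ e₂ ∷ []) (v ∷ as)) known = record
    { ready = Ready-same (same (e ∷ b ∷ c ∷ []) as) ready ; reserve≡ = trans e₁ reserve≡ ; budget≡ = trans e₂ budget≡
    ; values = λ m s m≤n r → trans (cong-app v (+ address m s)) (values m s m≤n r) }
    where open Known known

  Admissible : ℕ → ℕ → Set
  Admissible S E = reserve + S ≤ E × E < B × + E ℤ.≤ + S ℤ.+ K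

  initial-range : ∀ {S E} → reserve + S ≤ E → E < B → InRange B (initial S E)
  initial-range {S} {E} le E<B = inRange (s≤s z≤n) E<B (≤-<-trans (m+n≤o⇒n≤o reserve le) E<B)
    (≤-<-trans (m∸n≤m E (reserve + S)) E<B) 1≤B

  eval-window : ∀ vS vE {S E σ} → Known σ → Num σ vS S → Num σ vE E → reserve + S ≤ E → E < B →
                eval (windowEntry vS vE) σ ≡ + V n (initial S E)
  eval-window vS vE {S} {E} {σ} known S≡ E≡ le E<B = trans
    (cong (arrs σ aV) (eval-ENC {σ} (Ready.mul ready) {var 0 ⊕ var 0 ⊕ var 0} {var vE} {var vS} {var vE ⊖ (var 4 ⊕ var vS)} {lit 0ℤ}
      (initial S E) ≤-refl range (trans (cong (λ x → x ℤ.+ x ℤ.+ x) (Ready.n≡ ready)) (cong +_ triple))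
      E≡ S≡ (sub≡ E≡ (cong₂ ℤ._+_ reserve≡ S≡) le) refl))
    (values n (initial S E) ≤-refl range)
    where
    open Known known
    range = initial-range le E<B
    triple : n + n + n ≡ n * 3 + 0
    triple = solve 1 (λ n → n :+ n :+ n := n :* con 3 :+ con 0) refl n
      where open +-*-Solver

  -- The pairs tried so far are those with `S * B + E` below `x`, which gives both loops one
  -- invariant. The current best may also be the window from which the search started.
  record LeastAmong (x : ℕ) (σ : Store) : Set where
    field
      {S E}      : ℕ
      S≡         : Num σ bS S
      E≡         : Num σ bE E
      least≡     : Num σ vLeast (V n (initial S E))
      admissible : Admissible S E
      least      : ∀ {S′ E′} → Admissible S′ E′ → S′ * B + E′ < x → V n (initial S E) ≤ V n (initial S′ E′)

  LeastAmong-same : ∀ {x σ τ} → vars τ bS ≡ vars σ bS → vars τ bE ≡ vars σ bE → vars τ vLeast ≡ vars σ vLeast → LeastAmong x σ → LeastAmong x τ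
  LeastAmong-same e₁ e₂ e₃ l = record
    { S≡ = trans e₁ S≡ ; E≡ = trans e₂ E≡ ; least≡ = trans e₃ least≡
    ; admissible = admissible ; least = least }
    where open LeastAmong l

  window-exec : ∀ {S E σ} → Known σ → E < B → Num σ vS S → Num σ vE E → LeastAmong (S * B + E) σ →
                LeastAmong (suc (S * B + E)) (exec WINDOW σ)
  window-exec {S} {E} {σ} known E<B S≡ E≡ l = exec-GUARD windowTests COMPARE σ (LeastAmong (suc x))
    (λ { (h₁ ∷ h₂ ∷ []) → new (holds⇒≤ room≡ E≡ h₁ , E<B , subst₂ ℤ._≤_ E≡ budget h₂) })
    (λ ¬h → old λ (h₁ , _ , h₂) → ¬h (≤⇒holds room≡ E≡ h₁ ∷ subst₂ ℤ._≤_ (sym E≡) (sym budget) h₂ ∷ []))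
    where
    x = S * B + E
    room≡ = cong₂ ℤ._+_ (Known.reserve≡ known) S≡
    budget = cong₂ ℤ._+_ S≡ (Known.budget≡ known)
    module L = LeastAmong l
    only : ∀ {S′ E′} {X : Set} → Admissible S′ E′ → S′ * B + E′ < suc x → (S′ * B + E′ < x → X) → (S′ ≡ S → E′ ≡ E → X) → X
    only {S′} {E′} (_ , E′<B , _) lt before now with S′ * B + E′ ≟ x
    ... | no neq = before (≤∧≢⇒< (s≤s⁻¹ lt) neq)
    ... | yes eq with digits-injective {S′} {E′} {S} {E} B E′<B E<B eq
    ...   | S≡ , E≡ = now S≡ E≡
    old : ¬ Admissible S E → LeastAmong (suc x) σ
    old ¬a = record { S≡ = L.S≡ ; E≡ = L.E≡ ; least≡ = L.least≡ ; admissible = L.admissible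
                    ; least = λ a lt → only a lt (L.least a) λ { refl refl → contradiction a ¬a } }
    new : Admissible S E → LeastAmong (suc x) (exec COMPARE σ)
    new a@(le , _ , _) = exec-IF (var vV ⊕ lit 1ℤ ≼ var vLeast) TAKE skip τ (LeastAmong (suc x))
      (λ h → let v<least = subst (_≤ V n (initial L.S L.E)) (+-comm _ 1) (holds⇒≤ v+1≡ L.least≡ h) in record
        { S≡ = S≡ ; E≡ = E≡ ; least≡ = v≡ ; admissible = a
        ; least = λ a′ lt → only a′ lt (λ lt → ≤-trans (<⇒≤ v<least) (L.least a′ lt)) λ { refl refl → ≤-refl } })
      (λ ¬h → record
        { S≡ = L.S≡ ; E≡ = L.E≡ ; least≡ = L.least≡ ; admissible = L.admissible
        ; least = λ a′ lt → only a′ lt (L.least a′) λ { refl refl → ≮⇒≥ λ v<least →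
            ¬h (≤⇒holds v+1≡ L.least≡ (subst (_≤ V n (initial L.S L.E)) (+-comm 1 _) v<least)) } })
      where
      τ = exec (vV ≔ windowEntry vS vE) σ
      v≡ : eval (windowEntry vS vE) σ ≡ + V n (initial S E)
      v≡ = eval-window vS vE known S≡ E≡ le E<B
      v+1≡ : eval (windowEntry vS vE) σ ℤ.+ 1ℤ ≡ + (V n (initial S E) + 1)
      v+1≡ = cong (ℤ._+ 1ℤ) v≡

  record Window (σ : Store) : Set where
    field
      {S E}      : ℕ
      S≡         : Num σ bS S
      E≡         : Num σ bE E
      admissible : Admissible S E
      least      : ∀ {S′ E′} → Admissible S′ E′ → V n (initial S E) ≤ V n (initial S′ E′)

  choose-run : ∀ {σ} → Known σ → + reserve ℤ.≤ K → reserve < B → Run CHOOSE σ (kChoose * (B * (B * 1))) Window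
  choose-run {σ} known R≤K R<B = run-mono time≤ conclude
    (run-then {Q = λ τ → Known τ × LeastAmong 0 τ} (run-exec FIRST refl (Known-same (frame⇒same (exec-frame FIRST σ refl) refl) known , start))
      λ σ₁ (known₁ , l) → run-for* {WINDOWS} {vS} {vB} {B} (λ S → LeastAmong (S * B)) refl refl refl
        (outer σ₁ known₁) (Ready.radix≡ (Known.ready known₁)) {K = maxCost WINDOW + 16} ≤-refl 1≤B1 1≤B
        (LeastAmong-same refl refl refl l))
    where
    1≤B1 : 1 ≤ B * 1
    1≤B1 = subst (1 ≤_) (sym (*-identityʳ B)) 1≤B
    time≤ : maxCost FIRST + (maxCost WINDOW + 16 + 16) * (B * (B * 1)) ≤ kChoose * (B * (B * 1))
    time≤ = ≤-trans (+-monoˡ-≤ _ (subst (_≤ maxCost FIRST * (B * (B * 1))) (*-identityʳ (maxCost FIRST))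
        (*-monoʳ-≤ (maxCost FIRST) (*-mono-≤ 1≤B 1≤B1))))
      (≤-reflexive (sym (*-distribʳ-+ (B * (B * 1)) (maxCost FIRST) (maxCost WINDOW + 16 + 16))))
    start : LeastAmong 0 (exec FIRST σ)
    start = record
      { S≡ = refl ; E≡ = Known.reserve≡ known
      ; least≡ = eval-window bS bE (Known-same (frame⇒same (exec-frame (bS ≔ lit 0ℤ ⨾ bE ≔ var 4) σ refl) refl) known)
          refl (Known.reserve≡ known) (≤-reflexive (+-identityʳ reserve)) R<B
      ; admissible = ≤-reflexive (+-identityʳ reserve) , R<B , subst (+ reserve ℤ.≤_) (sym (ℤ.+-identityˡ K)) R≤K
      ; least = λ _ () }
    outer : ∀ σ₁ → Known σ₁ → ∀ S τ → S < B → Frame (FOR vS < vB DO WINDOWS) σ₁ τ → Num τ vS S → LeastAmong (S * B) τ →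
            Run WINDOWS τ ((maxCost WINDOW + 16) * (B * 1)) (λ υ → LeastAmong (suc S * B) (setVar vS (+ suc S) υ))
    outer σ₁ known₁ S τ S<B fr S≡ l = run-mono ≤-refl
      (λ {υ} l → LeastAmong-same refl refl refl (subst (λ x → LeastAmong x υ) (+-comm (S * B) B) l))
      (run-for-flat {WINDOW} {vE} {vB} {B} (λ E → LeastAmong (S * B + E)) refl refl refl inner
        (Ready.radix≡ (Known.ready known₂)) 1≤B
        (LeastAmong-same refl refl refl (subst (λ x → LeastAmong x τ) (sym (+-identityʳ (S * B))) l)))
      where
      known₂ = Known-same (frame⇒same fr refl) known₁
      inner : ∀ E υ → E < B → Frame WINDOWS τ υ → Num υ vE E → LeastAmong (S * B + E) υ →
              Run WINDOW υ (maxCost WINDOW) (λ ϕ → LeastAmong (S * B + suc E) (setVar vE (+ suc E) ϕ))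
      inner E υ E<B fr′ E≡ l = run-exec WINDOW refl (LeastAmong-same refl refl refl
        (subst (λ x → LeastAmong x (exec WINDOW υ)) (sym (+-suc (S * B) E))
          (window-exec (Known-same (frame⇒same fr′ refl) known₂) E<B (trans (sameVar fr′ vS refl) S≡) E≡ l)))
    conclude : ∀ {τ} → LeastAmong (B * B) τ → Window τ
    conclude l = record { S≡ = L.S≡ ; E≡ = L.E≡ ; admissible = L.admissible
      ; least = λ { a@(le , E<B , _) → L.least a (digits-< (≤-<-trans (m+n≤o⇒n≤o reserve le) E<B) E<B) } }
      where module L = LeastAmong l

  module _ {s₀ : State} (range₀ : InRange B s₀) where

    open Walk s₀

    best-range : ∀ {k W s} → InRange B s → InRange B (next (best k W s))
    best-range {k} {W} {s} range with best k W s | best-achieved k W s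
    ... | _ | _ , late , _       = range
    ... | _ | _ , early ρ ap , _ = fire-range {0} {k} {W} {s} range ρ ap

    WalkInv : ℕ → Store → Set
    WalkInv k σ = InRange B (position k) × StateAt (position k) σ × (∀ i → i < k → arrs σ aCls (+ i) ≡ + code (chosen i))

    -- The table holds values only; `STEP` recomputes the minimising move from the layer for the
    -- jobs after `k`.
    walk-step : ∀ {k σ} → k < n → Known σ → Num σ vK k → WalkInv k σ → Run WALKSTEP σ (maxCost WALKSTEP) (WalkInv (suc k))
    walk-step {k} {σ} k<n known k≡ (range , at , done) =
      run-then {Q = λ τ → Frame PRE σ τ × Env (n ∸ suc k) k (V (n ∸ suc k)) τ × StateAt (position k) τ}
        (run-exec PRE refl (fr₀ , env , StateAt-same {as = []} (frame⇒same fr₀ refl) at)) λ σ₁ (fr₁ , env₁ , at₁) →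
      run-then (run-frame (step-run range env₁ at₁)) λ σ₂ (((_ , cls≡ , α≡ , ε≡ , t≡) , (ph≡ , f≡ , _)) , fr₂) →
      run-exec KEEP refl
        ( best-range {k} {V (n ∸ suc k)} (settle-range (q≤B k) range)
        , (trans ph≡ (cong +_ (sym (proj₁ sibling))) , trans f≡ (cong +_ (sym (proj₂ sibling))) , α≡ , ε≡ , t≡)
        , record-class σ₂ (trans (sameVar fr₂ vK refl) (trans (sameVar fr₁ vK refl) k≡)) cls≡
            (trans (sameArr fr₂ aCls refl) (sameArr fr₁ aCls refl)))
      where
      PRE = vLayer ≔ var 0 ⊖ var vK ⊖ lit 1ℤ ⨾ GETJOB
      fr₀ = exec-frame PRE σ refl
      sibling = best-sibling {k} {V (n ∸ suc k)} {settle (q k) (position k)}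
      env : Env (n ∸ suc k) k (V (n ∸ suc k)) (exec PRE σ)
      env = record
        { m≤n = m∸n≤m n (suc k) ; layer≡ = remaining k<n n≡ k≡ ; mul = mul
        ; job≡ = getjob-exec {σ = exec (vLayer ≔ var 0 ⊖ var vK ⊖ lit 1ℤ) σ} k<n jobs k≡
        ; values = λ s r → values (n ∸ suc k) s (m∸n≤m n (suc k)) r }
        where
        open Known known
        open Ready ready
      record-class : ∀ τ → Num τ vK k → Num τ vCls (code (chosen k)) → arrs τ aCls ≡ arrs σ aCls →
                     ∀ i → i < suc k → arrs (exec KEEP τ) aCls (+ i) ≡ + code (chosen i)
      record-class τ k≡ cls≡ a≡ i i<sk with i ≟ k
      ... | yes refl = trans (cong (arrs (exec KEEP τ) aCls) (sym k≡)) (trans (setArr-same aCls (vars τ vK) τ) cls≡)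
      ... | no  i≢k = trans (setArr-other aCls τ (λ eq → i≢k (ℤ.+-injective (trans (sym eq) k≡))))
                      (trans (cong-app a≡ (+ i)) (done i (≤∧≢⇒< (s≤s⁻¹ i<sk) i≢k)))

  walk-run : ∀ {S E σ} → Known σ → Num σ bS S → Num σ bE E → Admissible S E →
             Run WALK σ ((maxCost RESET + (maxCost WALKSTEP + 16)) * (n * 1))
               (λ τ → ∀ i → i < n → arrs τ aCls (+ i) ≡ + code (Walk.chosen (initial S E) i))
  walk-run {S} {E} {σ} known S≡ E≡ (le , E<B , _) = run-mono time≤ (λ (_ , _ , done) → done)
    (run-then {Q = λ τ → Known τ × WalkInv range 0 τ} (run-exec RESET refl
        (Known-same (frame⇒same (exec-frame RESET σ refl) refl) known ,
         range , (refl , E≡ , S≡ , sub≡ E≡ (cong₂ ℤ._+_ (Known.reserve≡ known) S≡) le , refl) , λ i ()))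
      λ σ₁ (known₁ , inv) → run-for-flat {WALKSTEP} {vK} {0} {n} (WalkInv range) refl refl refl
        (λ k τ k<n fr k≡ inv → walk-step range k<n (Known-same (frame⇒same fr refl) known₁) k≡ inv)
        (Ready.n≡ (Known.ready known₁)) 1≤n inv)
    where
    range = initial-range le E<B
    1≤n1 : 1 ≤ n * 1
    1≤n1 = subst (1 ≤_) (sym (*-identityʳ n)) 1≤n
    time≤ : maxCost RESET + (maxCost WALKSTEP + 16) * (n * 1) ≤ (maxCost RESET + (maxCost WALKSTEP + 16)) * (n * 1)
    time≤ = ≤-trans (+-monoˡ-≤ _ (subst (_≤ maxCost RESET * (n * 1)) (*-identityʳ (maxCost RESET)) (*-monoʳ-≤ (maxCost RESET) 1≤n1)))
      (≤-reflexive (sym (*-distribʳ-+ (n * 1) (maxCost RESET) (maxCost WALKSTEP + 16))))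

-- Variables 3 and 4 accumulate P and the processing time of all r-jobs.
CAPA LIMITS CLIP CLIPHI CLIPLO DUE BODY MAIN PREP DUESTEP BYDUE BYCLASS : Program
CAPA    = IF lit 1ℤ ≼ 3 [ var vJ ] THEN 4 ≔ var 4 ⊕ 0 [ var vJ ] ELSE (6 [ var vJ ]≔ 0 [ var vJ ])
PREP    = 3 ≔ var 3 ⊕ 0 [ var vJ ] ⨾ 7 [ var vJ ]≔ var vJ ⨾ CAPA
LIMITS  = vB ≔ var 3 ⊕ lit 1ℤ ⨾ vBound ≔ var 3 ⊕ lit (+ 2) ⨾ vThree ≔ lit (+ 3)
CLIPHI  = IF var vB ≼ var vV THEN vV ≔ var vB ELSE skip
CLIPLO  = IF var vV ≼ lit 0ℤ THEN vV ≔ lit 0ℤ ELSE skip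
CLIP    = vV ≔ 1 [ var vJ ] ⊕ lit 1ℤ ⨾ CLIPHI ⨾ CLIPLO
DUESTEP = CLIP ⨾ 5 [ var vJ ]≔ var vV
DUE     = FOR vJ < 0 DO DUESTEP
BYDUE   = SORTING.SORT 5 7 aOrd
BYCLASS = SORTING.SORT aCls aOrd 4
BODY    = TABLE ⨾ LAYERS ⨾ CHOOSE ⨾ WALK ⨾ vBound ≔ lit (+ 5) ⨾ BYCLASS ⨾ 2 ≔ lit 1ℤ
MAIN    = (FOR vJ < 0 DO PREP) ⨾ LIMITS ⨾ DUE ⨾ BYDUE ⨾ IF var 4 ≼ var 1 THEN BODY ELSE skip

fromVector-toℕ : ∀ {n} (f : Fin n → ℤ) j → fromVector f (+ toℕ j) ≡ f j
fromVector-toℕ {n} f j with toℕ j <? n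
... | yes j<n = cong f (Fin.fromℕ<-toℕ j j<n)
... | no  j≮n = contradiction (Fin.toℕ<n j) j≮n

prefix-extend : ∀ {n} (f : Fin n → ℕ) → prefix (extend 0 f) n ≡ total f
prefix-extend {n} f = total-cong {n} (extend-toℕ 0 f)

-- `cutDue P d` is `d + 1` clamped to the range from 0 to `P + 1`; for negative `d` already `d + 1`
-- is at most 0.
clip-exec : ∀ P d {σ} → Num σ vB (suc P) → vars σ vV ≡ d ℤ.+ 1ℤ → Num (exec CLIPLO (exec CLIPHI σ)) vV (cutDue P d)
clip-exec P d {σ} B≡ v≡ = exec-IF (var vB ≼ var vV) (vV ≔ var vB) skip σ (λ τ → Num (exec CLIPLO τ) vV (cutDue P d))
  (λ h → high d v≡ (subst₂ ℤ._≤_ B≡ v≡ h)) (λ ¬h → low d v≡ λ h → ¬h (subst₂ ℤ._≤_ (sym B≡) (sym v≡) h))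
  where
  high : ∀ d → vars σ vV ≡ d ℤ.+ 1ℤ → + suc P ℤ.≤ d ℤ.+ 1ℤ → Num (exec CLIPLO (exec (vV ≔ var vB) σ)) vV (cutDue P d)
  high (+ e) v≡ le = exec-IF (var vV ≼ lit 0ℤ) (vV ≔ lit 0ℤ) skip (exec (vV ≔ var vB) σ) (λ τ → Num τ vV (suc (e ⊓ P)))
    (λ h → contradiction (holds⇒≤ B≡ refl h) λ ())
    (λ _ → trans B≡ (cong (λ z → + suc z) (sym (m≥n⇒m⊓n≡n (s≤s⁻¹ (subst (suc P ≤_) (+-comm e 1) (ℤ.drop‿+≤+ le)))))))
  high -[1+ zero ]  v≡ le = contradiction (ℤ.drop‿+≤+ le) λ ()
  high -[1+ suc e ] v≡ ()
  low : ∀ d → vars σ vV ≡ d ℤ.+ 1ℤ → ¬ (+ suc P ℤ.≤ d ℤ.+ 1ℤ) → Num (exec CLIPLO σ) vV (cutDue P d)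
  low (+ e) v≡ ¬le = exec-IF (var vV ≼ lit 0ℤ) (vV ≔ lit 0ℤ) skip σ (λ τ → Num τ vV (suc (e ⊓ P)))
    (λ h → contradiction (subst (_≤ 0) (+-comm e 1) (holds⇒≤ v≡ refl h)) λ ())
    (λ _ → trans v≡ (cong +_ (trans (+-comm e 1) (cong suc (sym (m≤n⇒m⊓n≡m
      (≰⇒≥ λ P≤e → ¬le (ℤ.+≤+ (subst (suc P ≤_) (+-comm 1 e) (s≤s P≤e))))))))))
  low -[1+ e ] v≡ _ = exec-IF (var vV ≼ lit 0ℤ) (vV ≔ lit 0ℤ) skip σ (λ τ → Num τ vV 0)
    (λ _ → refl) (λ ¬h → contradiction (subst (ℤ._≤ 0ℤ) (sym v≡) (negative e)) ¬h)
    where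
    negative : ∀ e → -[1+ e ] ℤ.+ 1ℤ ℤ.≤ 0ℤ
    negative zero    = ℤ.≤-refl
    negative (suc e) = ℤ.-≤+

-- Times are counted in units of `n * B ^ 4`. The factor 2 comes from `P + 2 ≤ 2 * B`, the factor 6
-- from `3 (n + 1) ≤ 6 n`, the factor 5 is the number of classes; in `kBranch`, 3 pays for the test
-- and 1 for `skip`.
kPrep kLimits kDue kByDue kTable′ kLayers kWalk′ kByClass kBody kBranch kMain : ℕ
kPrep    = maxCost PREP + 16
kLimits  = maxCost LIMITS
kDue     = maxCost DUESTEP + 16
kByDue   = 2 + (maxCost (SORTING.PUT 5 7 aOrd) + 16 + 16) * 2
kTable′  = kTable * 6
kLayers  = kLayer + 16
kWalk′   = maxCost RESET + (maxCost WALKSTEP + 16)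
kByClass = 2 + (maxCost (SORTING.PUT aCls aOrd 4) + 16 + 16) * 5
kBody    = kTable′ + (kLayers + (kChoose + (kWalk′ + (2 + (kByClass + 2)))))
kBranch  = 3 + kBody + 1
kMain    = kPrep + (kLimits + (kDue + (kByDue + kBranch)))

-- The whole program

module Solve (I : Instance) where

  open Instance I
  open DueDateOrder I
  open Schedule I

  B : ℕ
  B = suc (P I)

  1≤n : 1 ≤ n
  1≤n = ≤-trans (s≤s z≤n) (Fin.toℕ<n (proj₁ Jʳ-nonempty))

  1≤B : 1 ≤ B
  1≤B = s≤s z≤n

  q≤B : ∀ k → q′ k ≤ B
  q≤B = byPos-all (_≤ B) z≤n λ j → cutDue-bound (P I) (d j)

  open Address n B 1≤B
  open Fill n B 1≤n 1≤B p′ q′ w′ isR′ q≤B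
  open Search n B 1≤n 1≤B p′ q′ w′ isR′ q≤B Kʳ

  W : ℕ
  W = n * B ^ 4

  1≤W : 1 ≤ W
  1≤W = *-mono-≤ 1≤n (*-mono-≤ 1≤B (*-mono-≤ 1≤B (*-mono-≤ 1≤B (*-mono-≤ 1≤B (s≤s z≤n)))))

  constant : ∀ k → k ≤ k * W
  constant k = subst (_≤ k * W) (*-identityʳ k) (*-monoʳ-≤ k 1≤W)

  once : ∀ {c σ Q} → Run c σ (maxCost c) Q → Run c σ (maxCost c * W) Q
  once {c} = run-mono (constant (maxCost c)) id

  n≤W : n * 1 ≤ W
  n≤W = *-monoʳ-≤ n (*-mono-≤ 1≤B (*-mono-≤ 1≤B (*-mono-≤ 1≤B (*-mono-≤ 1≤B ≤-refl))))

  powerful : ∀ {i j} → i ≤ j → B ^ i ≤ B ^ j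
  powerful i≤j = ^-monoʳ-≤ B i≤j

  prJ poJ : Fin n → ℕ
  prJ j = p j when isRJob j
  poJ j = p j when not (isRJob j)

  -- `blank` is kept because array 6 is written only for jobs that are not r-jobs; the entries of
  -- r-jobs rely on the initial 0.
  record Prepped (k : ℕ) (σ : Store) : Set where
    field
      sum≡     : Num σ 3 (prefix (extend 0 p) k)
      reserve≡ : Num σ 4 (prefix (extend 0 prJ) k)
      names    : ∀ (j : Fin n) → toℕ j < k → arrs σ 7 (+ toℕ j) ≡ + toℕ j
      others   : ∀ (j : Fin n) → toℕ j < k → arrs σ 6 (+ toℕ j) ≡ + poJ j
      blank    : ∀ (j : Fin n) → k ≤ toℕ j → arrs σ 6 (+ toℕ j) ≡ 0ℤ

  Prepped-same : ∀ {k σ τ} → vars τ 3 ≡ vars σ 3 → vars τ 4 ≡ vars σ 4 → arrs τ 7 ≡ arrs σ 7 → arrs τ 6 ≡ arrs σ 6 →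
                 Prepped k σ → Prepped k τ
  Prepped-same e₃ e₄ e₇ e₆ h = record
    { sum≡ = trans e₃ sum≡ ; reserve≡ = trans e₄ reserve≡
    ; names = λ j lt → trans (cong-app e₇ (+ toℕ j)) (names j lt)
    ; others = λ j lt → trans (cong-app e₆ (+ toℕ j)) (others j lt)
    ; blank = λ j le → trans (cong-app e₆ (+ toℕ j)) (blank j le) }
    where open Prepped h

  prefix-extend-suc : ∀ (f : Fin n → ℕ) j → prefix (extend 0 f) (suc (toℕ j)) ≡ prefix (extend 0 f) (toℕ j) + f j
  prefix-extend-suc f j = trans (prefix-suc (extend 0 f) (toℕ j)) (cong (λ z → prefix (extend 0 f) (toℕ j) + z) (extend-toℕ 0 f j))

  prep-exec : ∀ j {σ} → Num σ vJ (toℕ j) → arrs σ 0 (+ toℕ j) ≡ + p j →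
              arrs σ 3 (+ toℕ j) ≡ (if isRJob j then 1ℤ else 0ℤ) → Prepped (toℕ j) σ → Prepped (suc (toℕ j)) (exec PREP σ)
  prep-exec j {σ} j≡ p≡ r≡ h = exec-IF (lit 1ℤ ≼ 3 [ var vJ ]) (4 ≔ var 4 ⊕ 0 [ var vJ ]) (6 [ var vJ ]≔ 0 [ var vJ ]) τ (Prepped (suc (toℕ j)))
      (λ 1≤r → yes-r (isRJob j) refl (subst (1ℤ ℤ.≤_) r≡′ 1≤r)) (λ 1≰r → no-r (isRJob j) refl λ 1≤r → 1≰r (subst (1ℤ ℤ.≤_) (sym r≡′) 1≤r))
    where
    open Prepped h
    τ = exec (3 ≔ var 3 ⊕ 0 [ var vJ ] ⨾ 7 [ var vJ ]≔ var vJ) σ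
    p≡′ : arrs σ 0 (vars σ vJ) ≡ + p j
    p≡′ = trans (cong (arrs σ 0) j≡) p≡
    r≡′ : arrs σ 3 (vars σ vJ) ≡ (if isRJob j then 1ℤ else 0ℤ)
    r≡′ = trans (cong (arrs σ 3) j≡) r≡
    sum≡′ : vars σ 3 ℤ.+ arrs σ 0 (vars σ vJ) ≡ + prefix (extend 0 p) (suc (toℕ j))
    sum≡′ = trans (cong₂ ℤ._+_ sum≡ p≡′) (cong +_ (sym (prefix-extend-suc p j)))
    split : ∀ {X : Fin n → Set} → (∀ i → toℕ i < toℕ j → X i) → X j → ∀ i → toℕ i < suc (toℕ j) → X i
    split {X} before now i i<sj with toℕ i ≟ toℕ j
    ... | yes i≡j = subst X (Fin.toℕ-injective (sym i≡j)) now
    ... | no  i≢j = before i (≤∧≢⇒< (s≤s⁻¹ i<sj) i≢j)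
    elsewhere : ∀ i → toℕ i ≢ toℕ j → vars σ vJ ≢ + toℕ i
    elsewhere i i≢j e = i≢j (ℤ.+-injective (trans (sym e) j≡))
    names′ : ∀ i → toℕ i < suc (toℕ j) → arrs τ 7 (+ toℕ i) ≡ + toℕ i
    names′ = split (λ i i<j → trans (setArr-other 7 σ (elsewhere i (<⇒≢ i<j))) (names i i<j))
                   (trans (cong (arrs τ 7) (sym j≡)) (trans (setArr-same 7 (vars σ vJ) σ) j≡))
    yes-r : ∀ β → isRJob j ≡ β → 1ℤ ℤ.≤ (if β then 1ℤ else 0ℤ) → Prepped (suc (toℕ j)) (exec (4 ≔ var 4 ⊕ 0 [ var vJ ]) τ)
    yes-r false _ (ℤ.+≤+ ())
    yes-r true  e _ = record
      { sum≡ = sum≡′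
      ; reserve≡ = trans (cong₂ ℤ._+_ reserve≡ p≡′) (cong +_ (sym (trans (prefix-extend-suc prJ j)
          (cong (λ β → prefix (extend 0 prJ) (toℕ j) + p j when β) e))))
      ; names = names′
      ; others = split others (trans (blank j ≤-refl) (cong (λ β → + (p j when not β)) (sym e)))
      ; blank = λ i j<i → blank i (<⇒≤ j<i) }
    no-r : ∀ β → isRJob j ≡ β → ¬ (1ℤ ℤ.≤ (if β then 1ℤ else 0ℤ)) → Prepped (suc (toℕ j)) (exec (6 [ var vJ ]≔ 0 [ var vJ ]) τ)
    no-r true  _ 1≰1 = contradiction ℤ.≤-refl 1≰1
    no-r false e _ = record
      { sum≡ = sum≡′
      ; reserve≡ = trans reserve≡ (cong +_ (sym (trans (prefix-extend-suc prJ j)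
          (trans (cong (λ β → prefix (extend 0 prJ) (toℕ j) + p j when β) e) (+-identityʳ _)))))
      ; names = names′
      ; others = split (λ i i<j → trans (setArr-other 6 τ (elsewhere i (<⇒≢ i<j))) (others i i<j))
          (trans (cong (arrs (exec (6 [ var vJ ]≔ 0 [ var vJ ]) τ) 6) (sym j≡))
            (trans (setArr-same 6 (vars σ vJ) τ) (trans p≡′ (cong (λ β → + (p j when not β)) (sym e)))))
      ; blank = λ i j<i → trans (setArr-other 6 τ (elsewhere i (λ e → <⇒≢ j<i (sym e)))) (blank i (<⇒≤ j<i)) }

  prep-run : Run (FOR vJ < 0 DO PREP) (input I) ((maxCost PREP + 16) * (n * 1)) (Prepped n)
  prep-run = run-for-flat {PREP} {vJ} {0} {n} Prepped refl refl refl step refl 1≤n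
      (record { sum≡ = refl ; reserve≡ = refl ; names = λ j () ; others = λ j () ; blank = λ j _ → refl })
    where
    step : ∀ k τ → k < n → Frame (FOR vJ < 0 DO PREP) (input I) τ → Num τ vJ k → Prepped k τ →
           Run PREP τ (maxCost PREP) (λ υ → Prepped (suc k) (setVar vJ (+ suc k) υ))
    step k τ k<n fr k≡ h = run-exec PREP refl (Prepped-same refl refl refl refl
      (subst (λ k → Prepped (suc k) (exec PREP τ)) toℕj (prep-exec j (trans k≡ (cong +_ (sym toℕj)))
        (trans (cong-app (sameArr fr 0 refl) (+ toℕ j)) (fromVector-toℕ _ j))
        (trans (cong-app (sameArr fr 3 refl) (+ toℕ j)) (fromVector-toℕ _ j))
        (subst (λ k → Prepped k τ) (sym toℕj) h))))
      where
      j = fromℕ< k<n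
      toℕj : toℕ j ≡ k
      toℕj = Fin.toℕ-fromℕ< k<n

  Cut : ℕ → Store → Set
  Cut k σ = ∀ (j : Fin n) → toℕ j < k → arrs σ 5 (+ toℕ j) ≡ + q j

  due-run : ∀ {σ} → Num σ 0 n → Num σ vB B → arrs σ 1 ≡ fromVector d → Run DUE σ ((maxCost DUESTEP + 16) * (n * 1)) (Cut n)
  due-run {σ} n≡ B≡ d≡ = run-for-flat {DUESTEP} {vJ} {0} {n} Cut refl refl refl step n≡ 1≤n (λ j ())
    where
    step : ∀ k τ → k < n → Frame DUE σ τ → Num τ vJ k → Cut k τ → Run DUESTEP τ (maxCost DUESTEP) (λ υ → Cut (suc k) (setVar vJ (+ suc k) υ))
    step k τ k<n fr k≡ cut =
      run-then {Q = λ υ → Frame CLIP τ υ × Num υ vV (q j)} (run-exec CLIP refl (exec-frame CLIP τ refl , clipped)) λ υ (fr′ , v≡) →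
      run-exec (5 [ var vJ ]≔ var vV) refl (cut′ υ fr′ v≡)
      where
      j = fromℕ< k<n
      toℕj : toℕ j ≡ k
      toℕj = Fin.toℕ-fromℕ< k<n
      clipped : Num (exec CLIP τ) vV (q j)
      clipped = clip-exec (P I) (d j) {exec (vV ≔ 1 [ var vJ ] ⊕ lit 1ℤ) τ} (trans (sameVar fr vB refl) B≡)
        (cong (ℤ._+ 1ℤ) (trans (cong (arrs τ 1) (trans k≡ (cong +_ (sym toℕj))))
          (trans (cong-app (trans (sameArr fr 1 refl) d≡) (+ toℕ j)) (fromVector-toℕ d j))))
      cut′ : ∀ υ → Frame CLIP τ υ → Num υ vV (q j) → Cut (suc k) (exec (5 [ var vJ ]≔ var vV) υ)
      cut′ υ fr′ v≡ i i<sk with toℕ i ≟ k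
      ... | yes i≡k rewrite Fin.toℕ-injective (trans i≡k (sym toℕj)) =
            trans (cong (arrs (exec (5 [ var vJ ]≔ var vV) υ) 5) (sym j≡)) (trans (setArr-same 5 (vars υ vJ) υ) v≡)
        where
        j≡ : Num υ vJ (toℕ j)
        j≡ = trans (sameVar fr′ vJ refl) (trans k≡ (cong +_ (sym toℕj)))
      ... | no i≢k = trans (setArr-other 5 υ λ e → i≢k (ℤ.+-injective (trans (sym e) (trans (sameVar fr′ vJ refl) k≡))))
            (trans (cong-app (sameArr fr′ 5 refl) (+ toℕ i)) (cut i (≤∧≢⇒< (s≤s⁻¹ i<sk) i≢k)))

  record Prepared (σ : Store) : Set where
    field
      n≡       : Num σ 0 n
      budget≡  : vars σ 1 ≡ Kʳ
      reserve≡ : Num σ 4 reserve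
      radix≡   : Num σ vB B
      three≡   : Num σ vThree 3
      blank    : ∀ i → arrs σ aV i ≡ 0ℤ
      jobs     : JobArrays σ
      ordered  : ∀ (k : Fin n) → arrs σ aOrd (+ toℕ k) ≡ + toℕ (job k)

  job-arrays : ∀ {σ} → (∀ j → arrs σ aOrd (+ toℕ (Q.rank j)) ≡ + toℕ j) → arrs σ 0 ≡ fromVector (λ j → + p j) →
               (∀ j → toℕ j < n → arrs σ 6 (+ toℕ j) ≡ + poJ j) → Cut n σ → arrs σ 2 ≡ fromVector (λ j → + w j) →
               arrs σ 3 ≡ fromVector (λ j → if isRJob j then 1ℤ else 0ℤ) → JobArrays σ
  job-arrays {σ} ord≡ p≡ po≡ q≡ w≡ r≡ = at-pos {λ k → ∃[ j ] arrs σ aOrd (+ k) ≡ j × arrs σ 0 j ≡ + p′ k × arrs σ 6 j ≡ + po k ×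
                arrs σ 5 j ≡ + q′ k × arrs σ 2 j ≡ + w′ k × arrs σ 3 j ≡ + r k} λ j →
      + toℕ j , trans (cong (λ z → arrs σ aOrd (+ z)) (pos≡ j)) (ord≡ j)
    , given j p≡ (cong +_ (sym (byPos-pos 0 p j)))
    , trans (po≡ j (Fin.toℕ<n j)) (cong +_ (sym (cong₂ (λ v β → v when not β) (byPos-pos 0 p j) (byPos-pos false isRJob j))))
    , trans (q≡ j (Fin.toℕ<n j)) (cong +_ (sym (byPos-pos 0 q j)))
    , given j w≡ (cong +_ (sym (byPos-pos 0 w j)))
    , given j r≡ (trans (indicator (isRJob j)) (cong (λ β → + (1 when β)) (sym (byPos-pos false isRJob j))))
    where
    given : ∀ j {a f v} → arrs σ a ≡ fromVector f → f j ≡ v → arrs σ a (+ toℕ j) ≡ v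
    given j {f = f} e h = trans (cong (λ g → g (+ toℕ j)) e) (trans (fromVector-toℕ f j) h)
    indicator : ∀ β → (if β then 1ℤ else 0ℤ) ≡ + (1 when β)
    indicator true  = refl
    indicator false = refl

  by-due-time : 2 + (maxCost (SORTING.PUT 5 7 aOrd) + 16 + 16) * ((2 + P I) * (n * 1)) ≤ kByDue * W
  by-due-time = begin
    2 + k * ((2 + P I) * (n * 1))  ≤⟨ +-mono-≤ (constant 2) (*-monoʳ-≤ k step) ⟩
    2 * W + k * (2 * W)            ≡⟨ solve 2 (λ k w → con 2 :* w :+ k :* (con 2 :* w) := (con 2 :+ k :* con 2) :* w) refl k W ⟩
    kByDue * W                     ∎
    where
    open ≤-Reasoning
    open +-*-Solver
    k = maxCost (SORTING.PUT 5 7 aOrd) + 16 + 16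
    step : (2 + P I) * (n * 1) ≤ 2 * W
    step = begin
      (2 + P I) * (n * 1)  ≤⟨ *-monoˡ-≤ (n * 1) (+-mono-≤ 1≤B (≤-refl {B})) ⟩
      (B + B) * (n * 1)    ≡⟨ solve 2 (λ b n → (b :+ b) :* (n :* con 1) := con 2 :* (n :* (b :* con 1))) refl B n ⟩
      2 * (n * (B ^ 1))    ≤⟨ *-monoʳ-≤ 2 (*-monoʳ-≤ n (powerful {1} {4} (s≤s z≤n))) ⟩
      2 * W                ∎

  preparation : ∀ {c k Q} → (∀ τ → Prepared τ → Num τ 2 0 → Run c τ (k * W) Q) →
                Run ((FOR vJ < 0 DO PREP) ⨾ LIMITS ⨾ DUE ⨾ BYDUE ⨾ c) (input I) ((kPrep + (kLimits + (kDue + (kByDue + k)))) * W) Q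
  preparation {c} {k} {Q} next =
    run-then* kPrep (kLimits + (kDue + (kByDue + k))) W (run-mono (*-monoʳ-≤ kPrep n≤W) id (run-frame prep-run)) λ σ₁ (prepped , fr₁) →
    run-then* kLimits (kDue + (kByDue + k)) W (once {LIMITS} {σ₁}
      (run-exec LIMITS {σ₁} {λ τ → Num τ vB B × Num τ vBound (2 + P I) × Num τ vThree 3 × Frame LIMITS σ₁ τ} refl
      (raised 1 (sum σ₁ prepped) , raised 2 (sum σ₁ prepped) , refl , exec-frame LIMITS σ₁ refl))) λ σ₂ (B≡ , bound≡ , three≡ , fr₂) →
    run-then* kDue (kByDue + k) W (run-mono (*-monoʳ-≤ kDue n≤W) id (run-frame (due-run
      (trans (sameVar fr₂ 0 refl) (sameVar fr₁ 0 refl)) B≡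
      (trans (sameArr fr₂ 1 refl) (sameArr fr₁ 1 refl))))) λ σ₃ (cut , fr₃) →
    -- Cut due dates range from 0 to `P + 1`, hence `P + 2` buckets.
    run-then* kByDue k W (run-mono by-due-time id
      (run-frame (SORTING.sort 5 7 aOrd q refl refl σ₃ (λ j → cut j (Fin.toℕ<n j)) {2 + P I} 1≤n (s≤s z≤n)
      (λ j → s≤s (cutDue-bound (P I) (d j)))
      (trans (sameVar fr₃ 0 refl) (trans (sameVar fr₂ 0 refl) (sameVar fr₁ 0 refl)))
      (trans (sameVar fr₃ vBound refl) bound≡)))) λ σ₄ (sorted , fr₄) →
    let
      still : ∀ x {v} → writesVar (BYDUE) x ≡ false → writesVar DUE x ≡ false → writesVar LIMITS x ≡ false → vars σ₁ x ≡ v → vars σ₄ x ≡ v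
      still x w₄ w₃ w₂ e = trans (sameVar fr₄ x w₄) (trans (sameVar fr₃ x w₃) (trans (sameVar fr₂ x w₂) e))
      stillA : ∀ a {f} → writesArr (BYDUE) a ≡ false → writesArr DUE a ≡ false → writesArr LIMITS a ≡ false → arrs σ₁ a ≡ f → arrs σ₄ a ≡ f
      stillA a w₄ w₃ w₂ e = trans (sameArr fr₄ a w₄) (trans (sameArr fr₃ a w₃) (trans (sameArr fr₂ a w₂) e))
      order≡ : ∀ j → arrs σ₄ aOrd (+ toℕ (Q.rank j)) ≡ + toℕ j
      order≡ j = trans (cong (λ z → arrs σ₄ aOrd (+ z)) (Q.toℕ-rank j)) (trans (sorted j)
        (trans (cong-app (trans (sameArr fr₃ 7 refl) (sameArr fr₂ 7 refl)) (+ toℕ j))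
               (Prepped.names prepped j (Fin.toℕ<n j))))
    in next σ₄ (record
      { n≡ = still 0 refl refl refl (sameVar fr₁ 0 refl)
      ; budget≡ = still 1 refl refl refl (sameVar fr₁ 1 refl)
      ; reserve≡ = still 4 refl refl refl (trans (Prepped.reserve≡ prepped) (cong +_ (trans (prefix-extend prJ) (sym reserve-jobs))))
      ; radix≡ = trans (sameVar fr₄ vB refl) (trans (sameVar fr₃ vB refl) B≡)
      ; three≡ = trans (sameVar fr₄ vThree refl) (trans (sameVar fr₃ vThree refl) three≡)
      ; blank = λ i → cong-app (stillA aV refl refl refl (sameArr fr₁ aV refl)) i
      ; jobs = job-arrays {σ₄} order≡ (stillA 0 refl refl refl (sameArr fr₁ 0 refl))
          (λ j lt → trans (cong-app (stillA 6 refl refl refl refl) (+ toℕ j)) (Prepped.others prepped j lt))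
          (λ j lt → trans (cong-app (sameArr fr₄ 5 refl) (+ toℕ j)) (cut j lt))
          (stillA 2 refl refl refl (sameArr fr₁ 2 refl)) (stillA 3 refl refl refl (sameArr fr₁ 3 refl))
      ; ordered = λ k → trans (cong (λ z → arrs σ₄ aOrd (+ toℕ z)) (sym (rank-job k))) (order≡ (job k)) })
      (still 2 refl refl refl (sameVar fr₁ 2 refl))
    where
    sum : ∀ σ → Prepped n σ → Num σ 3 (P I)
    sum σ prepped = trans (Prepped.sum≡ prepped) (cong +_ (prefix-extend p))
    raised : ∀ c {x} → x ≡ + P I → x ℤ.+ + c ≡ + (c + P I)
    raised c refl = cong +_ (+-comm (P I) c)

  table-time : ∀ k → k * tableSize ≤ (k * 6) * W
  table-time k = begin
    k * (B ^ 3 * (suc n + suc n + suc n))  ≤⟨ *-monoʳ-≤ k (*-mono-≤ (powerful {3} {4} (s≤s (s≤s (s≤s z≤n)))) (+-mono-≤ (+-mono-≤ n+1≤ n+1≤) n+1≤)) ⟩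
    k * (B ^ 4 * (n + n + (n + n) + (n + n)))  ≡⟨ solve 3 (λ k b n → k :* (b :* (n :+ n :+ (n :+ n) :+ (n :+ n)))
      := k :* con 6 :* (n :* b)) refl k (B ^ 4) n ⟩
    (k * 6) * W ∎
    where
    open ≤-Reasoning
    open +-*-Solver
    n+1≤ : suc n ≤ n + n
    n+1≤ = +-monoˡ-≤ n 1≤n

  Answered : Store → Set
  Answered τ = ∃[ answer ] Outputs I τ answer × CorrectAnswer I answer

  private
    class-time : 2 + (maxCost (SORTING.PUT aCls aOrd 4) + 16 + 16) * (5 * (n * 1)) ≤ kByClass * W
    class-time = begin
      2 + k * (5 * (n * 1))  ≤⟨ +-mono-≤ (constant 2) (*-monoʳ-≤ k (*-monoʳ-≤ 5 n≤W)) ⟩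
      2 * W + k * (5 * W)    ≡⟨ solve 2 (λ k w → con 2 :* w :+ k :* (con 5 :* w) := (con 2 :+ k :* con 5) :* w) refl k W ⟩
      kByClass * W           ∎
      where
      open ≤-Reasoning
      open +-*-Solver
      k = maxCost (SORTING.PUT aCls aOrd 4) + 16 + 16
    code<5 : ∀ x → code x < 5
    code<5 𝐀  = s≤s z≤n
    code<5 𝐁  = s≤s (s≤s z≤n)
    code<5 𝐁ˡ = s≤s (s≤s (s≤s z≤n))
    code<5 𝐃  = s≤s (s≤s (s≤s (s≤s z≤n)))
    code<5 𝐃ˡ = s≤s (s≤s (s≤s (s≤s (s≤s z≤n))))

  conclude : ∀ σ₃ → Known σ₃ → Search.Window n B 1≤n 1≤B p′ q′ w′ isR′ q≤B Kʳ σ₃ →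
             (∀ (k : Fin n) → arrs σ₃ aOrd (+ toℕ k) ≡ + toℕ (job k)) →
             Run (WALK ⨾ vBound ≔ lit (+ 5) ⨾ BYCLASS ⨾ 2 ≔ lit 1ℤ) σ₃ ((kWalk′ + (2 + (kByClass + 2))) * W) Answered
  conclude σ₃ known window ord =
    run-then* kWalk′ (2 + (kByClass + 2)) W (run-mono (*-monoʳ-≤ kWalk′ n≤W) id (run-frame (walk-run known Win.S≡ Win.E≡ Win.admissible)))
      λ σ₄ (classes , fr₄) →
    run-then* 2 (kByClass + 2) W (once {vBound ≔ lit (+ 5)} {σ₄}
      (run-exec (vBound ≔ lit (+ 5)) {σ₄} {λ τ → Num τ vBound 5 × Frame (vBound ≔ lit (+ 5)) σ₄ τ} refl
      (refl , exec-frame (vBound ≔ lit (+ 5)) σ₄ refl))) λ σ₅ (five , fr₅) →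
    -- The sorted values are the jobs in the order of due dates, so array 4 receives the composition
    -- of the two sorts, which is the answer.
    run-then* kByClass 2 W (run-mono class-time id (SORTING.sort aCls aOrd 4 (λ (k : Fin n) → code (cls (toℕ k))) refl refl σ₅
      (λ k → trans (cong-app (sameArr fr₅ aCls refl) (+ toℕ k)) (classes (toℕ k) (Fin.toℕ<n k)))
      {5} 1≤n (s≤s z≤n) (λ k → code<5 (cls (toℕ k)))
      (trans (sameVar fr₅ 0 refl) (trans (sameVar fr₄ 0 refl) (Ready.n≡ (Known.ready known)))) five)) λ σ₆ sorted →
    once {2 ≔ lit 1ℤ} (run-exec (2 ≔ lit 1ℤ) {σ₆} {Answered} refl
      (just (answer Win.S Win.E) , (refl , output σ₆ λ k → trans (sorted k)
          (trans (cong-app (trans (sameArr fr₅ aOrd refl) (sameArr fr₄ aOrd refl)) (+ toℕ k)) (ord k)))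
      , answer-optimal (window⁺ Win.admissible) λ win → Win.least (window⁻ win)))
    where
    module Win = Search.Window window
    cls = Walk.chosen (initial Win.S Win.E)
    module TS = ToSequence cls
    window⁺ : ∀ {S E} → Admissible S E → Schedule.Window I S E
    window⁺ (le , E<B , c) = record { spacious = le ; bounded = s≤s⁻¹ E<B ; cheap = c }
    window⁻ : ∀ {S E} → Schedule.Window I S E → Admissible S E
    window⁻ win = spacious , s≤s bounded , cheap
      where open Schedule.Window win
    output : ∀ τ → (∀ (k : Fin n) → arrs τ 4 (+ TS.K.below (TS.K.key k)) ≡ + toℕ (job k)) →
             ∀ k → arrs τ 4 (+ toℕ k) ≡ + toℕ (answer Win.S Win.E ⟨$⟩ʳ k)
    output τ stored k = trans (cong (λ z → arrs τ 4 (+ z)) (sym rank≡)) (trans (stored (TS.K.order ⟨$⟩ʳ k))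
      (cong (λ j → + toℕ j) (sym (TS.sequence-job k))))
      where
      rank≡ : TS.K.below (TS.K.key (TS.K.order ⟨$⟩ʳ k)) ≡ toℕ k
      rank≡ = trans (sym (TS.K.toℕ-rank (TS.K.order ⟨$⟩ʳ k))) (cong toℕ (inverseˡ TS.K.order))

  body-run : ∀ {σ} → Prepared σ → + reserve ℤ.≤ Kʳ → Run BODY σ (kBody * W) Answered
  body-run {σ} prep R≤K =
    run-then* kTable′ (kLayers + (kChoose + (kWalk′ + (2 + (kByClass + 2))))) W (run-mono (table-time kTable) id
      (run-frame (table 1≤B n≡ radix≡ three≡))) λ σ₁ (mul , fr₁) →
    let ready₁ : Ready σ₁
        ready₁ = record { n≡ = trans (sameVar fr₁ 0 refl) n≡ ; radix≡ = trans (sameVar fr₁ vB refl) radix≡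
          ; three≡ = trans (sameVar fr₁ vThree refl) three≡ ; mul = mul ; jobs = JobArrays-same {[]} {σ} {σ₁} (frame⇒same fr₁ refl) jobs }
    in
    run-then* kLayers (kChoose + (kWalk′ + (2 + (kByClass + 2)))) W
      (run-frame (layers ready₁ λ i → trans (cong-app (sameArr fr₁ aV refl) i) (blank i))) λ σ₂ (values , fr₂) →
    let known₂ : Known σ₂
        known₂ = record { ready = Ready-same (frame⇒same fr₂ refl) ready₁
          ; reserve≡ = trans (sameVar fr₂ 4 refl) (trans (sameVar fr₁ 4 refl) reserve≡)
          ; budget≡ = trans (sameVar fr₂ 1 refl) (trans (sameVar fr₁ 1 refl) budget≡)
          ; values = values }
    in
    run-then* kChoose (kWalk′ + (2 + (kByClass + 2))) W
      (run-mono choose-time id (run-frame (choose-run known₂ R≤K (s≤s reserve≤P)))) λ σ₃ (window , fr₃) →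
    conclude σ₃ (Known-same (frame⇒same fr₃ refl) known₂) window
      (λ k → trans (cong-app (trans (sameArr fr₃ aOrd refl) (trans (sameArr fr₂ aOrd refl) (sameArr fr₁ aOrd refl))) (+ toℕ k)) (ordered k))
    where
    open Prepared prep
    choose-time : kChoose * (B * (B * 1)) ≤ kChoose * W
    choose-time = *-monoʳ-≤ kChoose (≤-trans (powerful {2} {4} (s≤s (s≤s z≤n))) (subst (_≤ W) (*-identityˡ (B ^ 4)) (*-monoˡ-≤ (B ^ 4) 1≤n)))

  then-time : ∀ k → 3 + k * W ≤ (3 + k + 1) * W
  then-time k = ≤-trans (+-monoˡ-≤ (k * W) (constant 3)) (≤-trans (≤-reflexive (sym (*-distribʳ-+ W 3 k))) (*-monoˡ-≤ W (m≤m+n (3 + k) 1)))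

  else-time : ∀ k → 4 ≤ (3 + k + 1) * W
  else-time k = ≤-trans (constant 4) (*-monoˡ-≤ W (+-monoʳ-≤ 3 (m≤n+m 1 k)))

  branch : ∀ σ → Prepared σ → Num σ 2 0 → Run (IF var 4 ≼ var 1 THEN BODY ELSE skip) σ (kBranch * W) Answered
  branch σ prep zero≡ = decide (+ reserve ℤ.≤? Kʳ)
    where
    decide : Dec (+ reserve ℤ.≤ Kʳ) → Run (IF var 4 ≼ var 1 THEN BODY ELSE skip) σ (kBranch * W) Answered
    decide (yes R≤K) = run-mono (then-time kBody) id
      (run-yes (subst₂ ℤ._≤_ (sym (Prepared.reserve≡ prep)) (sym (Prepared.budget≡ prep)) R≤K) (body-run prep R≤K))
    decide (no R≰K) = run-mono (else-time kBody) id
      (run-no (λ h → R≰K (subst₂ ℤ._≤_ (Prepared.reserve≡ prep) (Prepared.budget≡ prep) h))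
        -- Variable 2 still holds its initial 0, which reports that no sequence is feasible.
        (run-exec skip {σ} {Answered} refl (nothing , zero≡ , λ π feasible → R≰K (reserve≤Kʳ π feasible))))

  main : Run MAIN (input I) (kMain * W) Answered
  main = preparation {k = kBranch} branch

  -- `P + 1` is at most twice `P ⊔ 1`, and 16 is the fourth power of 2. The maximum with 1 keeps the
  -- bound positive when all processing times are 0, as every run takes time.
  W≤ : W ≤ 16 * (n * (P I ⊔ 1) ^ 4)
  W≤ = begin
    n * B ^ 4              ≤⟨ *-monoʳ-≤ n (^-monoˡ-≤ 4 (+-mono-≤ (m≤n⊔m (P I) 1) (m≤m⊔n (P I) 1))) ⟩
    n * (x + x) ^ 4        ≡⟨ solve 2 (λ n x → n :* (x :+ x) :^ 4 := con 16 :* (n :* x :^ 4)) refl n x ⟩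
    16 * (n * x ^ 4)       ∎
    where
    open ≤-Reasoning
    open +-*-Solver
    x = P I ⊔ 1

  in-bound : ∀ k {t} → t ≤ k * W → t ≤ k * 16 * (n * (P I ⊔ 1) ^ 4)
  in-bound k t≤ = ≤-trans t≤ (≤-trans (*-monoʳ-≤ k W≤) (≤-reflexive (sym (*-assoc k 16 (n * (P I ⊔ 1) ^ 4)))))

  solved : SolvesWithin MAIN I (kMain * 16 * (n * (P I ⊔ 1) ^ 4))
  solved = read-off main
    where
    read-off : Run MAIN (input I) (kMain * W) Answered → SolvesWithin MAIN I (kMain * 16 * (n * (P I ⊔ 1) ^ 4))
    read-off (run {τ} {t} halts t≤ (answer , out , correct)) = τ , t , answer , halts , in-bound kMain t≤ , out , correct

theorem5 : SolvableInTimeO (λ I → Instance.n I * (P I ⊔ 1) ^ 4)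
theorem5 = MAIN , kMain * 16 , Solve.solved
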